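{- Let $E/F$ be an unramified cubic field extension of non-Archimedean local fields, $x\in\mathcal O_E^\times$ with $\mathcal O_E=\mathfrak o[x]$, $n\ge0$ an integer, and $R=\mathfrak o[\pi^nx]$. For integers $s,f\ge 0$ with $0\le s-f\le\min(n,f)$ and $c\in\mathfrak o$ put $$\mathcal O^1_{s,f,c}=\mathfrak o\langle1,\ \pi^{s-f}(x+c\pi^{f-\min(n,f)}x^2),\ \pi^fx^2\rangle,\qquad \mathcal O^2_{s,f,c}=\mathfrak o\langle1,\ \pi^fx,\ \pi^{s-f}(c\pi x+x^2)\rangle,$$ where for $\mathcal O^2_{s,f,c}$ it is also required that $f>s-f$. Then: $\mathcal O^1_{s,f,c}$ is an overorder of $R$ if and only if $\frac12s\le f\le\frac23s$ and $s\le f+n$; $\mathcal O^2_{s,f,c}$ is an overorder of $R$ if and only if $\frac12s<f\le\frac23s$ and $f\le n$. Moreover, for those $\mathcal O^i_{s,f,c}$ that are overorders of $R$: (1) $S(\mathcal O^i_{s,f,c})=s$ and $f(\mathcal O^i_{s,f,c})=f$ for $i=1,2$; (2) $\mathcal O^1_{s,f,c}=\mathcal O^1_{s',f',c'}$ if and only if $(s,f)=(s',f')$ and $c-c'\in(\pi^{\min(n,f)-(s-f)})$; and $\mathcal O^2_{s,f,c}=\mathcal O^2_{s',f',c'}$ if and only if $(s,f)=(s',f')$ and $c-c'\in(\pi^{2f-s-1})$; (3) $\mathcal O^1_{s,f,c}\ne\mathcal O^2_{s',f',c'}$ for $s'<2f'$; (4) $\mathcal O^i_{s,f,c}$ is Gorenstein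 if and only if $\frac32f=s$, for $i=1,2$. These give an explicit classification of all overorders of $R$ (every overorder of $R$ is one of these).
   Context: $F$ has any characteristic, ring of integers $\mathfrak o$, uniformizer $\pi$. $\mathfrak o\langle u_1,u_2,u_3\rangle$ denotes the $\mathfrak o$-submodule of $E$ generated by $u_1,u_2,u_3$. An order of $E$ is a subring $\mathcal O\subset E$ containing $\mathfrak o$, finitely generated as an $\mathfrak o$-module, with $F\mathcal O=E$; an overorder of $R$ is an order containing $R$. $S(\mathcal O)$ is the $\mathfrak o$-length of $\mathcal O_E/\mathcal O$; $f(\mathcal O)\ge0$ is defined by $\{a\in\mathcal O_E:a\mathcal O_E\subset\mathcal O\}=\pi^{f(\mathcal O)}\mathcal O_E$. A fractional $\mathcal O$-ideal is a nonzero finitely generated $\mathcal O$-submodule $I\subset E$; it is invertible if $IJ=\mathcal O$ for some fractional ideal $J$. $\mathcal O$ is Gorenstein if every fractional $\mathcal O$-ideal $I$ with $\{y\in E:yI\subset I\}=\mathcal O$ is invertible. -}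

module Defs where

open import Algebra.Bundles using (CommutativeRing)
open import Algebra.Morphism.Structures using (IsRingHomomorphism)
open import Data.Fin.Base using (Fin; toℕ; inject₁)
import Data.Fin.Base as Fin
open import Data.Integer.Base as ℤ using (ℤ; 0ℤ; 1ℤ)
open import Data.Maybe.Base using (map; zipWith)
open import Data.Nat.Base as ℕ using (ℕ; suc)
open import Data.Product.Base using (Σ-syntax; ∃-syntax; _×_)
open import Data.Vec.Functional using (Vector; []; _∷_)
open import Level using (Level; _⊔_) renaming (suc to lsuc)
open import Relation.Binary.Construct.Add.Supremum.NonStrict ℤ._≤_ using (_≤⁺_)
open import Relation.Binary.PropositionalEquality.Core using (_≡_)
open import Relation.Nullary.Construct.Add.Supremum using (_⁺; [_]; ⊤⁺)
open import Relation.Nullary.Negation.Core using (¬_)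
open import Relation.Unary using (Pred; _∈_; _⊆_; _≐_; _∖_; Satisfiable)

record Field (c ℓ : Level) : Set (lsuc (c ⊔ ℓ)) where
  field
    commutativeRing : CommutativeRing c ℓ

  open CommutativeRing commutativeRing public

  field
    1≉0     : ¬ 1# ≈ 0#
    inverse : ∀ x → ¬ x ≈ 0# → ∃[ y ] x * y ≈ 1#

-- A local field is given together with its normalised valuation v, where
-- v x = ⊤⁺ plays the role of v x = +∞.

record NonArchimedeanLocalField (c ℓ : Level) : Set (lsuc (c ⊔ ℓ)) where
  field
    field′ : Field c ℓ

  open Field field′ public

  field
    v        : Carrier → ℤ ⁺
    v-cong   : ∀ {x y} → x ≈ y → v x ≡ v y
    v-0      : v 0# ≡ ⊤⁺
    v-⊤      : ∀ {x} → v x ≡ ⊤⁺ → x ≈ 0#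
    v-*      : ∀ x y → v (x * y) ≡ zipWith ℤ._+_ (v x) (v y)
    v-+      : ∀ x y {k} → k ≤⁺ v x → k ≤⁺ v y → k ≤⁺ v (x + y)
    v-onto   : ∃[ x ] v x ≡ [ 1ℤ ]
    complete : (a : ℕ → Carrier) →
               (∀ k → ∃[ N ] (∀ i j → N ℕ.≤ i → N ℕ.≤ j → [ k ] ≤⁺ v (a i - a j))) →
               ∃[ l ] (∀ k → ∃[ N ] (∀ i → N ℕ.≤ i → [ k ] ≤⁺ v (a i - l)))

  Integral : Pred Carrier _
  Integral x = [ 0ℤ ] ≤⁺ v x

  IsUniformizer : Pred Carrier _
  IsUniformizer x = v x ≡ [ 1ℤ ]

  field
    finiteResidueField : ∃[ q ] Σ[ r ∈ (Fin q → Carrier) ]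
                         (∀ x → x ∈ Integral → ∃[ i ] [ 1ℤ ] ≤⁺ v (x - r i))

  open import Algebra.Properties.Semiring.Exp semiring public using (_^_)
  open import Algebra.Properties.Semiring.Sum semiring public using (sum)

record FiniteExtension {c ℓ : Level} (F E : NonArchimedeanLocalField c ℓ) : Set (c ⊔ ℓ) where
  private
    module F = NonArchimedeanLocalField F
    module E = NonArchimedeanLocalField E

  field
    ι                  : F.Carrier → E.Carrier
    isRingHomomorphism : IsRingHomomorphism F.rawRing E.rawRing ι
    degree             : ℕ
    basis              : Vector E.Carrier degree
    spanning           : ∀ y → Σ[ a ∈ Vector F.Carrier degree ]
                         y E.≈ E.sum (λ i → ι (a i) E.* basis i)
    independent        : (a : Vector F.Carrier degree) →
                         E.sum (λ i → ι (a i) E.* basis i) E.≈ E.0# → ∀ i → a i F.≈ F.0#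
    ramificationIndex  : ℕ
    v-ι                : ∀ a → E.v (ι a) ≡ map (ℤ.+ ramificationIndex ℤ.*_) (F.v a)

  -- The residue fields are finite, so the residue extension is
  -- automatically separable.
  Unramified : Set
  Unramified = ramificationIndex ≡ 1

module Orders {c ℓ : Level} {F E : NonArchimedeanLocalField c ℓ} (E/F : FiniteExtension F E) where
  private
    module F = NonArchimedeanLocalField F
    module E = NonArchimedeanLocalField E
  open E using (Carrier; _≈_; _+_; _*_; -_; 0#; 1#; _^_; sum)
  open FiniteExtension E/F using (ι)

  -- Subsets of E; F and 𝔬 are regarded as subsets of E through ι.
  Subset : Set (lsuc (c ⊔ ℓ))
  Subset = Pred Carrier (c ⊔ ℓ)

  Fᴱ : Subset
  Fᴱ y = ∃[ a ] ι a ≈ y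

  𝔬ᴱ : Subset
  𝔬ᴱ y = ∃[ a ] a ∈ F.Integral × ι a ≈ y

  𝒪ᴱ : Pred Carrier _
  𝒪ᴱ = E.Integral

  𝒪ᴱˣ : Pred Carrier _
  𝒪ᴱˣ x = x ∈ 𝒪ᴱ × ∃[ y ] y ∈ 𝒪ᴱ × x * y ≈ 1#

  Span : Subset → {k : ℕ} → Vector Carrier k → Subset
  Span A {k} u y = Σ[ a ∈ Vector Carrier k ] (∀ i → a i ∈ A) × y ≈ sum (λ i → a i * u i)

  𝔬⟨_,_,_⟩ : Carrier → Carrier → Carrier → Subset
  𝔬⟨ u₁ , u₂ , u₃ ⟩ = Span 𝔬ᴱ (u₁ ∷ u₂ ∷ u₃ ∷ [])

  𝔬[_] : Carrier → Subset
  𝔬[ x ] y = ∃[ k ] y ∈ Span 𝔬ᴱ {k} (λ i → x ^ toℕ i)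

  -- The finite sums of products ab with a ∈ A and b ∈ B.
  infixl 7 _·_
  _·_ : Subset → Subset → Subset
  (A · B) y = ∃[ k ] Σ[ b ∈ Vector Carrier k ] (∀ i → b i ∈ B) × y ∈ Span A b

  FinitelyGenerated : Subset → Subset → Set (c ⊔ ℓ)
  FinitelyGenerated A M = ∃[ k ] Σ[ u ∈ Vector Carrier k ] M ≐ Span A u

  record IsSubring (A : Subset) : Set (c ⊔ ℓ) where
    field
      resp     : ∀ {y z} → y ≈ z → y ∈ A → z ∈ A
      0-mem    : 0# ∈ A
      1-mem    : 1# ∈ A
      +-closed : ∀ {y z} → y ∈ A → z ∈ A → y + z ∈ A
      neg      : ∀ {y} → y ∈ A → - y ∈ A
      *-closed : ∀ {y z} → y ∈ A → z ∈ A → y * z ∈ A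

  -- A is meant to be a subring of E; closure under negation then follows
  -- from - 1# ∈ A.
  record IsSubmodule (A M : Subset) : Set (c ⊔ ℓ) where
    field
      resp     : ∀ {y z} → y ≈ z → y ∈ M → z ∈ M
      0-mem    : 0# ∈ M
      +-closed : ∀ {y z} → y ∈ M → z ∈ M → y + z ∈ M
      scale    : ∀ {a y} → a ∈ A → y ∈ M → a * y ∈ M

  record IsOrder (O : Subset) : Set (c ⊔ ℓ) where
    field
      isSubring         : IsSubring O
      𝔬-contained       : 𝔬ᴱ ⊆ O
      finitelyGenerated : FinitelyGenerated 𝔬ᴱ O
      FO=E              : ∀ y → y ∈ Fᴱ · O

  IsOverorder : Subset → Subset → Set (c ⊔ ℓ)
  IsOverorder R O = IsOrder O × R ⊆ O

  -- A strict chain of l + 1 submodules of 𝒪ᴱ / O, i.e. of submodules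
  -- of 𝒪ᴱ containing O.
  record Chain (O : Subset) (l : ℕ) : Set (lsuc (c ⊔ ℓ)) where
    field
      term        : Fin (suc l) → Subset
      isSubmodule : ∀ i → IsSubmodule 𝔬ᴱ (term i)
      above       : ∀ i → O ⊆ term i
      below       : ∀ i → term i ⊆ 𝒪ᴱ
      increasing  : ∀ (i : Fin l) → term (inject₁ i) ⊆ term (Fin.suc i)
      strict      : ∀ (i : Fin l) → Satisfiable (term (Fin.suc i) ∖ term (inject₁ i))

  -- S(O) = s : the 𝔬-length of 𝒪ᴱ / O is the maximal length of a strict
  -- chain of its 𝔬-submodules.
  S[_]≡_ : Subset → ℕ → Set (lsuc (c ⊔ ℓ))
  S[ O ]≡ s = Chain O s × (∀ l → Chain O l → l ℕ.≤ s)

  conductor : Subset → Subset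
  conductor O a = a ∈ 𝒪ᴱ × (∀ {b} → b ∈ 𝒪ᴱ → a * b ∈ O)

  multiplierRing : Subset → Subset
  multiplierRing I y = ∀ {z} → z ∈ I → y * z ∈ I

  record IsFractionalIdeal (O I : Subset) : Set (c ⊔ ℓ) where
    field
      isSubmodule       : IsSubmodule O I
      finitelyGenerated : FinitelyGenerated O I
      nonzero           : ∃[ y ] y ∈ I × ¬ y ≈ 0#

  Invertible : Subset → Subset → Set (lsuc (c ⊔ ℓ))
  Invertible O I = Σ[ J ∈ Subset ] IsFractionalIdeal O J × I · J ≐ O

  Gorenstein : Subset → Set (lsuc (c ⊔ ℓ))
  Gorenstein O = (I : Subset) → IsFractionalIdeal O I → multiplierRing I ≐ O → Invertible O I

  module Lattices (π : F.Carrier) (x : Carrier) (n : ℕ) where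

    ϖ : Carrier
    ϖ = ι π

    -- f(O) = f.
    f[_]≡_ : Subset → ℕ → Set (c ⊔ ℓ)
    f[ O ]≡ f = conductor O ≐ (λ y → ∃[ z ] z ∈ 𝒪ᴱ × y ≈ ϖ ^ f * z)

    -- The ideal (π ^ k) of 𝔬.
    ⟨π^_⟩ : ℕ → Pred F.Carrier (c ⊔ ℓ)
    ⟨π^ k ⟩ a = ∃[ b ] b ∈ F.Integral × a F.≈ (π F.^ k) F.* b

    R : Subset
    R = 𝔬[ ϖ ^ n * x ]

    O¹ : ℕ → ℕ → F.Carrier → Subset
    O¹ s f c = 𝔬⟨ 1# , ϖ ^ (s ℕ.∸ f) * (x + ι c * ϖ ^ (f ℕ.∸ n ℕ.⊓ f) * x ^ 2) , ϖ ^ f * x ^ 2 ⟩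

    O² : ℕ → ℕ → F.Carrier → Subset
    O² s f c = 𝔬⟨ 1# , ϖ ^ f * x , ϖ ^ (s ℕ.∸ f) * (ι c * ϖ * x + x ^ 2) ⟩

    -- The conditions under which O¹ s f c, respectively O² s f c, is
    -- defined; in particular every truncated subtraction above is exact.
    Admissible¹ : ℕ → ℕ → F.Carrier → Set
    Admissible¹ s f c = f ℕ.≤ s × s ℕ.∸ f ℕ.≤ n ℕ.⊓ f × c ∈ F.Integral

    Admissible² : ℕ → ℕ → F.Carrier → Set
    Admissible² s f c = Admissible¹ s f c × s ℕ.∸ f ℕ.< f

    Overorder¹ : ℕ → ℕ → F.Carrier → Set (c ⊔ ℓ)
    Overorder¹ s f c = Admissible¹ s f c × IsOverorder R (O¹ s f c)

    Overorder² : ℕ → ℕ → F.Carrier → Set (c ⊔ ℓ)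
    Overorder² s f c = Admissible² s f c × IsOverorder R (O² s f c)

{-# OPTIONS --safe #-}

-- Over the basis 1, x, x² (completeness of F and degree 3 make it an 𝔬-basis of 𝒪ᴱ) every order
-- O ⊇ R is 𝔬⟨1, π^a u, π^f w⟩ with a ≤ f, for an 𝔬-basis 1, u, w of 𝒪ᴱ; the two families record
-- in which coordinate the minimal valuation a is attained. Since the residue extension has degree 3,
-- the w-coefficient of u² is a unit, so such a lattice is a ring exactly when f ≤ 2a. It is
-- Gorenstein exactly when f = 2a: then it is monogenic over 𝔬 with simple socle of E/O, while for
-- f < 2a its dual is a non-invertible ideal with multiplier ring O.

module Submission where

open import Algebra.Bundles using (CommutativeRing)
open import Algebra.Morphism.Structures using (module IsRingHomomorphism)
open import Algebra.Solver.Ring.AlmostCommutativeRing using (_-Raw-AlmostCommutative⟶_; fromCommutativeRing)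
open import Data.Empty using (⊥)
open import Data.Fin.Base using (Fin; zero; suc; inject₁; punchIn; toℕ)
open import Data.Fin.Properties using (any?)
open import Data.Integer.Base as ℤ using (ℤ; +_; -[1+_]; 0ℤ; 1ℤ; _⊖_)
import Data.Integer.Properties as ℤ
open import Algebra.Properties.AbelianGroup ℤ.+-0-abelianGroup using () renaming (∙-cancelˡ to ℤ-cancelˡ)
open import Data.Maybe.Base as Maybe using (Maybe; just; nothing; zipWith)
open import Data.Maybe.Properties using (just-injective; map-cong; map-id)
open import Data.Nat.Base as ℕ using (ℕ; zero; suc)
import Data.Nat.Properties as ℕ
open import Data.Nat.Tactic.RingSolver using () renaming (solve-∀ to ℕ-solve)
open import Data.Product.Base using (∃-syntax; Σ-syntax; _×_; _,_; proj₁; proj₂)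
open import Data.Sum.Base as Sum using (_⊎_; inj₁; inj₂)
open import Data.Vec.Functional using (Vector; insertAt; _∷_; [])
open import Data.Vec.Functional.Properties using (insertAt-lookup; insertAt-punchIn)
open import Defs
open import Function.Base using (case_of_)
open import Function.Bundles using (_⇔_; mk⇔; Equivalence)
open import Level using (Level; _⊔_)
open import Relation.Binary.Construct.Add.Supremum.NonStrict ℤ._≤_ using (_≤⁺_; [_]; _≤⊤⁺; ≤⁺-dec; ≤⁺-trans; [≤]-injective)
import Relation.Binary.PropositionalEquality.Core as ≡
open ≡ using (_≡_)
open import Relation.Nullary.Construct.Add.Supremum using ([_]; ⊤⁺)
open import Relation.Nullary.Decidable.Core using (Dec; yes; no; ¬?; decidable-stable)
open import Relation.Nullary.Negation.Core using (¬_; contradiction)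
open import Relation.Unary using (_∈_; _⊆_; _≐_)

-- All statements about `Λ a f` are proved once, for an arbitrary integral basis `1, u, w`; a
-- unipotent change of basis (preceded by exchanging `x` and `x ^ 2` for the second family) makes
-- both families instances, with `a = s - f`. So `s = a + f` is the length, `a ≤ f` reads `s ≤ 2f`,
-- and `f ≤ 2a` reads `3f ≤ 2s`. The integer `n` enters only through the membership of `π^n x`. For
-- `u = x + t x²` and `w = x²` one has `π^n x = π^n u - π^n t w`, so membership costs `a ≤ n` and
-- `f ≤ n + v t`: this is the origin of the factor `π^(f - min(n,f))` in `t`. For `w = x` it costs
-- `f ≤ n`. Since `u` matters only modulo `π^(f - a) w`, the parameter `c` matters modulo
-- `π^(min(n,f) - a)`, respectively `π^(f - a - 1)`. The obstacle is that submodules are arbitrary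
-- predicates, without decidable membership or an index: chain lengths are bounded by enlarging a
-- lattice in Hermite form by one witness of strictness at a time, and the same reduction classifies
-- the orders.

-- Ring solver with integer coefficients

module IntegerCoefficients {c ℓ} (R : CommutativeRing c ℓ) where
  open CommutativeRing R
  open import Algebra.Properties.Ring ring using (-0#≈0#; -‿distribˡ-*; -‿distribʳ-*; -‿+-comm; -‿involutive)
  open import Algebra.Properties.Semiring.Mult.TCOptimised semiring using (×-homo-+; 1+×; ×1-homo-*) renaming (_×_ to _×′_)
  open import Relation.Binary.Reasoning.Setoid setoid

  ⟦_⟧ℤ : ℤ → Carrier
  ⟦ + n ⟧ℤ      = n ×′ 1#
  ⟦ -[1+ n ] ⟧ℤ = - (suc n ×′ 1#)

  private
    cancel : ∀ a b → (1# + a) - (1# + b) ≈ a - b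
    cancel a b = begin
      (1# + a) - (1# + b)     ≈⟨ +-cong (+-comm 1# a) (sym (-‿+-comm 1# b)) ⟩
      (a + 1#) + (- 1# - b)   ≈⟨ +-assoc a 1# _ ⟩
      a + (1# + (- 1# - b))   ≈⟨ +-congˡ (+-assoc 1# (- 1#) (- b)) ⟨
      a + ((1# - 1#) - b)     ≈⟨ +-congˡ (+-congʳ (-‿inverseʳ 1#)) ⟩
      a + (0# - b)            ≈⟨ +-congˡ (+-identityˡ _) ⟩
      a - b                   ∎

    ⊖-homo : ∀ m n → ⟦ m ⊖ n ⟧ℤ ≈ m ×′ 1# - n ×′ 1#
    ⊖-homo zero    zero    = sym (-‿inverseʳ 0#)
    ⊖-homo zero    (suc n) = sym (+-identityˡ _)
    ⊖-homo (suc m) zero    = begin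
      suc m ×′ 1#       ≈⟨ +-identityʳ _ ⟨
      suc m ×′ 1# + 0#  ≈⟨ +-congˡ -0#≈0# ⟨
      suc m ×′ 1# - 0#  ∎
    ⊖-homo (suc m) (suc n) = begin
      ⟦ suc m ⊖ suc n ⟧ℤ               ≡⟨ ≡.cong ⟦_⟧ℤ (ℤ.[1+m]⊖[1+n]≡m⊖n m n) ⟩
      ⟦ m ⊖ n ⟧ℤ                       ≈⟨ ⊖-homo m n ⟩
      m ×′ 1# - n ×′ 1#                ≈⟨ cancel _ _ ⟨
      (1# + m ×′ 1#) - (1# + n ×′ 1#)  ≈⟨ +-cong (1+× m 1#) (-‿cong (1+× n 1#)) ⟨
      suc m ×′ 1# - suc n ×′ 1#        ∎

    +-homo : ∀ i j → ⟦ i ℤ.+ j ⟧ℤ ≈ ⟦ i ⟧ℤ + ⟦ j ⟧ℤ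
    +-homo (+ m)    (+ n)    = ×-homo-+ 1# m n
    +-homo (+ m)    -[1+ n ] = ⊖-homo m (suc n)
    +-homo -[1+ m ] (+ n)    = trans (⊖-homo n (suc m)) (+-comm _ _)
    +-homo -[1+ m ] -[1+ n ] = begin
      - (suc (suc (m ℕ.+ n)) ×′ 1#)        ≈⟨ -‿cong (1+× (suc (m ℕ.+ n)) 1#) ⟩
      - (1# + suc (m ℕ.+ n) ×′ 1#)         ≈⟨ -‿cong (+-congˡ (×-homo-+ 1# (suc m) n)) ⟩
      - (1# + (suc m ×′ 1# + n ×′ 1#))     ≈⟨ -‿cong (+-congˡ (+-comm _ _)) ⟩
      - (1# + (n ×′ 1# + suc m ×′ 1#))     ≈⟨ -‿cong (+-assoc 1# _ _) ⟨
      - ((1# + n ×′ 1#) + suc m ×′ 1#)     ≈⟨ -‿cong (+-congʳ (1+× n 1#)) ⟨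
      - (suc n ×′ 1# + suc m ×′ 1#)        ≈⟨ -‿cong (+-comm _ _) ⟩
      - (suc m ×′ 1# + suc n ×′ 1#)        ≈⟨ -‿+-comm _ _ ⟨
      - (suc m ×′ 1#) - suc n ×′ 1#        ∎

    -‿homo : ∀ i → ⟦ ℤ.- i ⟧ℤ ≈ - ⟦ i ⟧ℤ
    -‿homo (+ zero)  = sym -0#≈0#
    -‿homo (+ suc n) = refl
    -‿homo -[1+ n ]  = sym (-‿involutive _)

    *-homo : ∀ i j → ⟦ i ℤ.* j ⟧ℤ ≈ ⟦ i ⟧ℤ * ⟦ j ⟧ℤ
    *-homo⁺ : ∀ m j → ⟦ + m ℤ.* j ⟧ℤ ≈ m ×′ 1# * ⟦ j ⟧ℤ
    *-homo⁺ m (+ n) = begin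
      ⟦ + m ℤ.* + n ⟧ℤ    ≡⟨ ≡.cong ⟦_⟧ℤ (≡.sym (ℤ.pos-* m n)) ⟩
      (m ℕ.* n) ×′ 1#     ≈⟨ ×1-homo-* m n ⟩
      m ×′ 1# * n ×′ 1#   ∎
    *-homo⁺ m -[1+ n ] = begin
      ⟦ + m ℤ.* -[1+ n ] ⟧ℤ          ≡⟨ ≡.cong ⟦_⟧ℤ (ℤ.neg-distribʳ-* (+ m) (+ suc n)) ⟨
      ⟦ ℤ.- (+ m ℤ.* + suc n) ⟧ℤ     ≈⟨ -‿homo (+ m ℤ.* + suc n) ⟩
      - ⟦ + m ℤ.* + suc n ⟧ℤ         ≈⟨ -‿cong (*-homo⁺ m (+ suc n)) ⟩
      - (m ×′ 1# * suc n ×′ 1#)      ≈⟨ -‿distribʳ-* _ _ ⟩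
      m ×′ 1# * - (suc n ×′ 1#)      ∎
    *-homo (+ m) j = *-homo⁺ m j
    *-homo -[1+ m ] j = begin
      ⟦ -[1+ m ] ℤ.* j ⟧ℤ            ≡⟨ ≡.cong ⟦_⟧ℤ (ℤ.neg-distribˡ-* (+ suc m) j) ⟨
      ⟦ ℤ.- (+ suc m ℤ.* j) ⟧ℤ       ≈⟨ -‿homo (+ suc m ℤ.* j) ⟩
      - ⟦ + suc m ℤ.* j ⟧ℤ           ≈⟨ -‿cong (*-homo⁺ (suc m) j) ⟩
      - (suc m ×′ 1# * ⟦ j ⟧ℤ)       ≈⟨ -‿distribˡ-* _ _ ⟩
      - (suc m ×′ 1#) * ⟦ j ⟧ℤ       ∎

  private
    morphism : ℤ.+-*-rawRing -Raw-AlmostCommutative⟶ fromCommutativeRing R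
    morphism = record
      { ⟦_⟧    = ⟦_⟧ℤ
      ; +-homo = +-homo
      ; *-homo = *-homo
      ; -‿homo = -‿homo
      ; 0-homo = refl
      ; 1-homo = refl
      }

    -- Distinct integers may have equal images in positive characteristic, so unequal coefficients
    -- yield `nothing` rather than a refutation.
    _coeff≟_ : ∀ i j → Maybe (⟦ i ⟧ℤ ≈ ⟦ j ⟧ℤ)
    i coeff≟ j with i ℤ.≟ j
    ... | yes ≡.refl = just refl
    ... | no _       = nothing

  open import Algebra.Solver.Ring ℤ.+-*-rawRing (fromCommutativeRing R) morphism _coeff≟_ public
    using (solve; con; _:+_; _:*_; _:-_; :-_; _:=_)

-- Linear dependence over a field

module LinearDependence {c ℓ} (K : Field c ℓ) (0≟ : ∀ a → Dec (Field._≈_ K a (Field.0# K))) where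
  open Field K hiding (zero)
  open IntegerCoefficients commutativeRing
  open import Algebra.Properties.Semiring.Sum semiring
  open import Relation.Binary.Reasoning.Setoid setoid

  sum-zero : ∀ {n} (a : Vector Carrier n) → (∀ i → a i ≈ 0#) → sum a ≈ 0#
  sum-zero {n} a a≈0 = trans (sum-cong-≋ a≈0) (sum-replicate-zero n)

  dependence : ∀ m (A : Fin (suc m) → Vector Carrier m) →
               Σ[ a ∈ Vector Carrier (suc m) ] (∃[ i ] ¬ a i ≈ 0#) ×
               (∀ j → sum (λ i → a i * A i j) ≈ 0#)
  dependence zero    A = (λ _ → 1#) , (zero , 1≉0) , λ ()
  dependence (suc m) A with any? (λ k → ¬? (0≟ (A k zero)))
  ... | no all-zero =
    let a , (i , aᵢ≉0) , rel = dependence m (λ i j → A (suc i) (suc j))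
    in (0# ∷ a) , (suc i , aᵢ≉0) , λ where
      zero    → sum-zero _ λ i → trans (*-congˡ {(0# ∷ a) i} (A₀≈0 i)) (zeroʳ _)
      (suc j) → trans (+-cong (zeroˡ _) (rel j)) (+-identityˡ 0#)
    where
    A₀≈0 : ∀ k → A k zero ≈ 0#
    A₀≈0 k = decidable-stable (0≟ _) λ ≉0 → all-zero (k , ≉0)
  ... | yes (k , Aₖ₀≉0) = a , (punchIn k i , λ ≈0 → aᵢ≉0 (trans (reflexive (≡.sym (insertAt-punchIn a′ k _ i))) ≈0)) , rel
    where
    b = proj₁ (inverse _ Aₖ₀≉0)
    Aₖ₀b≈1 = proj₂ (inverse _ Aₖ₀≉0)
    p = punchIn k
    IH = dependence m (λ i j → A (p i) (suc j) - A (p i) zero * (b * A k (suc j)))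
    a′ = proj₁ IH
    i = proj₁ (proj₁ (proj₂ IH))
    aᵢ≉0 = proj₂ (proj₁ (proj₂ IH))
    s = sum (λ i → a′ i * A (p i) zero)
    -- The coefficient of the pivot row is forced by column zero, where the other rows contribute
    -- `s` and `b` inverts the pivot.
    a = insertAt a′ k (- (s * b))
    expand : ∀ j → sum (λ i → a i * A i j) ≈ - (s * b) * A k j + sum (λ i → a′ i * A (p i) j)
    expand j = trans (sum-remove {i = k} (λ i → a i * A i j))
      (+-cong (*-congʳ (reflexive (insertAt-lookup a′ k (- (s * b)))))
              (sum-cong-≋ λ i → *-congʳ {A (p i) j} (reflexive (insertAt-punchIn a′ k (- (s * b)) i))))
    rel : ∀ j → sum (λ i → a i * A i j) ≈ 0#
    rel zero = begin
      sum (λ i → a i * A i zero)      ≈⟨ expand zero ⟩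
      - (s * b) * A k zero + s        ≈⟨ solve 3 (λ s b z → :- (s :* b) :* z :+ s := s :* (con 1ℤ :- z :* b)) refl s b _ ⟩
      s * (1# - A k zero * b)         ≈⟨ *-congˡ (+-congˡ (-‿cong Aₖ₀b≈1)) ⟩
      s * (1# - 1#)                   ≈⟨ *-congˡ (-‿inverseʳ 1#) ⟩
      s * 0#                          ≈⟨ zeroʳ s ⟩
      0#                              ∎
    rel (suc j) = begin
      sum (λ i → a i * A i (suc j))   ≈⟨ expand (suc j) ⟩
      - (s * b) * z + sum (λ i → a′ i * A (p i) (suc j))
        ≈⟨ +-congˡ (sum-cong-≋ λ i → solve 4 (λ a′ x y w → a′ :* x := a′ :* (x :- y :* w) :+ (a′ :* y) :* w) refl
                                             (a′ i) (A (p i) (suc j)) (A (p i) zero) (b * z)) ⟩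
      - (s * b) * z + sum (λ i → a′ i * (A (p i) (suc j) - A (p i) zero * (b * z)) + (a′ i * A (p i) zero) * (b * z))
        ≈⟨ +-congˡ (∑-distrib-+ (λ i → a′ i * (A (p i) (suc j) - A (p i) zero * (b * z))) (λ i → (a′ i * A (p i) zero) * (b * z))) ⟩
      - (s * b) * z + (sum (λ i → a′ i * (A (p i) (suc j) - A (p i) zero * (b * z))) + sum (λ i → (a′ i * A (p i) zero) * (b * z)))
        ≈⟨ +-congˡ (+-cong (proj₂ (proj₂ IH) j) (sym (*-distribʳ-sum (b * z) (λ i → a′ i * A (p i) zero)))) ⟩
      - (s * b) * z + (0# + s * (b * z))
        ≈⟨ solve 3 (λ s b z → :- (s :* b) :* z :+ (con 0ℤ :+ s :* (b :* z)) := con 0ℤ) refl s b z ⟩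
      0# ∎
      where z = A k (suc j)

-- Arithmetic of the normalised valuation

module Valuation {c ℓ} (L : NonArchimedeanLocalField c ℓ) where
  open NonArchimedeanLocalField L
  open IntegerCoefficients commutativeRing using (solve; con; _:+_; _:*_; _:-_; :-_; _:=_)
  open import Algebra.Properties.Ring ring using (-1*x≈-x; -‿involutive)

  infix 4 _≤ᵛ_ _≤ᵛ?_

  -- Lower bounds include zero without a case split and add up under products; an exact valuation is
  -- mostly expressed as a power of the uniformizer times a unit.
  _≤ᵛ_ : ℕ → Carrier → Set
  k ≤ᵛ y = [ + k ] ≤⁺ v y

  _≤ᵛ?_ : ∀ k y → Dec (k ≤ᵛ y)
  k ≤ᵛ? y = ≤⁺-dec ℤ._≤?_ _ _

  IsUnit : Carrier → Set
  IsUnit y = v y ≡ [ 0ℤ ]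

  private
    ≤⁺-* : ∀ {i j a b} → [ i ] ≤⁺ a → [ j ] ≤⁺ b → [ i ℤ.+ j ] ≤⁺ zipWith ℤ._+_ a b
    ≤⁺-* [ p ]      [ q ]      = [ ℤ.+-mono-≤ p q ]
    ≤⁺-* [ p ]      (_ ≤⊤⁺)    = _ ≤⊤⁺
    ≤⁺-* (_ ≤⊤⁺)    _          = _ ≤⊤⁺

    i+i≡0⇒i≡0 : ∀ i → i ℤ.+ i ≡ 0ℤ → i ≡ 0ℤ
    i+i≡0⇒i≡0 (+ zero) _ = ≡.refl

    double≡0 : ∀ a → zipWith ℤ._+_ a a ≡ [ 0ℤ ] → a ≡ [ 0ℤ ]
    double≡0 [ i ] eq = ≡.cong [_] (i+i≡0⇒i≡0 i (just-injective eq))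

    +[]-injective : ∀ {i : ℤ} {a b} → zipWith ℤ._+_ [ i ] a ≡ zipWith ℤ._+_ [ i ] b → a ≡ b
    +[]-injective {i} {⊤⁺}    {⊤⁺}    eq = ≡.refl
    +[]-injective {i} {[ j ]} {[ k ]} eq = ≡.cong [_] (ℤ-cancelˡ i j k (just-injective eq))

    []+-cancel-≤ : ∀ {i j : ℤ} {a} → [ i ℤ.+ j ] ≤⁺ zipWith ℤ._+_ [ i ] a → [ j ] ≤⁺ a
    []+-cancel-≤ {a = ⊤⁺}    p     = _ ≤⊤⁺
    []+-cancel-≤ {i} {j} {a = [ k ]} [ p ] =
      [ ≡.subst₂ ℤ._≤_ (cancel j) (cancel k) (ℤ.+-monoʳ-≤ (ℤ.- i) p) ]
      where
      cancel : ∀ k → ℤ.- i ℤ.+ (i ℤ.+ k) ≡ k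
      cancel k = ≡.trans (≡.sym (ℤ.+-assoc (ℤ.- i) i k))
                         (≡.trans (≡.cong (ℤ._+ k) (ℤ.+-inverseˡ i)) (ℤ.+-identityˡ k))

  0≟ : ∀ y → Dec (y ≈ 0#)
  0≟ y with v y in eq
  ... | ⊤⁺    = yes (v-⊤ eq)
  ... | [ i ] = no λ y≈0 → contradiction (≡.trans (≡.sym eq) (≡.trans (v-cong y≈0) v-0)) λ ()

  ≤ᵛ-resp : ∀ {k y z} → y ≈ z → k ≤ᵛ y → k ≤ᵛ z
  ≤ᵛ-resp {k} y≈z = ≡.subst ([ + k ] ≤⁺_) (v-cong y≈z)

  ≤ᵛ-+ : ∀ {k y z} → k ≤ᵛ y → k ≤ᵛ z → k ≤ᵛ y + z
  ≤ᵛ-+ {k} {y} {z} = v-+ y z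

  ≤ᵛ-0 : ∀ {k} → k ≤ᵛ 0#
  ≤ᵛ-0 {k} = ≡.subst ([ + k ] ≤⁺_) (≡.sym v-0) (_ ≤⊤⁺)

  ≤ᵛ-* : ∀ {j k y z} → j ≤ᵛ y → k ≤ᵛ z → j ℕ.+ k ≤ᵛ y * z
  ≤ᵛ-* {j} {k} {y} {z} p q = ≡.subst ([ + (j ℕ.+ k) ] ≤⁺_) (≡.sym (v-* y z)) (≤⁺-* p q)

  ≤ᵛ-weaken : ∀ {j k y} → j ℕ.≤ k → k ≤ᵛ y → j ≤ᵛ y
  ≤ᵛ-weaken j≤k = ≤⁺-trans ℤ.≤-trans [ ℤ.+≤+ j≤k ]

  ≤ᵛ-*ˡ : ∀ {k y z} → k ≤ᵛ y → 0 ≤ᵛ z → k ≤ᵛ y * z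
  ≤ᵛ-*ˡ {k} {y} {z} p q = ≡.subst (_≤ᵛ y * z) (ℕ.+-identityʳ k) (≤ᵛ-* p q)

  ≤ᵛ-*ʳ : ∀ {k y z} → 0 ≤ᵛ y → k ≤ᵛ z → k ≤ᵛ y * z
  ≤ᵛ-*ʳ = ≤ᵛ-*

  -- From `1 = 1 * 1` the value `v 1#` is idempotent under addition, and it is finite because `1≉0`.
  isUnit-1 : IsUnit 1#
  isUnit-1 with v 1# in eq
  ... | ⊤⁺    = contradiction (v-⊤ eq) 1≉0
  ... | [ i ] = +[]-injective {i} (≡.trans (≡.sym vv) (≡.cong [_] (≡.sym (ℤ.+-identityʳ i))))
    where
    vv : [ i ] ≡ zipWith ℤ._+_ [ i ] [ i ]
    vv = ≡.trans (≡.sym eq) (≡.trans (v-cong (sym (*-identityˡ 1#)))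
           (≡.trans (v-* 1# 1#) (≡.cong (λ a → zipWith ℤ._+_ a a) eq)))

  isUnit-resp : ∀ {y z} → y ≈ z → IsUnit y → IsUnit z
  isUnit-resp y≈z unit = ≡.trans (≡.sym (v-cong y≈z)) unit

  isUnit-* : ∀ {y z} → IsUnit y → IsUnit z → IsUnit (y * z)
  isUnit-* {y} {z} p q = ≡.trans (v-* y z) (≡.cong₂ (zipWith ℤ._+_) p q)

  -- Twice the valuation of `-1` is that of `1`, and ℤ has no torsion.
  isUnit--1 : IsUnit (- 1#)
  isUnit--1 = double≡0 _ (≡.trans (≡.sym (v-* _ _))
    (isUnit-resp (sym (trans (-1*x≈-x (- 1#)) (-‿involutive 1#))) isUnit-1))

  isUnit⇒integral : ∀ {y} → IsUnit y → 0 ≤ᵛ y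
  isUnit⇒integral eq = ≡.subst ([ 0ℤ ] ≤⁺_) (≡.sym eq) [ ℤ.≤-refl ]

  isUnit⇒¬1≤ᵛ : ∀ {y} → IsUnit y → ¬ 1 ≤ᵛ y
  isUnit⇒¬1≤ᵛ eq p with ≡.subst ([ 1ℤ ] ≤⁺_) eq p
  ... | [ ℤ.+≤+ () ]

  isUnit-or-1≤ᵛ : ∀ {y} → 0 ≤ᵛ y → IsUnit y ⊎ 1 ≤ᵛ y
  isUnit-or-1≤ᵛ {y} p with v y
  ... | ⊤⁺          = inj₂ (_ ≤⊤⁺)
  ... | [ + zero ]  = inj₁ ≡.refl
  ... | [ + suc n ] = inj₂ [ ℤ.+≤+ (ℕ.s≤s ℕ.z≤n) ]
  isUnit-or-1≤ᵛ [ () ] | [ -[1+ n ] ]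

  ¬1≤ᵛ⇒isUnit : ∀ {y} → 0 ≤ᵛ y → ¬ 1 ≤ᵛ y → IsUnit y
  ¬1≤ᵛ⇒isUnit 0≤y 1≰y = Sum.[ (λ unit → unit) , (λ 1≤y → contradiction 1≤y 1≰y) ] (isUnit-or-1≤ᵛ 0≤y)

  isUnit⇒≉0 : ∀ {y} → IsUnit y → ¬ y ≈ 0#
  isUnit⇒≉0 unit y≈0 = contradiction (≡.trans (≡.sym unit) (≡.trans (v-cong y≈0) v-0)) λ ()

  ≤ᵛ-neg : ∀ {k y} → k ≤ᵛ y → k ≤ᵛ - y
  ≤ᵛ-neg p = ≤ᵛ-resp (-1*x≈-x _) (≤ᵛ-*ʳ (isUnit⇒integral isUnit--1) p)

  ≤ᵛ-- : ∀ {k y z} → k ≤ᵛ y → k ≤ᵛ z → k ≤ᵛ y - z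
  ≤ᵛ-- p q = ≤ᵛ-+ p (≤ᵛ-neg q)

  integral-1 : 0 ≤ᵛ 1#
  integral-1 = isUnit⇒integral isUnit-1

  ≤ᵛ-all⇒≈0 : ∀ {y} → (∀ k → k ≤ᵛ y) → y ≈ 0#
  ≤ᵛ-all⇒≈0 {y} p with v y in eq
  ... | ⊤⁺    = v-⊤ eq
  ... | [ i ] = contradiction ([≤]-injective (p (suc ℤ.∣ i ∣))) (too-big i)
    where
    too-big : ∀ i → ¬ + suc ℤ.∣ i ∣ ℤ.≤ i
    too-big (+ n) (ℤ.+≤+ n<n) = ℕ.<-irrefl ≡.refl n<n

  -- The valuation-ring property of the integers: the two valuations add up to zero, so they cannot
  -- both be negative.
  integral-or-inverse : ∀ {y z} → y * z ≈ 1# → 0 ≤ᵛ y ⊎ 0 ≤ᵛ z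
  integral-or-inverse {y} {z} yz≈1 = go (v y) (v z) ≡.refl ≡.refl
      (≡.trans (≡.sym (v-* y z)) (≡.trans (v-cong yz≈1) isUnit-1))
    where
    go : ∀ a b → v y ≡ a → v z ≡ b → zipWith ℤ._+_ (v y) (v z) ≡ [ 0ℤ ] → 0 ≤ᵛ y ⊎ 0 ≤ᵛ z
    go [ + m ] b eq _ _ = inj₁ (≡.subst ([ 0ℤ ] ≤⁺_) (≡.sym eq) [ ℤ.+≤+ ℕ.z≤n ])
    go [ -[1+ m ] ] [ + n ] _ eq _ = inj₂ (≡.subst ([ 0ℤ ] ≤⁺_) (≡.sym eq) [ ℤ.+≤+ ℕ.z≤n ])
    go [ -[1+ m ] ] [ -[1+ n ] ] eq eq′ sum≡0 with ≡.trans (≡.sym (≡.cong₂ (zipWith ℤ._+_) eq eq′)) sum≡0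
    ... | ()
    go [ -[1+ m ] ] ⊤⁺ eq eq′ sum≡0 with ≡.trans (≡.sym (≡.cong₂ (zipWith ℤ._+_) eq eq′)) sum≡0
    ... | ()
    go ⊤⁺ b eq eq′ sum≡0 with ≡.trans (≡.sym (≡.cong₂ (zipWith ℤ._+_) eq eq′)) sum≡0
    ... | ()

  isUnit-inverse : ∀ {y z} → IsUnit y → y * z ≈ 1# → IsUnit z
  isUnit-inverse {y} {z} unit yz≈1 = +[]-injective {0ℤ} (≡.trans (≡.sym (≡.cong (λ a → zipWith ℤ._+_ a (v z)) unit))
     (≡.trans (≡.sym (v-* y z)) (≡.trans (v-cong yz≈1) isUnit-1)))

  *-cancelˡ-≤ᵛ : ∀ {k y z} → IsUnit y → k ≤ᵛ y * z → k ≤ᵛ z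
  *-cancelˡ-≤ᵛ {k} {y} {z} unit p =
    []+-cancel-≤ {0ℤ} (≡.subst₂ _≤⁺_ (≡.cong [_] (≡.sym (ℤ.+-identityˡ (+ k)))) (≡.trans (v-* y z) (≡.cong (λ a → zipWith ℤ._+_ a (v z)) unit)) p)

  *≈0⇒≈0 : ∀ {y z} → ¬ y ≈ 0# → y * z ≈ 0# → z ≈ 0#
  *≈0⇒≈0 {y} {z} y≉0 yz≈0 with y⁻¹ , yy⁻¹≈1 ← inverse y y≉0 =
    trans (sym (*-identityˡ z)) (trans (*-congʳ (sym yy⁻¹≈1))
      (trans (solve 3 (λ y i z → y :* i :* z := y :* z :* i) refl y y⁻¹ z)
             (trans (*-congʳ yz≈0) (zeroˡ y⁻¹))))

  module _ {ϖ : Carrier} (vϖ≡1 : IsUniformizer ϖ) where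

    v-ϖ^ : ∀ k → v (ϖ ^ k) ≡ [ + k ]
    v-ϖ^ zero    = isUnit-1
    v-ϖ^ (suc k) = ≡.trans (v-* ϖ (ϖ ^ k)) (≡.cong₂ (zipWith ℤ._+_) vϖ≡1 (v-ϖ^ k))

    ≤ᵛ-ϖ^ : ∀ k → k ≤ᵛ ϖ ^ k
    ≤ᵛ-ϖ^ k = ≡.subst ([ + k ] ≤⁺_) (≡.sym (v-ϖ^ k)) [ ℤ.≤-refl ]

    integral-ϖ^ : ∀ k → 0 ≤ᵛ ϖ ^ k
    integral-ϖ^ k = ≤ᵛ-weaken ℕ.z≤n (≤ᵛ-ϖ^ k)

    ϖ^≉0 : ∀ k → ¬ ϖ ^ k ≈ 0#
    ϖ^≉0 k ≈0 = contradiction (≡.trans (≡.sym (v-ϖ^ k)) (≡.trans (v-cong ≈0) v-0)) λ ()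

    ϖ⁻ : ℕ → Carrier
    ϖ⁻ k = proj₁ (inverse (ϖ ^ k) (ϖ^≉0 k))

    ϖ^*ϖ⁻≈1 : ∀ k → ϖ ^ k * ϖ⁻ k ≈ 1#
    ϖ^*ϖ⁻≈1 k = proj₂ (inverse (ϖ ^ k) (ϖ^≉0 k))

    ϖ^-cancel-≤ᵛ : ∀ j {k y} → j ℕ.+ k ≤ᵛ ϖ ^ j * y → k ≤ᵛ y
    ϖ^-cancel-≤ᵛ j {k} {y} p = []+-cancel-≤ {+ j}
      (≡.subst ([ + (j ℕ.+ k) ] ≤⁺_) (≡.trans (v-* _ y) (≡.cong (λ a → zipWith ℤ._+_ a (v y)) (v-ϖ^ j))) p)

    ϖ^-*-isUnit : ∀ {j k e} → IsUnit e → j ≤ᵛ ϖ ^ k * e → j ℕ.≤ k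
    ϖ^-*-isUnit {j} {k} {e} unit p = ℤ.drop‿+≤+ (≡.subst (+ j ℤ.≤_) (ℤ.+-identityʳ (+ k))
      ([≤]-injective (≡.subst ([ + j ] ≤⁺_) (≡.trans (v-* _ e) (≡.cong₂ (zipWith ℤ._+_) (v-ϖ^ k) unit)) p)))

    ϖ^ϖ⁻-* : ∀ k y → y ≈ ϖ ^ k * (y * ϖ⁻ k)
    ϖ^ϖ⁻-* k y = trans (sym (*-identityʳ y)) (trans (*-congˡ (sym (ϖ^*ϖ⁻≈1 k)))
      (solve 3 (λ y a b → y :* (a :* b) := a :* (y :* b)) refl y (ϖ ^ k) (ϖ⁻ k)))

    ≤ᵛ⇒integral-*ϖ⁻ : ∀ {k y} → k ≤ᵛ y → 0 ≤ᵛ y * ϖ⁻ k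
    ≤ᵛ⇒integral-*ϖ⁻ {k} {y} p = ϖ^-cancel-≤ᵛ k (≤ᵛ-resp (ϖ^ϖ⁻-* k y)
      (≡.subst (_≤ᵛ y) (≡.sym (ℕ.+-identityʳ k)) p))

    ≉0⇒isUnit-*ϖ⁻ : ∀ {y} → 0 ≤ᵛ y → ¬ y ≈ 0# → ∃[ k ] IsUnit (y * ϖ⁻ k)
    ≉0⇒isUnit-*ϖ⁻ {y} p y≉0 with v y in eq
    ... | ⊤⁺      = contradiction (v-⊤ eq) y≉0
    ... | [ + k ] = k , +[]-injective {+ k} (≡.trans (≡.cong (λ a → zipWith ℤ._+_ a (v (y * ϖ⁻ k))) (≡.sym (v-ϖ^ k)))
        (≡.trans (≡.sym (v-* _ _)) (≡.trans (≡.sym (v-cong (ϖ^ϖ⁻-* k y))) (≡.trans eq (≡.cong [_] (≡.sym (ℤ.+-identityʳ (+ k))))))))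
    ≉0⇒isUnit-*ϖ⁻ [ () ] y≉0 | [ -[1+ m ] ]

    integral-ϖ^-* : ∀ y → ∃[ k ] 0 ≤ᵛ ϖ ^ k * y
    integral-ϖ^-* y with 0≟ y
    ... | yes y≈0 = 0 , ≤ᵛ-resp (sym (trans (*-congˡ y≈0) (zeroʳ _))) ≤ᵛ-0
    ... | no y≉0 with y⁻¹ , yy⁻¹≈1 ← inverse y y≉0 | integral-or-inverse yy⁻¹≈1
    ...   | inj₁ 0≤y = 0 , ≤ᵛ-*ʳ integral-1 0≤y
    ...   | inj₂ 0≤y⁻¹ with k , unit ← ≉0⇒isUnit-*ϖ⁻ 0≤y⁻¹ (λ ≈0 → 1≉0 (trans (sym yy⁻¹≈1) (trans (*-congˡ ≈0) (zeroʳ y)))) =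
      k , isUnit⇒integral (isUnit-inverse unit (trans
        (solve 4 (λ i d p y → i :* d :* (p :* y) := (y :* i) :* (p :* d)) refl y⁻¹ (ϖ⁻ k) (ϖ ^ k) y)
        (trans (*-cong yy⁻¹≈1 (ϖ^*ϖ⁻≈1 k)) (*-identityˡ 1#))))

-- Convergence of power series in the uniformizer

module Series {c ℓ} (L : NonArchimedeanLocalField c ℓ) {π : NonArchimedeanLocalField.Carrier L}
              (vπ≡1 : NonArchimedeanLocalField.IsUniformizer L π) where
  open NonArchimedeanLocalField L hiding (zero)
  open Valuation L
  open IntegerCoefficients commutativeRing using (solve; con; _:+_; _:*_; _:-_; :-_; _:=_)

  partialSum : (ℕ → Carrier) → ℕ → Carrier
  partialSum a zero    = 0#
  partialSum a (suc k) = partialSum a k + π ^ k * a k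

  module _ (a : ℕ → Carrier) (0≤a : ∀ i → 0 ≤ᵛ a i) where
    private
      s = partialSum a

      integral-s : ∀ i → 0 ≤ᵛ s i
      integral-s zero    = ≤ᵛ-0
      integral-s (suc i) = ≤ᵛ-+ (integral-s i) (≤ᵛ-* (integral-ϖ^ vπ≡1 i) (0≤a i))

      increment : ∀ i d → i ≤ᵛ s i - s (d ℕ.+ i)
      increment i zero    = ≤ᵛ-resp (sym (-‿inverseʳ (s i))) ≤ᵛ-0
      increment i (suc d) = ≤ᵛ-resp (solve 3 (λ x y z → (x :- y) :- z := x :- (y :+ z)) refl _ _ _)
        (≤ᵛ-- (increment i d) (≤ᵛ-weaken (ℕ.m≤n+m i d) (≤ᵛ-*ˡ (≤ᵛ-ϖ^ vπ≡1 (d ℕ.+ i)) (0≤a (d ℕ.+ i)))))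

      increment′ : ∀ {i j} → i ℕ.≤ j → i ≤ᵛ s i - s j
      increment′ {i} {j} i≤j = ≡.subst (λ j → i ≤ᵛ s i - s j) (ℕ.m∸n+n≡m i≤j) (increment i (j ℕ.∸ i))

      difference : ∀ {N i j} → N ℕ.≤ i → N ℕ.≤ j → N ≤ᵛ s i - s j
      difference {N} {i} {j} N≤i N≤j = ≤ᵛ-resp (solve 3 (λ x y z → (x :- z) :- (x :- y) := y :- z) refl (s N) (s i) (s j))
        (≤ᵛ-- (increment′ N≤j) (increment′ N≤i))

      cauchy : ∀ k → ∃[ N ] (∀ i j → N ℕ.≤ i → N ℕ.≤ j → [ k ] ≤⁺ v (s i - s j))
      cauchy (+ n)    = n , λ i j n≤i n≤j → difference n≤i n≤j
      cauchy -[1+ n ] = 0 , λ i j _ _ → ≤⁺-trans ℤ.≤-trans [ ℤ.-≤+ ] (≤ᵛ-- (integral-s i) (integral-s j))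

    -- The limit is compared with `s k` through the partial sum at index `N ⊔ k`, which is close to
    -- both. Integrality of `l` is the case `k = 0`, since `s 0` is zero.
    series-limit : ∃[ l ] 0 ≤ᵛ l × (∀ k → k ≤ᵛ s k - l)
    series-limit with l , conv ← complete s cauchy = l , ≤ᵛ-resp (solve 1 (λ l → :- (con 0ℤ :- l) := l) refl l) (≤ᵛ-neg (close 0)) , close
      where
      close : ∀ k → k ≤ᵛ s k - l
      close k with N , near ← conv (+ k) = ≤ᵛ-resp
        (solve 3 (λ x y z → (x :- y) :+ (y :- z) := x :- z) refl (s k) (s (N ℕ.⊔ k)) l)
        (≤ᵛ-+ (increment′ (ℕ.m≤n⊔m N k)) (near (N ℕ.⊔ k) (ℕ.m≤m⊔n N k)))

-- Scalars from F inside E, and spans over them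

module Extension {c ℓ} {F E : NonArchimedeanLocalField c ℓ} (E/F : FiniteExtension F E)
                 (unramified : FiniteExtension.Unramified E/F)
                 (π : NonArchimedeanLocalField.Carrier F)
                 (vπ≡1 : NonArchimedeanLocalField.IsUniformizer F π) where
  private
    module F = NonArchimedeanLocalField F
  open NonArchimedeanLocalField E hiding (zero)
  open FiniteExtension E/F using (ι; v-ι; isRingHomomorphism)
  open IsRingHomomorphism isRingHomomorphism using (+-homo; *-homo; -‿homo; 0#-homo; 1#-homo; ⟦⟧-cong)
  open Orders E/F
  open Valuation E public
  open IntegerCoefficients commutativeRing using (solve; con; _:+_; _:*_; _:-_; :-_; _:=_)
  open import Algebra.Properties.Semiring.Exp semiring using (^-homo-*)

  v-ι≡v : ∀ a → v (ι a) ≡ F.v a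
  v-ι≡v a = ≡.trans (v-ι a) (≡.trans (≡.cong (λ e → Maybe.map (ℤ.+ e ℤ.*_) (F.v a)) unramified)
    (≡.trans (map-cong ℤ.*-identityˡ (F.v a)) (map-id (F.v a))))

  ϖ : Carrier
  ϖ = ι π

  vϖ≡1 : IsUniformizer ϖ
  vϖ≡1 = ≡.trans (v-ι≡v π) vπ≡1

  ι-^ : ∀ a k → ι (a F.^ k) ≈ ι a ^ k
  ι-^ a zero    = 1#-homo
  ι-^ a (suc k) = trans (*-homo a (a F.^ k)) (*-congˡ (ι-^ a k))

  ι-- : ∀ a b → ι (a F.- b) ≈ ι a - ι b
  ι-- a b = trans (+-homo a (F.- b)) (+-congˡ (-‿homo b))

  ι-integral : ∀ {a} → a ∈ F.Integral → 0 ≤ᵛ ι a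
  ι-integral {a} = ≡.subst ([ 0ℤ ] ≤⁺_) (≡.sym (v-ι≡v a))

  Fᴱ-0 : Fᴱ 0#
  Fᴱ-0 = F.0# , 0#-homo

  Fᴱ-1 : Fᴱ 1#
  Fᴱ-1 = F.1# , 1#-homo

  Fᴱ-+ : ∀ {y z} → Fᴱ y → Fᴱ z → Fᴱ (y + z)
  Fᴱ-+ (a , p) (b , q) = a F.+ b , trans (+-homo a b) (+-cong p q)

  Fᴱ-* : ∀ {y z} → Fᴱ y → Fᴱ z → Fᴱ (y * z)
  Fᴱ-* (a , p) (b , q) = a F.* b , trans (*-homo a b) (*-cong p q)

  Fᴱ-neg : ∀ {y} → Fᴱ y → Fᴱ (- y)
  Fᴱ-neg (a , p) = F.- a , trans (-‿homo a) (-‿cong p)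

  Fᴱ-- : ∀ {y z} → Fᴱ y → Fᴱ z → Fᴱ (y - z)
  Fᴱ-- p q = Fᴱ-+ p (Fᴱ-neg q)

  Fᴱ-inverse : ∀ {y z} → Fᴱ y → y * z ≈ 1# → Fᴱ z
  Fᴱ-inverse {y} {z} (a , ιa≈y) yz≈1 = b , (begin
      ι b              ≈⟨ *-identityʳ _ ⟨
      ι b * 1#         ≈⟨ *-congˡ yz≈1 ⟨
      ι b * (y * z)    ≈⟨ *-congˡ (*-congʳ ιa≈y) ⟨
      ι b * (ι a * z)  ≈⟨ solve 3 (λ b a z → b :* (a :* z) := a :* b :* z) refl (ι b) (ι a) z ⟩
      ι a * ι b * z    ≈⟨ *-congʳ (*-homo a b) ⟨
      ι (a F.* b) * z  ≈⟨ *-congʳ (trans (⟦⟧-cong ab≈1) 1#-homo) ⟩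
      1# * z           ≈⟨ *-identityˡ z ⟩
      z                ∎)
    where
    open import Relation.Binary.Reasoning.Setoid setoid
    a≉0 : ¬ a F.≈ F.0#
    a≉0 a≈0 = 1≉0 (trans (sym yz≈1) (trans (*-congʳ (trans (sym ιa≈y) (trans (⟦⟧-cong a≈0) 0#-homo))) (zeroˡ z)))
    b = proj₁ (F.inverse a a≉0)
    ab≈1 = proj₂ (F.inverse a a≉0)

  Fᴱ-ϖ^ : ∀ k → Fᴱ (ϖ ^ k)
  Fᴱ-ϖ^ k = π F.^ k , ι-^ π k

  Fᴱ-ϖ⁻ : ∀ k → Fᴱ (ϖ⁻ vϖ≡1 k)
  Fᴱ-ϖ⁻ k = Fᴱ-inverse (Fᴱ-ϖ^ k) (ϖ^*ϖ⁻≈1 vϖ≡1 k)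

  𝔬⇒Fᴱ : ∀ {y} → 𝔬ᴱ y → Fᴱ y
  𝔬⇒Fᴱ (a , _ , eq) = a , eq

  𝔬⇒integral : ∀ {y} → 𝔬ᴱ y → 0 ≤ᵛ y
  𝔬⇒integral (a , p , eq) = ≤ᵛ-resp eq (ι-integral p)

  -- This is `F ∩ 𝒪ᴱ = 𝔬`. It splits membership in 𝔬 into rationality over F, which survives
  -- division, and a valuation bound.
  integral⇒𝔬 : ∀ {y} → Fᴱ y → 0 ≤ᵛ y → 𝔬ᴱ y
  integral⇒𝔬 {y} (a , eq) p = a , ≡.subst ([ 0ℤ ] ≤⁺_) (≡.trans (v-cong (sym eq)) (v-ι≡v a)) p , eq

  𝔬-isSubring : IsSubring 𝔬ᴱ
  𝔬-isSubring = record
    { resp     = λ { y≈z (a , p , eq) → a , p , trans eq y≈z }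
    ; 0-mem    = integral⇒𝔬 Fᴱ-0 ≤ᵛ-0
    ; 1-mem    = integral⇒𝔬 Fᴱ-1 integral-1
    ; +-closed = λ p q → integral⇒𝔬 (Fᴱ-+ (𝔬⇒Fᴱ p) (𝔬⇒Fᴱ q)) (≤ᵛ-+ (𝔬⇒integral p) (𝔬⇒integral q))
    ; neg      = λ p → integral⇒𝔬 (Fᴱ-neg (𝔬⇒Fᴱ p)) (≤ᵛ-neg (𝔬⇒integral p))
    ; *-closed = λ p q → integral⇒𝔬 (Fᴱ-* (𝔬⇒Fᴱ p) (𝔬⇒Fᴱ q)) (≤ᵛ-* (𝔬⇒integral p) (𝔬⇒integral q))
    }

  open IsSubring 𝔬-isSubring public using () renaming
    (resp to 𝔬-resp; 0-mem to 𝔬-0; 1-mem to 𝔬-1; +-closed to 𝔬-+; neg to 𝔬-neg; *-closed to 𝔬-*)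

  𝔬-- : ∀ {y z} → 𝔬ᴱ y → 𝔬ᴱ z → 𝔬ᴱ (y - z)
  𝔬-- p q = 𝔬-+ p (𝔬-neg q)

  𝔬-ϖ^ : ∀ k → 𝔬ᴱ (ϖ ^ k)
  𝔬-ϖ^ k = integral⇒𝔬 (Fᴱ-ϖ^ k) (integral-ϖ^ vϖ≡1 k)

  𝔬-ϖ : 𝔬ᴱ ϖ
  𝔬-ϖ = 𝔬-resp (*-identityʳ ϖ) (𝔬-ϖ^ 1)

  𝔬-ι : ∀ {a} → a ∈ F.Integral → 𝔬ᴱ (ι a)
  𝔬-ι {a} p = a , p , refl

  infix 4 _∣_

  _∣_ : Carrier → Carrier → Set (c Level.⊔ ℓ)
  a ∣ b = ∃[ d ] 𝔬ᴱ d × b ≈ a * d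

  ≤ᵛ⇒ϖ^∣ : ∀ {k y} → Fᴱ y → k ≤ᵛ y → ϖ ^ k ∣ y
  ≤ᵛ⇒ϖ^∣ {k} {y} Fy k≤y = y * ϖ⁻ vϖ≡1 k , integral⇒𝔬 (Fᴱ-* Fy (Fᴱ-ϖ⁻ k)) (≤ᵛ⇒integral-*ϖ⁻ vϖ≡1 k≤y) , ϖ^ϖ⁻-* vϖ≡1 k y

  ≉0⇒ϖ^-*-unit : ∀ {y} → 𝔬ᴱ y → ¬ y ≈ 0# → ∃[ k ] ∃[ e ] 𝔬ᴱ e × IsUnit e × y ≈ ϖ ^ k * e
  ≉0⇒ϖ^-*-unit {y} oy y≉0 with k , unit ← ≉0⇒isUnit-*ϖ⁻ vϖ≡1 (𝔬⇒integral oy) y≉0 =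
    k , y * ϖ⁻ vϖ≡1 k , integral⇒𝔬 (Fᴱ-* (𝔬⇒Fᴱ oy) (Fᴱ-ϖ⁻ k)) (isUnit⇒integral unit) , unit , ϖ^ϖ⁻-* vϖ≡1 k y

  𝔬-unit-inverse : ∀ {e} → 𝔬ᴱ e → IsUnit e → ∃[ e⁻¹ ] 𝔬ᴱ e⁻¹ × IsUnit e⁻¹ × e * e⁻¹ ≈ 1#
  𝔬-unit-inverse {e} oe unit with e⁻¹ , ee⁻¹≈1 ← inverse e (isUnit⇒≉0 unit) =
    e⁻¹ , integral⇒𝔬 (Fᴱ-inverse (𝔬⇒Fᴱ oe) ee⁻¹≈1) (isUnit⇒integral (isUnit-inverse unit ee⁻¹≈1))
        , isUnit-inverse unit ee⁻¹≈1 , ee⁻¹≈1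

  ϖ^-+ : ∀ j k → ϖ ^ (j ℕ.+ k) ≈ ϖ ^ j * ϖ ^ k
  ϖ^-+ = ^-homo-* ϖ

  ϖ^-∸ : ∀ {j k} → j ℕ.≤ k → ϖ ^ k ≈ ϖ ^ j * ϖ ^ (k ℕ.∸ j)
  ϖ^-∸ {j} {k} j≤k = trans (reflexive (≡.cong (ϖ ^_) (≡.sym (ℕ.m+[n∸m]≡n j≤k)))) (ϖ^-+ j (k ℕ.∸ j))

  module _ {A : Subset} (A-isSubring : IsSubring A) where
    private
      module A = IsSubring A-isSubring

    span-isSubmodule : ∀ {k} (u : Vector Carrier k) → IsSubmodule A (Span A u)
    span-isSubmodule {k} u = record
      { resp     = λ { y≈z (a , a∈A , eq) → a , a∈A , trans (sym y≈z) eq }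
      ; 0-mem    = (λ _ → 0#) , (λ _ → A.0-mem) , sym (trans (sum-cong-≋ (λ i → zeroˡ (u i))) (sum-replicate-zero k))
      ; +-closed = λ { (a , a∈A , eq) (b , b∈A , eq′) → (λ i → a i + b i) , (λ i → A.+-closed (a∈A i) (b∈A i)) ,
                     trans (+-cong eq eq′) (trans (sym (∑-distrib-+ (λ i → a i * u i) (λ i → b i * u i)))
                       (sum-cong-≋ (λ i → sym (distribʳ (u i) (a i) (b i))))) }
      ; scale    = λ { {s} {y} s∈A (a , a∈A , eq) → (λ i → s * a i) , (λ i → A.*-closed s∈A (a∈A i)) ,
                     trans (*-congˡ eq) (trans (*-distribˡ-sum s (λ i → a i * u i)) (sum-cong-≋ (λ i → sym (*-assoc s (a i) (u i))))) }
      }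
      where open import Algebra.Properties.Semiring.Sum semiring

    span-generator : ∀ {k} (u : Vector Carrier k) i → Span A u (u i)
    span-generator {suc k} u zero = (1# ∷ λ _ → 0#) , (λ { zero → A.1-mem ; (suc i) → A.0-mem }) ,
      sym (trans (+-cong (*-identityˡ _) (trans (sum-cong-≋ (λ i → zeroˡ (u (suc i)))) (sum-replicate-zero k))) (+-identityʳ _))
      where open import Algebra.Properties.Semiring.Sum semiring
    span-generator {suc k} u (suc i) with a , a∈A , eq ← span-generator (λ j → u (suc j)) i =
      (0# ∷ a) , (λ { zero → A.0-mem ; (suc i) → a∈A i }) ,
      trans eq (sym (trans (+-congʳ (zeroˡ _)) (+-identityˡ _)))

  span-⊆ : ∀ {A M : Subset} → IsSubmodule A M → ∀ {k} (u : Vector Carrier k) → (∀ i → u i ∈ M) → Span A u ⊆ M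
  span-⊆ {A} {M} M-isSubmodule u u∈M (a , a∈A , eq) = M.resp (sym eq) (go u u∈M a a∈A)
    where
    module M = IsSubmodule M-isSubmodule
    go : ∀ {k} (u : Vector Carrier k) → (∀ i → u i ∈ M) → (a : Vector Carrier k) → (∀ i → a i ∈ A) → sum (λ i → a i * u i) ∈ M
    go {zero}  u u∈M a a∈A = M.0-mem
    go {suc k} u u∈M a a∈A = M.+-closed (M.scale (a∈A zero) (u∈M zero))
      (go (λ i → u (suc i)) (λ i → u∈M (suc i)) (λ i → a (suc i)) (λ i → a∈A (suc i)))

  module _ {u₁ u₂ u₃ y : Carrier} where

    ∈⟨⟩ : ∀ {r p q} → 𝔬ᴱ r → 𝔬ᴱ p → 𝔬ᴱ q → y ≈ r * u₁ + p * u₂ + q * u₃ → 𝔬⟨ u₁ , u₂ , u₃ ⟩ y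
    ∈⟨⟩ {r} {p} {q} or op oq eq = (r ∷ p ∷ q ∷ []) , (λ { zero → or ; (suc zero) → op ; (suc (suc zero)) → oq }) ,
      trans eq (solve 3 (λ a b c → a :+ b :+ c := a :+ (b :+ (c :+ con 0ℤ))) refl (r * u₁) (p * u₂) (q * u₃))

    ∈⟨⟩⁻ : 𝔬⟨ u₁ , u₂ , u₃ ⟩ y → ∃[ r ] ∃[ p ] ∃[ q ] 𝔬ᴱ r × 𝔬ᴱ p × 𝔬ᴱ q × y ≈ r * u₁ + p * u₂ + q * u₃
    ∈⟨⟩⁻ (a , oa , eq) = a zero , a (suc zero) , a (suc (suc zero)) , oa _ , oa _ , oa _ ,
      trans eq (solve 3 (λ a b c → a :+ (b :+ (c :+ con 0ℤ)) := a :+ b :+ c) refl (a zero * u₁) (a (suc zero) * u₂) (a (suc (suc zero)) * u₃))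

-- Integral bases, finitely generated submodules and chains

module Bases {c ℓ} {F E : NonArchimedeanLocalField c ℓ} (E/F : FiniteExtension F E)
             (unramified : FiniteExtension.Unramified E/F)
             (π : NonArchimedeanLocalField.Carrier F)
             (vπ≡1 : NonArchimedeanLocalField.IsUniformizer F π) where
  open NonArchimedeanLocalField E hiding (zero)
  open Orders E/F
  open Extension E/F unramified π vπ≡1
  open IntegerCoefficients commutativeRing using (solve; con; _:+_; _:*_; _:-_; :-_; _:=_)
  open import Relation.Binary.Reasoning.Setoid setoid

  -- 1, u, w is an 𝔬-basis of 𝒪ᴱ and an F-basis of E.
  record IntegralBasis (u w : Carrier) : Set (c ⊔ ℓ) where
    field
      0≤u     : 0 ≤ᵛ u
      0≤w     : 0 ≤ᵛ w
      coords  : ∀ y → ∃[ r ] ∃[ p ] ∃[ q ] Fᴱ r × Fᴱ p × Fᴱ q × y ≈ r + p * u + q * w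
      bounded : ∀ {r p q} → Fᴱ r → Fᴱ p → Fᴱ q → 0 ≤ᵛ r + p * u + q * w → 0 ≤ᵛ r × 0 ≤ᵛ p × 0 ≤ᵛ q

    -- Divide by `ϖ ^ k` and apply `bounded`. Together with the ultrametric inequality this makes
    -- the valuation of an element the minimum of those of its coordinates.
    coords-≤ᵛ : ∀ {k r p q} → Fᴱ r → Fᴱ p → Fᴱ q → k ≤ᵛ r + p * u + q * w → k ≤ᵛ r × k ≤ᵛ p × k ≤ᵛ q
    coords-≤ᵛ {k} {r} {p} {q} Fr Fp Fq k≤y =
      let 0≤r , 0≤p , 0≤q = bounded (Fᴱ-* Fr (Fᴱ-ϖ⁻ k)) (Fᴱ-* Fp (Fᴱ-ϖ⁻ k)) (Fᴱ-* Fq (Fᴱ-ϖ⁻ k))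
            (≤ᵛ-resp (solve 6 (λ r p q u w d → (r :+ p :* u :+ q :* w) :* d := r :* d :+ p :* d :* u :+ q :* d :* w) refl r p q u w _)
                     (≤ᵛ⇒integral-*ϖ⁻ vϖ≡1 k≤y))
      in lift 0≤r , lift 0≤p , lift 0≤q
      where
      lift : ∀ {t} → 0 ≤ᵛ t * ϖ⁻ vϖ≡1 k → k ≤ᵛ t
      lift {t} p = ≤ᵛ-resp (sym (ϖ^ϖ⁻-* vϖ≡1 k t)) (≤ᵛ-*ˡ (≤ᵛ-ϖ^ vϖ≡1 k) p)

    -- Zero has every lower bound for its valuation, hence so do its coordinates; thus independence
    -- over F comes from `bounded`.
    coords-≈0 : ∀ {r p q} → Fᴱ r → Fᴱ p → Fᴱ q → r + p * u + q * w ≈ 0# → r ≈ 0# × p ≈ 0# × q ≈ 0#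
    coords-≈0 Fr Fp Fq eq = ≤ᵛ-all⇒≈0 (λ k → proj₁ (bound k)) , ≤ᵛ-all⇒≈0 (λ k → proj₁ (proj₂ (bound k)))
                          , ≤ᵛ-all⇒≈0 (λ k → proj₂ (proj₂ (bound k)))
      where
      bound = λ k → coords-≤ᵛ {k} Fr Fp Fq (≤ᵛ-resp (sym eq) ≤ᵛ-0)

    integral-coords : ∀ {y} → 0 ≤ᵛ y → ∃[ r ] ∃[ p ] ∃[ q ] 𝔬ᴱ r × 𝔬ᴱ p × 𝔬ᴱ q × y ≈ r + p * u + q * w
    integral-coords {y} 0≤y with r , p , q , Fr , Fp , Fq , eq ← coords y
      with 0≤r , 0≤p , 0≤q ← bounded Fr Fp Fq (≤ᵛ-resp eq 0≤y) =
      r , p , q , integral⇒𝔬 Fr 0≤r , integral⇒𝔬 Fp 0≤p , integral⇒𝔬 Fq 0≤q , eq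

  order⇒submodule : ∀ {O} → IsSubring O → 𝔬ᴱ ⊆ O → IsSubmodule 𝔬ᴱ O
  order⇒submodule O-isSubring 𝔬⊆O = record
    { resp = resp ; 0-mem = 0-mem ; +-closed = +-closed ; scale = λ oa y∈O → *-closed (𝔬⊆O oa) y∈O }
    where open IsSubring O-isSubring

  sub-closed : ∀ {A M y z} → IsSubring A → IsSubmodule A M → y ∈ M → z ∈ M → y - z ∈ M
  sub-closed {z = z} A-isSubring M-isSubmodule y∈M z∈M =
    M.+-closed y∈M (M.resp (-1*x≈-x z) (M.scale (IsSubring.neg A-isSubring (IsSubring.1-mem A-isSubring)) z∈M))
    where
    module M = IsSubmodule M-isSubmodule
    open import Algebra.Properties.Ring ring using (-1*x≈-x)

  module _ (u₁ u₂ u₃ : Carrier) where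
    private
      generators = u₁ ∷ u₂ ∷ u₃ ∷ []

    ⟨⟩-isSubmodule : IsSubmodule 𝔬ᴱ 𝔬⟨ u₁ , u₂ , u₃ ⟩
    ⟨⟩-isSubmodule = span-isSubmodule 𝔬-isSubring generators

    ∈⟨⟩₁ : u₁ ∈ 𝔬⟨ u₁ , u₂ , u₃ ⟩
    ∈⟨⟩₁ = span-generator 𝔬-isSubring generators zero

    ∈⟨⟩₂ : u₂ ∈ 𝔬⟨ u₁ , u₂ , u₃ ⟩
    ∈⟨⟩₂ = span-generator 𝔬-isSubring generators (suc zero)

    ∈⟨⟩₃ : u₃ ∈ 𝔬⟨ u₁ , u₂ , u₃ ⟩
    ∈⟨⟩₃ = span-generator 𝔬-isSubring generators (suc (suc zero))

    ⟨⟩-⊆ : ∀ {M} → IsSubmodule 𝔬ᴱ M → u₁ ∈ M → u₂ ∈ M → u₃ ∈ M → 𝔬⟨ u₁ , u₂ , u₃ ⟩ ⊆ M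
    ⟨⟩-⊆ M-isSubmodule m₁ m₂ m₃ = span-⊆ M-isSubmodule generators λ { zero → m₁ ; (suc zero) → m₂ ; (suc (suc zero)) → m₃ }

  ≐-trans : ∀ {O O′ O″ : Subset} → O ≐ O′ → O′ ≐ O″ → O ≐ O″
  ≐-trans (p , q) (p′ , q′) = (λ y∈ → p′ (p y∈)) , (λ y∈ → q (q′ y∈))

  ⟨⟩-cong : ∀ {u₁ u₂ u₃ u₂′ u₃′} → u₂ ≈ u₂′ → u₃ ≈ u₃′ → 𝔬⟨ u₁ , u₂ , u₃ ⟩ ≐ 𝔬⟨ u₁ , u₂′ , u₃′ ⟩
  ⟨⟩-cong p q = half p q , half (sym p) (sym q)
    where
    half : ∀ {u₁ u₂ u₃ u₂′ u₃′} → u₂ ≈ u₂′ → u₃ ≈ u₃′ → 𝔬⟨ u₁ , u₂ , u₃ ⟩ ⊆ 𝔬⟨ u₁ , u₂′ , u₃′ ⟩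
    half {u₁} {u₂} {u₃} {u₂′} {u₃′} p q = ⟨⟩-⊆ u₁ u₂ u₃ N (∈⟨⟩₁ u₁ u₂′ u₃′) (IsSubmodule.resp N (sym p) (∈⟨⟩₂ u₁ u₂′ u₃′)) (IsSubmodule.resp N (sym q) (∈⟨⟩₃ u₁ u₂′ u₃′))
      where N = ⟨⟩-isSubmodule u₁ u₂′ u₃′

  ⟨⟩-swap : ∀ {u₁ u₂ u₃} → 𝔬⟨ u₁ , u₂ , u₃ ⟩ ≐ 𝔬⟨ u₁ , u₃ , u₂ ⟩
  ⟨⟩-swap {u₁} {u₂} {u₃} = half u₂ u₃ , half u₃ u₂
    where
    half : ∀ u₂ u₃ → 𝔬⟨ u₁ , u₂ , u₃ ⟩ ⊆ 𝔬⟨ u₁ , u₃ , u₂ ⟩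
    half u₂ u₃ = ⟨⟩-⊆ u₁ u₂ u₃ (⟨⟩-isSubmodule u₁ u₃ u₂) (∈⟨⟩₁ u₁ u₃ u₂) (∈⟨⟩₃ u₁ u₃ u₂) (∈⟨⟩₂ u₁ u₃ u₂)

  restrict-scalars : ∀ {A B M} → B ⊆ A → IsSubmodule A M → IsSubmodule B M
  restrict-scalars B⊆A M-isSubmodule = record
    { resp = resp ; 0-mem = 0-mem ; +-closed = +-closed ; scale = λ b∈B → scale (B⊆A b∈B) }
    where open IsSubmodule M-isSubmodule

  sum-closed : ∀ {A M k} → IsSubmodule A M → (t : Vector Carrier k) → (∀ i → t i ∈ M) → sum t ∈ M
  sum-closed {k = zero}  M-isSubmodule t t∈M = IsSubmodule.0-mem M-isSubmodule
  sum-closed {k = suc k} M-isSubmodule t t∈M =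
    IsSubmodule.+-closed M-isSubmodule (t∈M zero) (sum-closed M-isSubmodule (λ i → t (suc i)) (λ i → t∈M (suc i)))

  -- 𝒪ᴱ is a valuation ring, so a generator of least valuation divides all the others.
  least-generator : ∀ {k} (u : Vector Carrier (suc k)) → ∃[ i ] ∀ j → ∃[ z ] 0 ≤ᵛ z × u j ≈ u i * z
  least-generator {zero}  u = zero , λ { zero → 1# , integral-1 , sym (*-identityʳ _) }
  least-generator {suc k} u with i , div ← least-generator (λ j → u (suc j)) | 0≟ (u zero)
  ... | yes u₀≈0 = suc i , λ { zero → 0# , ≤ᵛ-0 , trans u₀≈0 (sym (zeroʳ _)) ; (suc j) → div j }
  ... | no u₀≉0 with t , u₀t≈1 ← inverse _ u₀≉0 | 0≟ (u (suc i))
  ...   | yes uᵢ≈0 = zero , λ { zero    → 1# , integral-1 , sym (*-identityʳ _)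
                              ; (suc j) → let z , 0≤z , eq = div j in 0# , ≤ᵛ-0 , trans eq (trans (*-congʳ uᵢ≈0) (trans (zeroˡ z) (sym (zeroʳ _)))) }
  ...   | no uᵢ≉0 with s , uᵢs≈1 ← inverse _ uᵢ≉0
      with integral-or-inverse {u (suc i) * t} {u zero * s}
        (trans (solve 4 (λ a b c d → a :* b :* (c :* d) := (c :* b) :* (a :* d)) refl _ _ _ _) (trans (*-cong u₀t≈1 uᵢs≈1) (*-identityˡ 1#)))
  ...     | inj₁ 0≤uᵢt = zero , λ { zero    → 1# , integral-1 , sym (*-identityʳ _)
                                  ; (suc j) → let z , 0≤z , eq = div j in u (suc i) * t * z , ≤ᵛ-* 0≤uᵢt 0≤z ,
                                      trans eq (trans (sym (*-identityˡ _)) (trans (*-congʳ (sym u₀t≈1))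
                                        (solve 4 (λ a b c d → a :* b :* (c :* d) := a :* (c :* b :* d)) refl _ _ _ _))) }
  ...     | inj₂ 0≤u₀s = suc i , λ { zero    → u zero * s , 0≤u₀s , trans (sym (*-identityʳ _)) (trans (*-congˡ (sym uᵢs≈1))
                                        (solve 3 (λ a b c → a :* (b :* c) := b :* (a :* c)) refl _ _ _))
                                   ; (suc j) → div j }

  -- The integral multiples of `g` form an A-module because A consists of integral elements, so
  -- divisibility passes from the generators to all of `M`.
  least-element : ∀ {A M} → IsSubring A → A ⊆ 𝒪ᴱ → FinitelyGenerated A M → ∃[ y ] y ∈ M × ¬ y ≈ 0# →
                  ∃[ g ] g ∈ M × ¬ g ≈ 0# × (∀ {y} → y ∈ M → ∃[ z ] 0 ≤ᵛ z × y ≈ g * z)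
  least-element A-isSubring A⊆𝒪 (zero , u , M⊆ , ⊆M) (y , y∈M , y≉0) = contradiction (proj₂ (proj₂ (M⊆ y∈M))) y≉0
  least-element {A} {M} A-isSubring A⊆𝒪 (suc k , u , M⊆ , ⊆M) (y , y∈M , y≉0) with i , div ← least-generator u =
    u i , ⊆M (span-generator A-isSubring u i) , (λ uᵢ≈0 → y≉0 (let z , _ , eq = divides y∈M in trans eq (trans (*-congʳ uᵢ≈0) (zeroˡ z)))) , divides
    where
    Multiple : Subset
    Multiple y = ∃[ z ] 0 ≤ᵛ z × y ≈ u i * z
    multiple-isSubmodule : IsSubmodule A Multiple
    multiple-isSubmodule = record
      { resp     = λ { y≈y′ (z , 0≤z , eq) → z , 0≤z , trans (sym y≈y′) eq }
      ; 0-mem    = 0# , ≤ᵛ-0 , sym (zeroʳ _)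
      ; +-closed = λ { (z , 0≤z , eq) (z′ , 0≤z′ , eq′) → z + z′ , ≤ᵛ-+ 0≤z 0≤z′ , trans (+-cong eq eq′) (sym (distribˡ _ _ _)) }
      ; scale    = λ { {a} a∈A (z , 0≤z , eq) → a * z , ≤ᵛ-* (A⊆𝒪 a∈A) 0≤z , trans (*-congˡ eq) (solve 3 (λ a u z → a :* (u :* z) := u :* (a :* z)) refl a _ z) }
      }
    divides : ∀ {y} → y ∈ M → Multiple y
    divides y∈M = span-⊆ multiple-isSubmodule u div (M⊆ y∈M)

  -- Let `g` be an element of least valuation in the order. For `y` in the order `y * g` lies there
  -- too, so it is an integral multiple of `g`; cancelling `g` shows that `y` is integral.
  order⊆𝒪 : ∀ {O} → IsOrder O → O ⊆ 𝒪ᴱ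
  order⊆𝒪 {O} O-isOrder {y} y∈O
    with g , g∈O , g≉0 , div ← least-element 𝔬-isSubring 𝔬⇒integral (IsOrder.finitelyGenerated O-isOrder) (1# , IsSubring.1-mem (IsOrder.isSubring O-isOrder) , 1≉0)
    with z , 0≤z , yg≈gz ← div (IsSubring.*-closed (IsOrder.isSubring O-isOrder) y∈O g∈O) =
    ≤ᵛ-resp (sym y≈z) 0≤z
    where
    open import Algebra.Properties.Ring ring using (x∙y⁻¹≈ε⇒x≈y)
    y≈z : y ≈ z
    y≈z = x∙y⁻¹≈ε⇒x≈y y z (*≈0⇒≈0 g≉0 (trans (solve 3 (λ g y z → g :* (y :- z) := y :* g :- g :* z) refl g y z)
      (trans (+-congʳ yg≈gz) (-‿inverseʳ _))))

  chain-mono : ∀ {O O′ l} → O′ ⊆ O → Chain O l → Chain O′ l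
  chain-mono O′⊆O C = record
    { term = term ; isSubmodule = isSubmodule ; above = λ i y∈O′ → above i (O′⊆O y∈O′)
    ; below = below ; increasing = increasing ; strict = strict }
    where open Chain C

  chain-point : ∀ {O} → IsSubmodule 𝔬ᴱ O → O ⊆ 𝒪ᴱ → Chain O 0
  chain-point {O} O-isSubmodule O⊆𝒪 = record
    { term = λ _ → O ; isSubmodule = λ _ → O-isSubmodule ; above = λ _ y∈O → y∈O
    ; below = λ _ → O⊆𝒪 ; increasing = λ () ; strict = λ () }

  chain-cons : ∀ {O O′ l z} → IsSubmodule 𝔬ᴱ O → O ⊆ 𝒪ᴱ → O ⊆ O′ → z ∈ O′ → ¬ z ∈ O → Chain O′ l → Chain O (suc l)
  chain-cons {O} O-isSubmodule O⊆𝒪 O⊆O′ z∈O′ z∉O C = record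
    { term        = λ { zero → O ; (suc i) → term i }
    ; isSubmodule = λ { zero → O-isSubmodule ; (suc i) → isSubmodule i }
    ; above       = λ { zero y∈O → y∈O ; (suc i) y∈O → above i (O⊆O′ y∈O) }
    ; below       = λ { zero → O⊆𝒪 ; (suc i) → below i }
    ; increasing  = λ { zero y∈O → above zero (O⊆O′ y∈O) ; (suc i) → increasing i }
    ; strict      = λ { zero → _ , above zero z∈O′ , z∉O ; (suc i) → strict i }
    }
    where open Chain C

  -- The base may grow to anything inside the second term; the induction bounding chain lengths
  -- moves its base in this way.
  chain-tail : ∀ {O O′ l} → (C : Chain O (suc l)) → O′ ⊆ Chain.term C (suc zero) → Chain O′ l
  chain-tail {O} {O′} {l} C O′⊆ = record
    { term = λ i → term (suc i) ; isSubmodule = λ i → isSubmodule (suc i)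
    ; above = above′
    ; below = λ i → below (suc i) ; increasing = λ i → increasing (suc i) ; strict = λ i → strict (suc i) }
    where
    open Chain C
    ascend : ∀ {l} (t : Fin (suc l) → Subset) → (∀ i → t (inject₁ i) ⊆ t (suc i)) → ∀ i → t zero ⊆ t i
    ascend t incr zero            y∈ = y∈
    ascend {suc l} t incr (suc i) y∈ = ascend (λ i → t (suc i)) (λ i → incr (suc i)) i (incr zero y∈)
    above′ : ∀ i → O′ ⊆ term (suc i)
    above′ i y∈O′ = ascend (λ i → term (suc i)) (λ i → increasing (suc i)) i (O′⊆ y∈O′)

-- The lattices `Λ a f` of an integral basis: ring property and conductor

module BasisLattices {c ℓ} {F E : NonArchimedeanLocalField c ℓ} (E/F : FiniteExtension F E)
             (unramified : FiniteExtension.Unramified E/F)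
             (π : NonArchimedeanLocalField.Carrier F)
             (vπ≡1 : NonArchimedeanLocalField.IsUniformizer F π)
             {u w : NonArchimedeanLocalField.Carrier E}
             (basis : Bases.IntegralBasis E/F unramified π vπ≡1 u w) where
  open NonArchimedeanLocalField E hiding (zero)
  open Orders E/F hiding (module Lattices)
  open Extension E/F unramified π vπ≡1
  open Bases E/F unramified π vπ≡1
  open IntegralBasis basis
  open IntegerCoefficients commutativeRing using (solve; con; _:+_; _:*_; _:-_; :-_; _:=_)
  open import Relation.Binary.Reasoning.Setoid setoid
  open import Algebra.Properties.Ring ring using (x∙y⁻¹≈ε⇒x≈y)

  Λ : ℕ → ℕ → Subset
  Λ a f = 𝔬⟨ 1# , ϖ ^ a * u , ϖ ^ f * w ⟩

  ∈Λ : ∀ a f {y r p q} → 𝔬ᴱ r → Fᴱ p → Fᴱ q → a ≤ᵛ p → f ≤ᵛ q → y ≈ r + p * u + q * w → y ∈ Λ a f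
  ∈Λ a f {y} {r} {p} {q} or Fp Fq a≤p f≤q eq =
    let p′ , op′ , p≈ = ≤ᵛ⇒ϖ^∣ Fp a≤p
        q′ , oq′ , q≈ = ≤ᵛ⇒ϖ^∣ Fq f≤q
    in ∈⟨⟩ or op′ oq′ (begin
      y ≈⟨ eq ⟩
      r + p * u + q * w ≈⟨ +-cong (+-congˡ (*-congʳ p≈)) (*-congʳ q≈) ⟩
      r + ϖ ^ a * p′ * u + ϖ ^ f * q′ * w
        ≈⟨ solve 7 (λ r a p u f q w → r :+ a :* p :* u :+ f :* q :* w := r :* con 1ℤ :+ p :* (a :* u) :+ q :* (f :* w)) refl r (ϖ ^ a) p′ u (ϖ ^ f) q′ w ⟩
      r * 1# + p′ * (ϖ ^ a * u) + q′ * (ϖ ^ f * w) ∎)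

  -- By uniqueness of coordinates, any expression of `y` over F coincides with the one supplied by
  -- the span.
  ∈Λ⁻ : ∀ a f {y r p q} → y ∈ Λ a f → Fᴱ r → Fᴱ p → Fᴱ q → y ≈ r + p * u + q * w → 0 ≤ᵛ r × a ≤ᵛ p × f ≤ᵛ q
  ∈Λ⁻ a f {y} {r} {p} {q} y∈Λ Fr Fp Fq eq =
    let r′ , p′ , q′ , or′ , op′ , oq′ , eq′ = ∈⟨⟩⁻ y∈Λ
        r≈ , p≈ , q≈ = coords-≈0 (Fᴱ-- Fr (𝔬⇒Fᴱ or′)) (Fᴱ-- Fp (𝔬⇒Fᴱ (𝔬-* op′ (𝔬-ϖ^ a)))) (Fᴱ-- Fq (𝔬⇒Fᴱ (𝔬-* oq′ (𝔬-ϖ^ f))))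
          (begin
            (r - r′) + (p - p′ * ϖ ^ a) * u + (q - q′ * ϖ ^ f) * w
              ≈⟨ solve 10 (λ r r′ p p′ a q q′ f u w → (r :- r′) :+ (p :- p′ :* a) :* u :+ (q :- q′ :* f) :* w
                    := (r :+ p :* u :+ q :* w) :- (r′ :* con 1ℤ :+ p′ :* (a :* u) :+ q′ :* (f :* w))) refl r r′ p p′ (ϖ ^ a) q q′ (ϖ ^ f) u w ⟩
            (r + p * u + q * w) - (r′ * 1# + p′ * (ϖ ^ a * u) + q′ * (ϖ ^ f * w))
              ≈⟨ +-cong eq (-‿cong eq′) ⟨
            y - y ≈⟨ -‿inverseʳ y ⟩
            0# ∎)
    in ≤ᵛ-resp (sym (x∙y⁻¹≈ε⇒x≈y r r′ r≈)) (𝔬⇒integral or′) ,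
       ≤ᵛ-resp (sym (x∙y⁻¹≈ε⇒x≈y p (p′ * ϖ ^ a) p≈)) (≤ᵛ-*ʳ (𝔬⇒integral op′) (≤ᵛ-ϖ^ vϖ≡1 a)) ,
       ≤ᵛ-resp (sym (x∙y⁻¹≈ε⇒x≈y q (q′ * ϖ ^ f) q≈)) (≤ᵛ-*ʳ (𝔬⇒integral oq′) (≤ᵛ-ϖ^ vϖ≡1 f))

  module _ (a f : ℕ) where
    private
      α = ϖ ^ a * u
      β = ϖ ^ f * w

    Λ-isSubmodule : IsSubmodule 𝔬ᴱ (Λ a f)
    Λ-isSubmodule = ⟨⟩-isSubmodule 1# α β

    1∈Λ : 1# ∈ Λ a f
    1∈Λ = ∈⟨⟩₁ 1# α β

    ϖ^*u∈Λ : ϖ ^ a * u ∈ Λ a f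
    ϖ^*u∈Λ = ∈⟨⟩₂ 1# α β

    ϖ^*w∈Λ : ϖ ^ f * w ∈ Λ a f
    ϖ^*w∈Λ = ∈⟨⟩₃ 1# α β

    Λ-⊆ : ∀ {M} → IsSubmodule 𝔬ᴱ M → 1# ∈ M → ϖ ^ a * u ∈ M → ϖ ^ f * w ∈ M → Λ a f ⊆ M
    Λ-⊆ = ⟨⟩-⊆ 1# α β

    𝔬⊆Λ : 𝔬ᴱ ⊆ Λ a f
    𝔬⊆Λ {y} oy = IsSubmodule.resp Λ-isSubmodule (*-identityʳ y) (IsSubmodule.scale Λ-isSubmodule oy 1∈Λ)

    Λ⊆𝒪 : Λ a f ⊆ 𝒪ᴱ
    Λ⊆𝒪 y∈Λ = let r , p , q , or , op , oq , eq = ∈⟨⟩⁻ y∈Λ in ≤ᵛ-resp (sym eq)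
      (≤ᵛ-+ (≤ᵛ-+ (≤ᵛ-* (𝔬⇒integral or) integral-1) (≤ᵛ-* (𝔬⇒integral op) (≤ᵛ-* (integral-ϖ^ vϖ≡1 a) 0≤u)))
            (≤ᵛ-* (𝔬⇒integral oq) (≤ᵛ-* (integral-ϖ^ vϖ≡1 f) 0≤w)))

  ϖ^𝒪⊆Λ : ∀ {a f} → a ℕ.≤ f → ∀ {y} → f ≤ᵛ y → y ∈ Λ a f
  ϖ^𝒪⊆Λ {a} {f} a≤f {y} f≤y =
    let r , p , q , Fr , Fp , Fq , eq = coords y
        f≤r , f≤p , f≤q = coords-≤ᵛ Fr Fp Fq (≤ᵛ-resp eq f≤y)
    in ∈Λ a f (integral⇒𝔬 Fr (≤ᵛ-weaken ℕ.z≤n f≤r)) Fp Fq (≤ᵛ-weaken a≤f f≤p) f≤q eq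

  u-square : ∃[ C ] ∃[ A ] ∃[ ε ] 𝔬ᴱ C × 𝔬ᴱ A × 𝔬ᴱ ε × u * u ≈ C + A * u + ε * w
  u-square = integral-coords (≤ᵛ-* 0≤u 0≤u)

  -- Otherwise ū is quadratic over the residue field k; writing uw = g + bu + dw, the element
  -- w̄ = (ḡ + b̄ū)/(ū - d̄) would lie in k(ū), which is spanned by 1 and ū.
  u-square-coefficient-isUnit : ∀ {C A ε} → 𝔬ᴱ C → 𝔬ᴱ A → 𝔬ᴱ ε → u * u ≈ C + A * u + ε * w → IsUnit ε
  u-square-coefficient-isUnit {C} {A} {ε} oC oA oε u²≈ =
    let g , b , d , og , ob , od , uw≈ = integral-coords (≤ᵛ-* 0≤u 0≤w)
    in ¬1≤ᵛ⇒isUnit (𝔬⇒integral oε) λ 1≤ε → absurd 1≤ε og ob od uw≈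
    where
   absurd : 1 ≤ᵛ ε → ∀ {g b d} → 𝔬ᴱ g → 𝔬ᴱ b → 𝔬ᴱ d → u * w ≈ g + b * u + d * w → ⊥
   absurd 1≤ε {g} {b} {d} og ob od uw≈ =
    isUnit⇒¬1≤ᵛ unit-N (proj₂ (proj₂ (coords-≤ᵛ (𝔬⇒Fᴱ or) (𝔬⇒Fᴱ op) (𝔬⇒Fᴱ oN) 1≤Nw-pu-r)))
    where
    -- The constant left in `(u - d) * (u - (A - d))` once `u * u` is replaced; the second factor is
    -- chosen so that the linear term in `u` cancels.
    N = C + d * (A - d)
    oN = 𝔬-+ oC (𝔬-* od (𝔬-- oA od))
    -- The `u`-coordinate of `u - t` is 1, so it is not divisible by `ϖ`.
    unit-shift : ∀ {t} → 𝔬ᴱ t → IsUnit (u - t)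
    unit-shift {t} ot = ¬1≤ᵛ⇒isUnit (≤ᵛ-- 0≤u (𝔬⇒integral ot)) λ 1≤u-t → contradiction
      (proj₁ (proj₂ (coords-≤ᵛ (𝔬⇒Fᴱ (𝔬-neg ot)) Fᴱ-1 Fᴱ-0
        (≤ᵛ-resp (solve 3 (λ u t w → u :- t := :- t :+ con 1ℤ :* u :+ con 0ℤ :* w) refl u t w) 1≤u-t))))
      (isUnit⇒¬1≤ᵛ isUnit-1)
    norm : (u - d) * (u - (A - d)) ≈ N + ε * w
    norm = begin
      (u - d) * (u - (A - d))        ≈⟨ solve 3 (λ u d A → (u :- d) :* (u :- (A :- d)) := u :* u :+ (d :* (A :- d) :- A :* u)) refl u d A ⟩
      u * u + (d * (A - d) - A * u)  ≈⟨ +-congʳ u²≈ ⟩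
      (C + A * u + ε * w) + (d * (A - d) - A * u)
        ≈⟨ solve 6 (λ C A u ε w d → (C :+ A :* u :+ ε :* w) :+ (d :* (A :- d) :- A :* u) := C :+ d :* (A :- d) :+ ε :* w) refl C A u ε w d ⟩
      N + ε * w                      ∎
    1≤εw : 1 ≤ᵛ ε * w
    1≤εw = ≤ᵛ-*ˡ 1≤ε 0≤w
    unit-N : IsUnit N
    unit-N = ¬1≤ᵛ⇒isUnit (𝔬⇒integral oN) λ 1≤N → contradiction (≤ᵛ-+ 1≤N 1≤εw)
      (isUnit⇒¬1≤ᵛ (isUnit-resp norm (isUnit-* (unit-shift od) (unit-shift (𝔬-- oA od)))))
    -- Multiplying `(u - d) * w = g + b * u` by `u - (A - d)` expresses `N * w`, up to a multiple of
    -- `ε`, through `1` and `u`; `r` and `p` are the negatives of those coefficients. Then `ϖ`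
    -- divides `r + p * u + N * w` and hence `N`, which was shown to be a unit.
    r = (A - d) * g - b * C
    p = b * (A - d) - g - b * A
    or = 𝔬-- (𝔬-* (𝔬-- oA od) og) (𝔬-* ob oC)
    op = 𝔬-- (𝔬-- (𝔬-* ob (𝔬-- oA od)) og) (𝔬-* ob oA)
    identity : r + p * u + N * w ≈ ε * (w * (b - w))
    identity = begin
      r + p * u + N * w
        ≈⟨ solve 9 (λ A d g b C u w N ε → (A :- d) :* g :- b :* C :+ (b :* (A :- d) :- g :- b :* A) :* u :+ N :* w
             := (N :+ ε :* w) :* w :- ((g :+ b :* u) :* (u :- (A :- d)) :- b :* (u :* u :- (C :+ A :* u :+ ε :* w))) :+ ε :* (w :* (b :- w))) refl A d g b C u w N ε ⟩
      (N + ε * w) * w - ((g + b * u) * (u - (A - d)) - b * (u * u - (C + A * u + ε * w))) + ε * (w * (b - w))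
        ≈⟨ +-congʳ (+-cong (*-congʳ (sym norm)) (-‿cong (+-cong (*-congʳ g+bu≈) (-‿cong (*-congˡ (trans (+-congʳ u²≈) (-‿inverseʳ _))))))) ⟩
      (u - d) * (u - (A - d)) * w - ((u - d) * w * (u - (A - d)) - b * 0#) + ε * (w * (b - w))
        ≈⟨ solve 6 (λ u d A w b z → (u :- d) :* (u :- (A :- d)) :* w :- ((u :- d) :* w :* (u :- (A :- d)) :- b :* con 0ℤ) :+ z := z) refl u d A w b _ ⟩
      ε * (w * (b - w)) ∎
      where
      g+bu≈ : g + b * u ≈ (u - d) * w
      g+bu≈ = begin
        g + b * u                    ≈⟨ solve 5 (λ g b u d w → g :+ b :* u := (g :+ b :* u :+ d :* w) :- d :* w) refl g b u d w ⟩
        (g + b * u + d * w) - d * w  ≈⟨ +-congʳ uw≈ ⟨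
        u * w - d * w                ≈⟨ solve 3 (λ u w d → u :* w :- d :* w := (u :- d) :* w) refl u w d ⟩
        (u - d) * w                  ∎
    1≤Nw-pu-r : 1 ≤ᵛ r + p * u + N * w
    1≤Nw-pu-r = ≤ᵛ-resp (sym identity) (≤ᵛ-*ˡ 1≤ε (≤ᵛ-* 0≤w (≤ᵛ-- (𝔬⇒integral ob) 0≤w)))

  module Order {a f : ℕ} (a≤f : a ℕ.≤ f) {O : Subset} (O≐Λ : O ≐ Λ a f) where
    private
      O⊆Λ = proj₁ O≐Λ
      Λ⊆O = proj₂ O≐Λ
      module Λ = IsSubmodule (Λ-isSubmodule a f)
      α = ϖ ^ a * u
      β = ϖ ^ f * w

      f≤β* : ∀ y → 0 ≤ᵛ y → f ≤ᵛ β * y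
      f≤β* y 0≤y = ≤ᵛ-*ˡ (≤ᵛ-*ˡ (≤ᵛ-ϖ^ vϖ≡1 f) 0≤w) 0≤y

    module _ (f≤2a : f ℕ.≤ a ℕ.+ a) where

      -- Products involving `β` lie in `ϖ ^ f` times 𝒪ᴱ, which is contained in `Λ a f`; the one
      -- critical product is `α * α`, which is divisible by `ϖ ^ (2a)`.
      Λ-*-closed : ∀ {y z} → y ∈ Λ a f → z ∈ Λ a f → y * z ∈ Λ a f
      Λ-*-closed {y} {z} y∈Λ z∈Λ =
        let r , p , q , or , op , oq , eq = ∈⟨⟩⁻ y∈Λ
            r′ , p′ , q′ , or′ , op′ , oq′ , eq′ = ∈⟨⟩⁻ z∈Λ
        in Λ.resp (begin
            (r * r′ + (r * p′ + p * r′) * α) + (p * p′ * (α * α) + (β * (q * z) + β * (q′ * (r + p * α))))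
              ≈⟨ +-congˡ (+-congˡ (+-congʳ (*-congˡ (*-congˡ eq′)))) ⟩
            (r * r′ + (r * p′ + p * r′) * α) + (p * p′ * (α * α) + (β * (q * (r′ * 1# + p′ * α + q′ * β)) + β * (q′ * (r + p * α))))
              ≈⟨ solve 8 (λ r p q r′ p′ q′ α β → (r :* r′ :+ (r :* p′ :+ p :* r′) :* α) :+ (p :* p′ :* (α :* α) :+ (β :* (q :* (r′ :* con 1ℤ :+ p′ :* α :+ q′ :* β)) :+ β :* (q′ :* (r :+ p :* α))))
                    := (r :* con 1ℤ :+ p :* α :+ q :* β) :* (r′ :* con 1ℤ :+ p′ :* α :+ q′ :* β)) refl r p q r′ p′ q′ α β ⟩
            (r * 1# + p * α + q * β) * (r′ * 1# + p′ * α + q′ * β)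
              ≈⟨ *-cong eq eq′ ⟨
            y * z ∎)
          (Λ.+-closed
            (Λ.+-closed (𝔬⊆Λ a f (𝔬-* or or′)) (Λ.scale (𝔬-+ (𝔬-* or op′) (𝔬-* op or′)) (ϖ^*u∈Λ a f)))
            (ϖ^𝒪⊆Λ a≤f (≤ᵛ-+
              (≤ᵛ-*ʳ (𝔬⇒integral (𝔬-* op op′)) (≤ᵛ-weaken f≤2a (≤ᵛ-* (≤ᵛ-*ˡ (≤ᵛ-ϖ^ vϖ≡1 a) 0≤u) (≤ᵛ-*ˡ (≤ᵛ-ϖ^ vϖ≡1 a) 0≤u))))
              (≤ᵛ-+ (f≤β* (q * z) (≤ᵛ-* (𝔬⇒integral oq) (Λ⊆𝒪 a f z∈Λ)))
                    (f≤β* (q′ * (r + p * α)) (≤ᵛ-* (𝔬⇒integral oq′) (≤ᵛ-+ (𝔬⇒integral or) (≤ᵛ-* (𝔬⇒integral op) (Λ⊆𝒪 a f (ϖ^*u∈Λ a f))))))))))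

      isSubring : IsSubring O
      isSubring = record
        { resp     = λ y≈z y∈O → Λ⊆O (Λ.resp y≈z (O⊆Λ y∈O))
        ; 0-mem    = Λ⊆O Λ.0-mem
        ; 1-mem    = Λ⊆O (1∈Λ a f)
        ; +-closed = λ y∈O z∈O → Λ⊆O (Λ.+-closed (O⊆Λ y∈O) (O⊆Λ z∈O))
        ; neg      = λ {y} y∈O → Λ⊆O (Λ.resp (-1*x≈-x y) (Λ.scale (𝔬-neg 𝔬-1) (O⊆Λ y∈O)))
        ; *-closed = λ y∈O z∈O → Λ⊆O (Λ-*-closed (O⊆Λ y∈O) (O⊆Λ z∈O))
        }
        where open import Algebra.Properties.Ring ring using (-1*x≈-x)

      isOrder : IsOrder O
      isOrder = record
        { isSubring         = isSubring
        ; 𝔬-contained       = λ oy → Λ⊆O (𝔬⊆Λ a f oy)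
        ; finitelyGenerated = 3 , (1# ∷ α ∷ β ∷ []) , O≐Λ
        ; FO=E              = λ y → let r , p , q , Fr , Fp , Fq , eq = coords y in
            3 , (1# ∷ α ∷ β ∷ []) , (λ { zero → Λ⊆O (1∈Λ a f) ; (suc zero) → Λ⊆O (ϖ^*u∈Λ a f) ; (suc (suc zero)) → Λ⊆O (ϖ^*w∈Λ a f) }) ,
            (r ∷ p * ϖ⁻ vϖ≡1 a ∷ q * ϖ⁻ vϖ≡1 f ∷ []) ,
            (λ { zero → Fr ; (suc zero) → Fᴱ-* Fp (Fᴱ-ϖ⁻ a) ; (suc (suc zero)) → Fᴱ-* Fq (Fᴱ-ϖ⁻ f) }) ,
            trans eq (trans (+-cong (+-congˡ (*-congʳ (ϖ^ϖ⁻-* vϖ≡1 a p))) (*-congʳ (ϖ^ϖ⁻-* vϖ≡1 f q)))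
              (solve 7 (λ r a p u f q w → r :+ a :* p :* u :+ f :* q :* w := r :* con 1ℤ :+ (p :* (a :* u) :+ (q :* (f :* w) :+ con 0ℤ))) refl r (ϖ ^ a) (p * ϖ⁻ vϖ≡1 a) u (ϖ ^ f) (q * ϖ⁻ vϖ≡1 f) w))
        }

    isOrder⇒f≤2a : IsOrder O → f ℕ.≤ a ℕ.+ a
    isOrder⇒f≤2a O-isOrder =
      let C , A , ε , oC , oA , oε , u²≈ = u-square in
      ϖ^-*-isUnit vϖ≡1 (u-square-coefficient-isUnit oC oA oε u²≈) (proj₂ (proj₂ (∈Λ⁻ a f
        (O⊆Λ (IsSubring.*-closed (IsOrder.isSubring O-isOrder) (Λ⊆O (ϖ^*u∈Λ a f)) (Λ⊆O (ϖ^*u∈Λ a f))))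
        (𝔬⇒Fᴱ (𝔬-* o2a oC)) (𝔬⇒Fᴱ (𝔬-* o2a oA)) (𝔬⇒Fᴱ (𝔬-* o2a oε))
        (begin
          α * α                     ≈⟨ solve 2 (λ a u → a :* u :* (a :* u) := a :* a :* (u :* u)) refl (ϖ ^ a) u ⟩
          ϖ ^ a * ϖ ^ a * (u * u)   ≈⟨ *-cong (sym (ϖ^-+ a a)) u²≈ ⟩
          ϖ ^ (a ℕ.+ a) * (C + A * u + ε * w)
            ≈⟨ solve 6 (λ a C A u ε w → a :* (C :+ A :* u :+ ε :* w) := a :* C :+ a :* A :* u :+ a :* ε :* w) refl (ϖ ^ (a ℕ.+ a)) C A u ε w ⟩
          ϖ ^ (a ℕ.+ a) * C + ϖ ^ (a ℕ.+ a) * A * u + ϖ ^ (a ℕ.+ a) * ε * w ∎))))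
      where
      o2a = 𝔬-ϖ^ (a ℕ.+ a)

    -- If `y` is `ϖ ^ k` times a unit with inverse `e`, then `y * (e * w)` is `ϖ ^ k * w`; when it
    -- lies in the lattice, its `w`-coordinate gives `f ≤ k`.
    conductor-≐ : conductor O ≐ (λ y → ∃[ z ] z ∈ 𝒪ᴱ × y ≈ ϖ ^ f * z)
    conductor-≐ = ⊆ϖ^f , λ { {y} (z , 0≤z , eq) →
        ≤ᵛ-resp (sym eq) (≤ᵛ-* (integral-ϖ^ vϖ≡1 f) 0≤z) ,
        λ 0≤b → Λ⊆O (ϖ^𝒪⊆Λ a≤f (≤ᵛ-*ˡ (≤ᵛ-resp (sym eq) (≤ᵛ-*ˡ (≤ᵛ-ϖ^ vϖ≡1 f) 0≤z)) 0≤b)) }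
      where
      ⊆ϖ^f : ∀ {y} → conductor O y → ∃[ z ] z ∈ 𝒪ᴱ × y ≈ ϖ ^ f * z
      ⊆ϖ^f {y} (0≤y , y𝒪⊆O) = case 0≟ y of λ where
          (yes y≈0) → 0# , ≤ᵛ-0 , trans y≈0 (sym (zeroʳ _))
          (no y≉0)  →
            let k , unit = ≉0⇒isUnit-*ϖ⁻ vϖ≡1 0≤y y≉0
                e , ye≈1 = inverse _ (isUnit⇒≉0 unit)
            in y * ϖ⁻ vϖ≡1 f , ≤ᵛ⇒integral-*ϖ⁻ vϖ≡1 (f≤y k unit ye≈1) , ϖ^ϖ⁻-* vϖ≡1 f y
        where
        f≤y : ∀ k {e} → IsUnit (y * ϖ⁻ vϖ≡1 k) → y * ϖ⁻ vϖ≡1 k * e ≈ 1# → f ≤ᵛ y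
        f≤y k {e} unit ye≈1 = ≤ᵛ-weaken f≤k k≤y
          where
          k≤y : k ≤ᵛ y
          k≤y = ≤ᵛ-resp (sym (ϖ^ϖ⁻-* vϖ≡1 k y)) (≤ᵛ-*ˡ (≤ᵛ-ϖ^ vϖ≡1 k) (isUnit⇒integral unit))
          f≤k : f ℕ.≤ k
          f≤k = ϖ^-*-isUnit vϖ≡1 isUnit-1 (≤ᵛ-resp (sym (*-identityʳ (ϖ ^ k))) (proj₂ (proj₂ (∈Λ⁻ a f
            (O⊆Λ (y𝒪⊆O (≤ᵛ-* (isUnit⇒integral (isUnit-inverse unit ye≈1)) 0≤w)))
            Fᴱ-0 Fᴱ-0 (Fᴱ-ϖ^ k)
            (begin
              y * (e * w)                          ≈⟨ *-congʳ (ϖ^ϖ⁻-* vϖ≡1 k y) ⟩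
              ϖ ^ k * (y * ϖ⁻ vϖ≡1 k) * (e * w)    ≈⟨ solve 4 (λ a b e w → a :* b :* (e :* w) := a :* (b :* e) :* w) refl _ _ e w ⟩
              ϖ ^ k * (y * ϖ⁻ vϖ≡1 k * e) * w      ≈⟨ *-congʳ (*-congˡ ye≈1) ⟩
              ϖ ^ k * 1# * w                       ≈⟨ solve 3 (λ a w u → a :* con 1ℤ :* w := con 0ℤ :+ con 0ℤ :* u :+ a :* w) refl _ w u ⟩
              0# + 0# * u + ϖ ^ k * w              ∎)))))

-- Length of the quotient through Hermite normal forms

module Length {c ℓ} {F E : NonArchimedeanLocalField c ℓ} (E/F : FiniteExtension F E)
             (unramified : FiniteExtension.Unramified E/F)
             (π : NonArchimedeanLocalField.Carrier F)
             (vπ≡1 : NonArchimedeanLocalField.IsUniformizer F π)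
             {u w : NonArchimedeanLocalField.Carrier E}
             (basis : Bases.IntegralBasis E/F unramified π vπ≡1 u w) where
  open NonArchimedeanLocalField E hiding (zero)
  open Orders E/F hiding (module Lattices)
  open Extension E/F unramified π vπ≡1
  open Bases E/F unramified π vπ≡1
  open IntegralBasis basis
  open BasisLattices E/F unramified π vπ≡1 basis
  open IntegerCoefficients commutativeRing using (solve; con; _:+_; _:*_; _:-_; :-_; _:=_)
  open import Relation.Binary.Reasoning.Setoid setoid

  -- Every lattice containing 1 has a basis in this Hermite normal form.
  H : ℕ → ℕ → Carrier → Subset
  H i j s = 𝔬⟨ 1# , ϖ ^ i * u + s * w , ϖ ^ j * w ⟩

  module _ (i j : ℕ) (s : Carrier) where
    private
      g = ϖ ^ i * u + s * w
      h = ϖ ^ j * w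

    H-isSubmodule : IsSubmodule 𝔬ᴱ (H i j s)
    H-isSubmodule = ⟨⟩-isSubmodule 1# g h

    H₁ : 1# ∈ H i j s
    H₁ = ∈⟨⟩₁ 1# g h

    H₂ : ϖ ^ i * u + s * w ∈ H i j s
    H₂ = ∈⟨⟩₂ 1# g h

    H₃ : ϖ ^ j * w ∈ H i j s
    H₃ = ∈⟨⟩₃ 1# g h

    H-⊆ : ∀ {M} → IsSubmodule 𝔬ᴱ M → 1# ∈ M → ϖ ^ i * u + s * w ∈ M → ϖ ^ j * w ∈ M → H i j s ⊆ M
    H-⊆ = ⟨⟩-⊆ 1# g h

  ϖ^*w-multiple : ∀ {M t} k → IsSubmodule 𝔬ᴱ M → Fᴱ t → k ≤ᵛ t → ϖ ^ k * w ∈ M → t * w ∈ M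
  ϖ^*w-multiple {t = t} k M-isSubmodule Ft k≤t ϖ^*w∈M =
    let t′ , ot′ , t≈ = ≤ᵛ⇒ϖ^∣ Ft k≤t in
    IsSubmodule.resp M-isSubmodule (trans (solve 3 (λ t a w → t :* (a :* w) := a :* t :* w) refl t′ (ϖ ^ k) w) (*-congʳ (sym t≈)))
      (IsSubmodule.scale M-isSubmodule ot′ ϖ^*w∈M)

  ϖ^*w-from-unit : ∀ {M t e} k → IsSubmodule 𝔬ᴱ M → 𝔬ᴱ e → IsUnit e → t ≈ ϖ ^ k * e → t * w ∈ M → ϖ ^ k * w ∈ M
  ϖ^*w-from-unit {t = t} {e} k M-isSubmodule oe unit t≈ tw∈M =
    let e⁻¹ , oe⁻¹ , _ , ee⁻¹≈1 = 𝔬-unit-inverse oe unit in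
    IsSubmodule.resp M-isSubmodule (begin
        e⁻¹ * (t * w)            ≈⟨ *-congˡ (*-congʳ t≈) ⟩
        e⁻¹ * (ϖ ^ k * e * w)    ≈⟨ solve 4 (λ i a e w → i :* (a :* e :* w) := (e :* i) :* (a :* w)) refl e⁻¹ (ϖ ^ k) e w ⟩
        (e * e⁻¹) * (ϖ ^ k * w)  ≈⟨ *-congʳ ee⁻¹≈1 ⟩
        1# * (ϖ ^ k * w)         ≈⟨ *-identityˡ _ ⟩
        ϖ ^ k * w                ∎)
      (IsSubmodule.scale M-isSubmodule oe⁻¹ tw∈M)

  -- The outcome of adding `t * w` to `H i j s`. The field `minimal` says that `ϖ ^ j′ * w` is
  -- forced by `ϖ ^ j * w` and `t * w`; `strict` says that the exponent drops unless `t * w` was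
  -- already present.
  record Adjoined-w (i j : ℕ) (s t : Carrier) : Set (Level.suc (c ⊔ ℓ)) where
    field
      j′       : ℕ
      j′≤j     : j′ ℕ.≤ j
      t*w∈     : t * w ∈ H i j′ s
      enlarges : H i j s ⊆ H i j′ s
      minimal  : ∀ {M} → IsSubmodule 𝔬ᴱ M → ϖ ^ j * w ∈ M → t * w ∈ M → ϖ ^ j′ * w ∈ M
      strict   : t * w ∈ H i j s ⊎ j′ ℕ.< j

  adjoin-w : ∀ i j {s t} → 𝔬ᴱ t → Adjoined-w i j s t
  adjoin-w i j {s} {t} ot = case j ≤ᵛ? t of λ where
      (yes j≤t) → record
        { j′ = j ; j′≤j = ℕ.≤-refl ; t*w∈ = t*w∈ j j≤t ; enlarges = λ y∈ → y∈
        ; minimal = λ _ ϖ^j*w∈M _ → ϖ^j*w∈M ; strict = inj₁ (t*w∈ j j≤t) }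
      (no j≰t) →
        let k , e , oe , unit , t≈ = ≉0⇒ϖ^-*-unit ot (λ t≈0 → j≰t (≤ᵛ-resp (sym t≈0) ≤ᵛ-0))
            k≤t = ≤ᵛ-resp (sym t≈) (≤ᵛ-*ˡ (≤ᵛ-ϖ^ vϖ≡1 k) (𝔬⇒integral oe))
            k<j = ℕ.≰⇒> λ j≤k → j≰t (≤ᵛ-weaken j≤k k≤t)
        in record
        { j′ = k ; j′≤j = ℕ.<⇒≤ k<j ; t*w∈ = t*w∈ k k≤t
        ; enlarges = H-⊆ i j s (H-isSubmodule i k s) (H₁ i k s) (H₂ i k s)
            (ϖ^*w-multiple k (H-isSubmodule i k s) (Fᴱ-ϖ^ j) (≤ᵛ-weaken (ℕ.<⇒≤ k<j) (≤ᵛ-ϖ^ vϖ≡1 j)) (H₃ i k s))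
        ; minimal = λ M-isSubmodule _ tw∈M → ϖ^*w-from-unit k M-isSubmodule oe unit t≈ tw∈M
        ; strict = inj₂ k<j }
    where
    t*w∈ : ∀ k → k ≤ᵛ t → t * w ∈ H i k s
    t*w∈ k k≤t = ϖ^*w-multiple k (H-isSubmodule i k s) (𝔬⇒Fᴱ ot) k≤t (H₃ i k s)

  -- One step of enlargement: `minimal` makes the new lattice the smallest one containing the old
  -- lattice and `y`, and `strict` lets `i + j`, which is the colength in 𝒪ᴱ, serve as a measure.
  record Adjoined (i j : ℕ) (s y : Carrier) : Set (Level.suc (c ⊔ ℓ)) where
    field
      i′ j′    : ℕ
      s′       : Carrier
      os′      : 𝔬ᴱ s′
      y∈       : y ∈ H i′ j′ s′
      enlarges : H i j s ⊆ H i′ j′ s′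
      minimal  : ∀ {M} → IsSubmodule 𝔬ᴱ M → H i j s ⊆ M → y ∈ M → H i′ j′ s′ ⊆ M
      strict   : y ∈ H i j s ⊎ i′ ℕ.+ j′ ℕ.< i ℕ.+ j

  -- The Euclidean algorithm over a discrete valuation ring. If `ϖ ^ i` divides the `u`-coordinate
  -- of `y`, the second generator reduces `y` to a multiple of `w`; otherwise `y`, rescaled, becomes
  -- the second generator and the old one is reduced by it.
  adjoin : ∀ i j {s y} → 𝔬ᴱ s → 0 ≤ᵛ y → Adjoined i j s y
  adjoin i j {s} {y} os 0≤y =
    let r , p , q , or , op , oq , y≈ = integral-coords 0≤y in
    case i ≤ᵛ? p of λ where
        (yes i≤p) →
          let p′ , op′ , p≈ = ≤ᵛ⇒ϖ^∣ (𝔬⇒Fᴱ op) i≤p in divisible r p q p′ or op′ oq p≈ y≈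
        (no i≰p)  →
          let k , e , oe , unit , p≈ = ≉0⇒ϖ^-*-unit op (λ p≈0 → i≰p (≤ᵛ-resp (sym p≈0) ≤ᵛ-0))
              e⁻¹ , oe⁻¹ , _ , ee⁻¹≈1 = 𝔬-unit-inverse oe unit
              k<i = ℕ.≰⇒> λ i≤k → i≰p (≤ᵛ-weaken i≤k (≤ᵛ-resp (sym p≈) (≤ᵛ-*ˡ (≤ᵛ-ϖ^ vϖ≡1 k) (𝔬⇒integral oe))))
          in smaller r p q k e e⁻¹ or oq oe oe⁻¹ ee⁻¹≈1 k<i p≈ y≈
    where
    divisible : ∀ r p q p′ → 𝔬ᴱ r → 𝔬ᴱ p′ → 𝔬ᴱ q → p ≈ ϖ ^ i * p′ → y ≈ r + p * u + q * w → Adjoined i j s y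
    divisible r p q p′ or op′ oq p≈ y≈ = record
      { i′ = i ; j′ = j′ ; s′ = s ; os′ = os
      ; y∈ = y∈H (H-isSubmodule i j′ s) (H₁ i j′ s) (H₂ i j′ s) t*w∈
      ; enlarges = enlarges
      ; minimal = λ M-isSubmodule H⊆M y∈M → H-⊆ i j′ s M-isSubmodule (H⊆M (H₁ i j s)) (H⊆M (H₂ i j s))
          (minimal M-isSubmodule (H⊆M (H₃ i j s)) (tw∈M M-isSubmodule (H⊆M (H₁ i j s)) (H⊆M (H₂ i j s)) y∈M))
      ; strict = Sum.map (y∈H (H-isSubmodule i j s) (H₁ i j s) (H₂ i j s)) (ℕ.+-monoʳ-< i) strict
      }
      where
      t = q - p′ * s
      g = ϖ ^ i * u + s * w
      open Adjoined-w (adjoin-w i j {s} {t} (𝔬-- oq (𝔬-* op′ os)))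
      y≈′ : y ≈ (r * 1# + p′ * g) + t * w
      y≈′ = trans y≈ (trans (+-congʳ (+-congˡ (*-congʳ p≈)))
        (solve 7 (λ r a p u q w s → r :+ a :* p :* u :+ q :* w := (r :* con 1ℤ :+ p :* (a :* u :+ s :* w)) :+ (q :- p :* s) :* w) refl r (ϖ ^ i) p′ u q w s))
      y∈H : ∀ {M} → IsSubmodule 𝔬ᴱ M → 1# ∈ M → g ∈ M → t * w ∈ M → y ∈ M
      y∈H M-isSubmodule 1∈M g∈M tw∈M = M.resp (sym y≈′) (M.+-closed (M.+-closed (M.scale or 1∈M) (M.scale op′ g∈M)) tw∈M)
        where module M = IsSubmodule M-isSubmodule
      tw∈M : ∀ {M} → IsSubmodule 𝔬ᴱ M → 1# ∈ M → g ∈ M → y ∈ M → t * w ∈ M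
      tw∈M M-isSubmodule 1∈M g∈M y∈M = M.resp (trans (+-congʳ y≈′) (solve 2 (λ a b → a :+ b :- a := b) refl (r * 1# + p′ * g) (t * w)))
        (sub-closed 𝔬-isSubring M-isSubmodule y∈M (M.+-closed (M.scale or 1∈M) (M.scale op′ g∈M)))
        where module M = IsSubmodule M-isSubmodule
    smaller : ∀ r p q k e e⁻¹ → 𝔬ᴱ r → 𝔬ᴱ q → 𝔬ᴱ e → 𝔬ᴱ e⁻¹ → e * e⁻¹ ≈ 1# → k ℕ.< i → p ≈ ϖ ^ k * e →
              y ≈ r + p * u + q * w → Adjoined i j s y
    smaller r p q k e e⁻¹ or oq oe oe⁻¹ ee⁻¹≈1 k<i p≈ y≈ = record
      { i′ = k ; j′ = j′ ; s′ = s′ ; os′ = os′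
      ; y∈ = H.resp (sym y≈′) (H.+-closed (H.scale or (H₁ k j′ s′)) (H.scale oe (H₂ k j′ s′)))
      ; enlarges = H-⊆ i j s (H-isSubmodule k j′ s′) (H₁ k j′ s′)
          (H.resp (sym g≈) (H.+-closed (H.scale (𝔬-ϖ^ (i ℕ.∸ k)) (H₂ k j′ s′)) t*w∈)) (enlarges (H₃ k j s′))
      ; minimal = λ M-isSubmodule H⊆M y∈M →
          let g′∈M = g′∈ M-isSubmodule (H⊆M (H₁ i j s)) y∈M in
          H-⊆ k j′ s′ M-isSubmodule (H⊆M (H₁ i j s)) g′∈M
            (minimal M-isSubmodule (H⊆M (H₃ i j s)) (tw∈M M-isSubmodule (H⊆M (H₂ i j s)) g′∈M))
      ; strict = inj₂ (ℕ.+-mono-<-≤ k<i j′≤j)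
      }
      where
      -- Scaling `y - r` by `e⁻¹` makes its `u`-coordinate exactly `ϖ ^ k`; then `t` is the
      -- `w`-coordinate that remains of `g` after subtracting `d * g′`.
      s′ = e⁻¹ * q
      os′ = 𝔬-* oe⁻¹ oq
      d = ϖ ^ (i ℕ.∸ k)
      t = s - d * s′
      g = ϖ ^ i * u + s * w
      g′ = ϖ ^ k * u + s′ * w
      open Adjoined-w (adjoin-w k j {s′} {t} (𝔬-- os (𝔬-* (𝔬-ϖ^ (i ℕ.∸ k)) os′)))
      module H = IsSubmodule (H-isSubmodule k j′ s′)
      g≈ : g ≈ d * g′ + t * w
      g≈ = trans (+-congʳ (*-congʳ (ϖ^-∸ (ℕ.<⇒≤ k<i))))
        (solve 6 (λ a d u s s′ w → a :* d :* u :+ s :* w := d :* (a :* u :+ s′ :* w) :+ (s :- d :* s′) :* w) refl (ϖ ^ k) d u s s′ w)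
      y≈′ : y ≈ r * 1# + e * g′
      y≈′ = begin
        y                                        ≈⟨ y≈ ⟩
        r + p * u + q * w                        ≈⟨ +-cong (+-congˡ (*-congʳ p≈)) (*-congʳ (trans (sym (*-identityˡ q)) (*-congʳ (sym ee⁻¹≈1)))) ⟩
        r + ϖ ^ k * e * u + e * e⁻¹ * q * w      ≈⟨ solve 7 (λ r a e u i q w → r :+ a :* e :* u :+ e :* i :* q :* w := r :* con 1ℤ :+ e :* (a :* u :+ i :* q :* w)) refl r (ϖ ^ k) e u e⁻¹ q w ⟩
        r * 1# + e * g′                          ∎
      g′∈ : ∀ {M} → IsSubmodule 𝔬ᴱ M → 1# ∈ M → y ∈ M → g′ ∈ M
      g′∈ M-isSubmodule 1∈M y∈M = M.resp (begin
          e⁻¹ * (y - r * 1#)                  ≈⟨ *-congˡ (+-congʳ y≈′) ⟩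
          e⁻¹ * ((r * 1# + e * g′) - r * 1#)  ≈⟨ solve 4 (λ i r e g → i :* ((r :+ e :* g) :- r) := (e :* i) :* g) refl e⁻¹ (r * 1#) e g′ ⟩
          (e * e⁻¹) * g′                      ≈⟨ *-congʳ ee⁻¹≈1 ⟩
          1# * g′                             ≈⟨ *-identityˡ g′ ⟩
          g′                                  ∎)
        (M.scale oe⁻¹ (sub-closed 𝔬-isSubring M-isSubmodule y∈M (M.scale or 1∈M)))
        where module M = IsSubmodule M-isSubmodule
      tw∈M : ∀ {M} → IsSubmodule 𝔬ᴱ M → g ∈ M → g′ ∈ M → t * w ∈ M
      tw∈M M-isSubmodule g∈M g′∈M = M.resp (trans (+-congʳ g≈) (solve 2 (λ a b → a :+ b :- a := b) refl (d * g′) (t * w)))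
        (sub-closed 𝔬-isSubring M-isSubmodule g∈M (M.scale (𝔬-ϖ^ (i ℕ.∸ k)) g′∈M))
        where module M = IsSubmodule M-isSubmodule

  -- The witness of the first strict inclusion lies in the second term but outside `H i j s`.
  -- Adjoining it stays inside the second term and lowers `i + j`, so the tail of the chain is a
  -- chain over a lattice of smaller measure.
  chain-bound : ∀ l i j {s} → 𝔬ᴱ s → Chain (H i j s) l → l ℕ.≤ i ℕ.+ j
  chain-bound zero    i j os C = ℕ.z≤n
  chain-bound (suc l) i j {s} os C = case strict-adj of λ where
      (inj₁ y∈H)  → contradiction (C.above zero y∈H) y∉
      (inj₂ less) → ℕ.≤-trans (ℕ.s≤s (chain-bound l i′ j′ os′ (chain-tail C
        (minimal (C.isSubmodule (suc zero)) (C.above (suc zero)) y∈)))) less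
    where
    module C = Chain C
    y = proj₁ (C.strict zero)
    y∈ = proj₁ (proj₂ (C.strict zero))
    y∉ = proj₂ (proj₂ (C.strict zero))
    open Adjoined (adjoin i j os (C.below (suc zero) y∈)) using (i′; j′; os′; minimal) renaming (strict to strict-adj)

  -- Each step divides one generator by `ϖ`, and the divided generator witnesses strictness.
  Λ-chain : ∀ a f → Chain (Λ a f) (a ℕ.+ f)
  Λ-chain zero    zero    = chain-point (Λ-isSubmodule 0 0) (Λ⊆𝒪 0 0)
  Λ-chain zero    (suc f) = chain-cons (Λ-isSubmodule 0 (suc f)) (Λ⊆𝒪 0 (suc f))
    (Λ-⊆ 0 (suc f) (Λ-isSubmodule 0 f) (1∈Λ 0 f) (ϖ^*u∈Λ 0 f)
      (IsSubmodule.resp (Λ-isSubmodule 0 f) (sym (*-assoc ϖ (ϖ ^ f) w)) (IsSubmodule.scale (Λ-isSubmodule 0 f) 𝔬-ϖ (ϖ^*w∈Λ 0 f))))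
    (ϖ^*w∈Λ 0 f)
    (λ ∈Λ → ℕ.<-irrefl ≡.refl (ϖ^-*-isUnit vϖ≡1 isUnit-1 (≤ᵛ-resp (sym (*-identityʳ (ϖ ^ f)))
      (proj₂ (proj₂ (∈Λ⁻ 0 (suc f) ∈Λ Fᴱ-0 Fᴱ-0 (Fᴱ-ϖ^ f) (solve 3 (λ a w u → a :* w := con 0ℤ :+ con 0ℤ :* u :+ a :* w) refl (ϖ ^ f) w u)))))))
    (Λ-chain zero f)
  Λ-chain (suc a) f       = chain-cons (Λ-isSubmodule (suc a) f) (Λ⊆𝒪 (suc a) f)
    (Λ-⊆ (suc a) f (Λ-isSubmodule a f) (1∈Λ a f)
      (IsSubmodule.resp (Λ-isSubmodule a f) (sym (*-assoc ϖ (ϖ ^ a) u)) (IsSubmodule.scale (Λ-isSubmodule a f) 𝔬-ϖ (ϖ^*u∈Λ a f)))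
      (ϖ^*w∈Λ a f))
    (ϖ^*u∈Λ a f)
    (λ ∈Λ → ℕ.<-irrefl ≡.refl (ϖ^-*-isUnit vϖ≡1 isUnit-1 (≤ᵛ-resp (sym (*-identityʳ (ϖ ^ a)))
      (proj₁ (proj₂ (∈Λ⁻ (suc a) f ∈Λ Fᴱ-0 (Fᴱ-ϖ^ a) Fᴱ-0 (solve 3 (λ a w u → a :* u := con 0ℤ :+ a :* u :+ con 0ℤ :* w) refl (ϖ ^ a) w u)))))))
    (Λ-chain a f)

  H-0⊆Λ : ∀ a f → H a f 0# ⊆ Λ a f
  H-0⊆Λ a f = H-⊆ a f 0# (Λ-isSubmodule a f) (1∈Λ a f)
    (IsSubmodule.resp (Λ-isSubmodule a f) (sym (trans (+-congˡ (zeroˡ w)) (+-identityʳ _))) (ϖ^*u∈Λ a f)) (ϖ^*w∈Λ a f)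

  length-≐ : ∀ {O} a f → O ≐ Λ a f → S[ O ]≡ (a ℕ.+ f)
  length-≐ a f (O⊆Λ , Λ⊆O) = chain-mono O⊆Λ (Λ-chain a f) ,
    λ l C → chain-bound l a f 𝔬-0 (chain-mono (λ y∈H → Λ⊆O (H-0⊆Λ a f y∈H)) C)

-- The Gorenstein property

module GorensteinCriterion {c ℓ} {F E : NonArchimedeanLocalField c ℓ} (E/F : FiniteExtension F E)
             (unramified : FiniteExtension.Unramified E/F)
             (π : NonArchimedeanLocalField.Carrier F)
             (vπ≡1 : NonArchimedeanLocalField.IsUniformizer F π)
             {u w : NonArchimedeanLocalField.Carrier E}
             (basis : Bases.IntegralBasis E/F unramified π vπ≡1 u w) where
  open NonArchimedeanLocalField E hiding (zero)
  open Orders E/F hiding (module Lattices)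
  open Extension E/F unramified π vπ≡1
  open Bases E/F unramified π vπ≡1
  open IntegralBasis basis
  open BasisLattices E/F unramified π vπ≡1 basis
  open Length E/F unramified π vπ≡1 basis using (ϖ^*w-multiple; ϖ^*w-from-unit)
  open IntegerCoefficients commutativeRing using (solve; con; _:+_; _:*_; _:-_; :-_; _:=_)
  open import Relation.Binary.Reasoning.Setoid setoid


  module _ {a f : ℕ} (a≤f : a ℕ.≤ f) (f≤2a : f ℕ.≤ a ℕ.+ a) {O : Subset} (O≐Λ : O ≐ Λ a f) where
    private
      O⊆Λ = proj₁ O≐Λ
      Λ⊆O = proj₂ O≐Λ
      α = ϖ ^ a * u
      β = ϖ ^ f * w
      O-isSubring = Order.isSubring a≤f O≐Λ f≤2a
      module O = IsSubring O-isSubring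

      𝔬⊆O : 𝔬ᴱ ⊆ O
      𝔬⊆O oy = Λ⊆O (𝔬⊆Λ a f oy)

      O⊆𝒪 : O ⊆ 𝒪ᴱ
      O⊆𝒪 y∈O = Λ⊆𝒪 a f (O⊆Λ y∈O)

      ϖ^𝒪⊆O : ∀ {y} → f ≤ᵛ y → y ∈ O
      ϖ^𝒪⊆O f≤y = Λ⊆O (ϖ^𝒪⊆Λ a≤f f≤y)

      -- Coordinates and bounds on their valuations are decidable; this later turns a refutation of
      -- `¬ z ∈ O` into membership.
      _∈O? : ∀ {y} → 0 ≤ᵛ y → Dec (y ∈ O)
      _∈O? {y} 0≤y =
        let r , p , q , or , op , oq , eq = integral-coords 0≤y in
        case a ≤ᵛ? p of λ where
          (no a≰p)  → no λ y∈O → a≰p (proj₁ (proj₂ (∈Λ⁻ a f (O⊆Λ y∈O) (𝔬⇒Fᴱ or) (𝔬⇒Fᴱ op) (𝔬⇒Fᴱ oq) eq)))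
          (yes a≤p) → case f ≤ᵛ? q of λ where
            (no f≰q)  → no λ y∈O → f≰q (proj₂ (proj₂ (∈Λ⁻ a f (O⊆Λ y∈O) (𝔬⇒Fᴱ or) (𝔬⇒Fᴱ op) (𝔬⇒Fᴱ oq) eq)))
            (yes f≤q) → yes (Λ⊆O (∈Λ a f or (𝔬⇒Fᴱ op) (𝔬⇒Fᴱ oq) a≤p f≤q eq))

    -- For f = 2a the O-module E/O has simple socle, generated by π ^ (2a - 1) w. So if
    -- O ⊊ M ⊆ 𝒪ᴱ then this element lies in M, and it then multiplies M into M.
    module Symmetric (f≡2a : f ≡ a ℕ.+ a) where

      module _ {M : Subset} (M-isSubmodule : IsSubmodule O M) (1∈M : 1# ∈ M) {t : ℕ} (f≡1+t : f ≡ suc t) where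
        private
          module M = IsSubmodule M-isSubmodule
          M-isSubmodule-𝔬 = restrict-scalars {B = 𝔬ᴱ} 𝔬⊆O M-isSubmodule
          η = ϖ ^ t * w

          t<f : t ℕ.< f
          t<f = ℕ.≤-reflexive (≡.sym f≡1+t)

          ≰f⇒≤t : ∀ {k} → ¬ f ℕ.≤ k → k ℕ.≤ t
          ≰f⇒≤t f≰k = ℕ.s≤s⁻¹ (≡.subst (_ ℕ.<_) f≡1+t (ℕ.≰⇒> f≰k))

          O⊆M : O ⊆ M
          O⊆M {y} y∈O = M.resp (*-identityʳ y) (M.scale y∈O 1∈M)

          qw⇒η : ∀ {q} → 𝔬ᴱ q → ¬ f ≤ᵛ q → q * w ∈ M → η ∈ M
          qw⇒η oq f≰q qw∈M =
            let k , e , oe , unit , q≈ = ≉0⇒ϖ^-*-unit oq (λ q≈0 → f≰q (≤ᵛ-resp (sym q≈0) ≤ᵛ-0))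
                k≤t = ≰f⇒≤t λ f≤k → f≰q (≤ᵛ-weaken f≤k (≤ᵛ-resp (sym q≈) (≤ᵛ-*ˡ (≤ᵛ-ϖ^ vϖ≡1 k) (𝔬⇒integral oe))))
            in ϖ^*w-multiple k M-isSubmodule-𝔬 (Fᴱ-ϖ^ t) (≤ᵛ-weaken k≤t (≤ᵛ-ϖ^ vϖ≡1 t))
                 (ϖ^*w-from-unit k M-isSubmodule-𝔬 oe unit q≈ qw∈M)

          pu∈O : ∀ {p} → Fᴱ p → a ≤ᵛ p → p * u ∈ O
          pu∈O {p} Fp a≤p = Λ⊆O (∈Λ a f 𝔬-0 Fp Fᴱ-0 a≤p ≤ᵛ-0 (solve 3 (λ p u w → p :* u := con 0ℤ :+ p :* u :+ con 0ℤ :* w) refl p u w))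

          M-- : ∀ {y z} → y ∈ M → z ∈ M → y - z ∈ M
          M-- = sub-closed O-isSubring M-isSubmodule

          strip : ∀ {p q} → 𝔬ᴱ p → 𝔬ᴱ q → a ≤ᵛ p → ¬ f ≤ᵛ q → p * u + q * w ∈ M → η ∈ M
          strip {p} {q} op oq a≤p f≰q y∈M = qw⇒η oq f≰q
            (M.resp (solve 2 (λ a b → a :+ b :- a := b) refl (p * u) (q * w)) (M-- y∈M (O⊆M (pu∈O (𝔬⇒Fᴱ op) a≤p))))

          -- Here v p = a - 1. If v (π q) < f then π y = π p u + π q w reduces to π q w; otherwise
          -- α y reduces to π ^ a p ε w with ε the w-coefficient of u ^ 2.
          extremal : ∀ {a′ p q e} → a ≡ suc a′ → 𝔬ᴱ e → IsUnit e → 𝔬ᴱ q → p ≈ ϖ ^ a′ * e → p * u + q * w ∈ M → η ∈ M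
          extremal {a′} {p} {q} {e} a≡1+a′ oe unit oq p≈ y∈M = case f ≤ᵛ? (ϖ * q) of λ where
              (no f≰ϖq) → strip (𝔬-* 𝔬-ϖ op) (𝔬-* 𝔬-ϖ oq) a≤ϖp f≰ϖq
                (M.resp (solve 5 (λ v p u q w → v :* (p :* u :+ q :* w) := v :* p :* u :+ v :* q :* w) refl ϖ p u q w) (M.scale (𝔬⊆O 𝔬-ϖ) y∈M))
              (yes f≤ϖq) →
                let C , A , ε , oC , oA , oε , u²≈ = u-square
                in qw⇒η (𝔬-* oap oε) (f≰apε (u-square-coefficient-isUnit oC oA oε u²≈))
                     (M.resp (begin
                         α * (p * u + q * w) - (ϖ ^ a * p * C + ϖ ^ a * p * A * u + ϖ ^ a * u * (q * w))
                           ≈⟨ solve 7 (λ v u p z C A y → v :* u :* (p :* u :+ z) :- (v :* p :* C :+ v :* p :* A :* u :+ v :* u :* z)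
                                := v :* p :* (u :* u :- (C :+ A :* u))) refl (ϖ ^ a) u p (q * w) C A w ⟩
                         ϖ ^ a * p * (u * u - (C + A * u))
                           ≈⟨ *-congˡ (+-congʳ u²≈) ⟩
                         ϖ ^ a * p * ((C + A * u + ε * w) - (C + A * u))
                           ≈⟨ solve 4 (λ b c ε w → b :* ((c :+ ε :* w) :- c) := b :* ε :* w) refl (ϖ ^ a * p) (C + A * u) ε w ⟩
                         ϖ ^ a * p * ε * w ∎)
                       (M-- (M.scale (Λ⊆O (ϖ^*u∈Λ a f)) y∈M)
                         (O⊆M (O.+-closed (O.+-closed (𝔬⊆O (𝔬-* oap oC))
                            (pu∈O (𝔬⇒Fᴱ (𝔬-* oap oA)) (≤ᵛ-*ˡ a≤ap (𝔬⇒integral oA))))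
                            (ϖ^𝒪⊆O (f≤αqw f≤ϖq))))))
            where
            op : 𝔬ᴱ p
            op = 𝔬-resp (sym p≈) (𝔬-* (𝔬-ϖ^ a′) oe)
            oap : 𝔬ᴱ (ϖ ^ a * p)
            oap = 𝔬-* (𝔬-ϖ^ a) op
            a≤ap : a ≤ᵛ ϖ ^ a * p
            a≤ap = ≤ᵛ-*ˡ (≤ᵛ-ϖ^ vϖ≡1 a) (𝔬⇒integral op)
            a≤ϖp : a ≤ᵛ ϖ * p
            a≤ϖp = ≡.subst (_≤ᵛ ϖ * p) (≡.sym a≡1+a′) (≤ᵛ-resp (trans (*-assoc _ _ _) (*-congˡ (sym p≈)))
              (≤ᵛ-*ˡ (≤ᵛ-ϖ^ vϖ≡1 (suc a′)) (𝔬⇒integral oe)))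
            f≰apε : ∀ {ε} → IsUnit ε → ¬ f ≤ᵛ ϖ ^ a * p * ε
            -- The valuation of `ϖ ^ a * p * ε` is `a + a′`, one short of `f = 2a`.
            f≰apε {ε} unit-ε f≤ = ℕ.<-irrefl ≡.refl (ℕ.<-≤-trans a+a′<f
              (ϖ^-*-isUnit vϖ≡1 (isUnit-* unit unit-ε) (≤ᵛ-resp (begin
                ϖ ^ a * p * ε                  ≈⟨ *-congʳ (*-congˡ p≈) ⟩
                ϖ ^ a * (ϖ ^ a′ * e) * ε       ≈⟨ solve 4 (λ a b e ε → a :* (b :* e) :* ε := a :* b :* (e :* ε)) refl (ϖ ^ a) (ϖ ^ a′) e ε ⟩
                ϖ ^ a * ϖ ^ a′ * (e * ε)       ≈⟨ *-congʳ (ϖ^-+ a a′) ⟨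
                ϖ ^ (a ℕ.+ a′) * (e * ε)       ∎) f≤)))
              where
              a+a′<f : a ℕ.+ a′ ℕ.< f
              a+a′<f = ≡.subst (a ℕ.+ a′ ℕ.<_) (≡.sym f≡2a) (ℕ.+-monoʳ-< a (ℕ.≤-reflexive (≡.sym a≡1+a′)))
            f≤αqw : f ≤ᵛ ϖ * q → f ≤ᵛ ϖ ^ a * u * (q * w)
            f≤αqw f≤ϖq = ≤ᵛ-resp (begin
                (ϖ * q) * (ϖ ^ a′ * u * w)   ≈⟨ solve 5 (λ v q b u w → v :* q :* (b :* u :* w) := v :* b :* u :* (q :* w)) refl ϖ q (ϖ ^ a′) u w ⟩
                ϖ ^ suc a′ * u * (q * w)     ≈⟨ reflexive (≡.cong (λ k → ϖ ^ k * u * (q * w)) (≡.sym a≡1+a′)) ⟩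
                ϖ ^ a * u * (q * w)          ∎)
              (≤ᵛ-*ˡ f≤ϖq (≤ᵛ-* (≤ᵛ-* (integral-ϖ^ vϖ≡1 a′) 0≤u) 0≤w))

        -- After subtracting the scalar `r`, an element outside `O` fails in one of its coordinates.
        -- If only the `w`-coordinate fails, `strip` applies; otherwise a power of `ϖ` brings the
        -- `u`-coordinate to the extremal valuation `a - 1`.
        socle : ∀ {z} → z ∈ M → 0 ≤ᵛ z → ¬ z ∈ O → η ∈ M
        socle {z} z∈M 0≤z z∉O =
          let r , p , q , or , op , oq , z≈ = integral-coords 0≤z
              pu+qw∈M = M.resp (trans (+-congʳ z≈) (solve 3 (λ r a b → r :+ a :+ b :- r := a :+ b) refl r (p * u) (q * w)))
                (M-- z∈M (O⊆M (𝔬⊆O or)))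
          in case a ≤ᵛ? p of λ where
            (yes a≤p) → strip op oq a≤p
              (λ f≤q → z∉O (Λ⊆O (∈Λ a f or (𝔬⇒Fᴱ op) (𝔬⇒Fᴱ oq) a≤p f≤q z≈))) pu+qw∈M
            (no a≰p) →
              let k , e , oe , unit , p≈ = ≉0⇒ϖ^-*-unit op (λ p≈0 → a≰p (≤ᵛ-resp (sym p≈0) ≤ᵛ-0))
                  k<a = ℕ.≰⇒> λ a≤k → a≰p (≤ᵛ-weaken a≤k (≤ᵛ-resp (sym p≈) (≤ᵛ-*ˡ (≤ᵛ-ϖ^ vϖ≡1 k) (𝔬⇒integral oe))))
                  -- Raises the valuation of the `u`-coordinate from `k` to exactly `a - 1`.
                  d = a ℕ.∸ suc k
              in extremal {d ℕ.+ k} {ϖ ^ d * p} {ϖ ^ d * q}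
                   (≡.trans (≡.sym (ℕ.m∸n+n≡m k<a)) (ℕ.+-suc d k)) oe unit (𝔬-* (𝔬-ϖ^ d) oq)
                   (trans (*-congˡ p≈) (trans (sym (*-assoc _ _ _)) (*-congʳ (sym (ϖ^-+ d k)))))
                   (M.resp (solve 5 (λ v p u q w → v :* (p :* u :+ q :* w) := v :* p :* u :+ v :* q :* w) refl (ϖ ^ d) p u q w)
                     (M.scale (𝔬⊆O (𝔬-ϖ^ d)) pu+qw∈M))

        ϖ^t𝒪⊆M : η ∈ M → ∀ {y} → t ≤ᵛ y → y ∈ M
        ϖ^t𝒪⊆M η∈M {y} t≤y =
          let r , p , q , Fr , Fp , Fq , y≈ = coords y
              t≤r , t≤p , t≤q = coords-≤ᵛ Fr Fp Fq (≤ᵛ-resp y≈ t≤y)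
          in M.resp (sym y≈) (M.+-closed
               (M.+-closed (O⊆M (𝔬⊆O (integral⇒𝔬 Fr (≤ᵛ-weaken ℕ.z≤n t≤r)))) (O⊆M (pu∈O Fp (≤ᵛ-weaken a≤t t≤p))))
               (ϖ^*w-multiple t M-isSubmodule-𝔬 Fq t≤q η∈M))
          where
          a≤t : a ℕ.≤ t
          -- Here `t = 2a - 1`, and `a` is positive because `2a` is a successor.
          a≤t = half≤ a (≡.trans (≡.sym f≡1+t) f≡2a)
            where
            half≤ : ∀ a {t} → suc t ≡ a ℕ.+ a → a ℕ.≤ t
            half≤ (suc a) eq = ℕ.≤-trans (ℕ.m≤n+m (suc a) a) (ℕ.≤-reflexive (≡.sym (ℕ.suc-injective eq)))

        η∉O : ¬ η ∈ O
        η∉O η∈O = ℕ.<-irrefl ≡.refl (ℕ.<-≤-trans t<f (ϖ^-*-isUnit vϖ≡1 isUnit-1 (≤ᵛ-resp (sym (*-identityʳ (ϖ ^ t)))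
          (proj₂ (proj₂ (∈Λ⁻ a f (O⊆Λ η∈O) Fᴱ-0 Fᴱ-0 (Fᴱ-ϖ^ t)
            (solve 3 (λ a w u → a :* w := con 0ℤ :+ con 0ℤ :* u :+ a :* w) refl (ϖ ^ t) w u)))))))

      -- Dividing `I` by an element `g` of least valuation places it between `O` and 𝒪ᴱ. Were it
      -- larger than `O`, the socle element would multiply `I` into itself and so lie in `O`. Hence
      -- `I` is the principal ideal `g` times `O`, with inverse generated by `g⁻¹`.
      gorenstein : Gorenstein O
      gorenstein I I-ideal (⊆O , O⊆) =
        let g , g∈I , g≉0 , divides = least-element O-isSubring O⊆𝒪 I.finitelyGenerated I.nonzero
            g⁻¹ , gg⁻¹≈1 = inverse g g≉0
        in principal g∈I gg⁻¹≈1 (generates g∈I divides)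
        where
        module I where
          open IsFractionalIdeal I-ideal public
          open IsSubmodule isSubmodule public

        module _ {g : Carrier} (g∈I : g ∈ I) where

          g⁻¹I : Subset
          g⁻¹I z = g * z ∈ I

          g⁻¹I-isSubmodule : IsSubmodule O g⁻¹I
          g⁻¹I-isSubmodule = record
            { resp     = λ y≈z → I.resp (*-congˡ y≈z)
            ; 0-mem    = I.resp (sym (zeroʳ g)) I.0-mem
            ; +-closed = λ {y} {z} p q → I.resp (sym (distribˡ g y z)) (I.+-closed p q)
            ; scale    = λ {o} {y} o∈O p → I.resp (solve 3 (λ o g y → o :* (g :* y) := g :* (o :* y)) refl o g y) (I.scale o∈O p)
            }

          1∈g⁻¹I : 1# ∈ g⁻¹I
          1∈g⁻¹I = I.resp (sym (*-identityʳ g)) g∈I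

          generates : (∀ {y} → y ∈ I → ∃[ z ] 0 ≤ᵛ z × y ≈ g * z) → ∀ {y} → y ∈ I → ∃[ z ] z ∈ O × y ≈ g * z
          generates divides y∈I =
            let z , 0≤z , y≈ = divides y∈I in
            z , decidable-stable (0≤z ∈O?) (λ z∉O → absurd (I.resp y≈ y∈I) 0≤z z∉O (zero-or-suc f)) , y≈
            where
            zero-or-suc : ∀ n → n ≡ 0 ⊎ ∃[ t ] n ≡ suc t
            zero-or-suc zero    = inj₁ ≡.refl
            zero-or-suc (suc t) = inj₂ (t , ≡.refl)
            absurd : ∀ {z} → z ∈ g⁻¹I → 0 ≤ᵛ z → ¬ z ∈ O → f ≡ 0 ⊎ ∃[ t ] f ≡ suc t → ⊥
            -- For `f = 0` the order is 𝒪ᴱ itself, and there is no exponent `f - 1`.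
            absurd z∈ 0≤z z∉O (inj₁ f≡0) = z∉O (ϖ^𝒪⊆O (≡.subst (_≤ᵛ _) (≡.sym f≡0) 0≤z))
            -- `η` times any integral element lies in `ϖ ^ t` times 𝒪ᴱ, hence in `g⁻¹I`; so `η` is
            -- in the multiplier ring of `I`, which is `O` by hypothesis.
            absurd z∈ 0≤z z∉O (inj₂ (t , f≡1+t)) = η∉O g⁻¹I-isSubmodule 1∈g⁻¹I f≡1+t (⊆O λ {y} y∈I →
              let z′ , 0≤z′ , y≈ = divides y∈I in
              I.resp (trans (solve 3 (λ g η z → g :* (η :* z) := η :* (g :* z)) refl g (ϖ ^ t * w) z′) (*-congˡ (sym y≈)))
                (ϖ^t𝒪⊆M g⁻¹I-isSubmodule 1∈g⁻¹I f≡1+t (socle g⁻¹I-isSubmodule 1∈g⁻¹I f≡1+t z∈ 0≤z z∉O)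
                  (≤ᵛ-*ˡ (≤ᵛ-*ˡ (≤ᵛ-ϖ^ vϖ≡1 t) 0≤w) 0≤z′)))

          principal : ∀ {g⁻¹} → g * g⁻¹ ≈ 1# → (∀ {y} → y ∈ I → ∃[ z ] z ∈ O × y ≈ g * z) → Invertible O I
          principal {g⁻¹} gg⁻¹≈1 generated = J , J-ideal , IJ⊆O , O⊆IJ
            where
            J : Subset
            J = Span O (g⁻¹ ∷ [])
            g⁻¹∈J : g⁻¹ ∈ J
            g⁻¹∈J = span-generator O-isSubring (g⁻¹ ∷ []) zero
            J-ideal : IsFractionalIdeal O J
            J-ideal = record
              { isSubmodule       = span-isSubmodule O-isSubring (g⁻¹ ∷ [])
              ; finitelyGenerated = 1 , (g⁻¹ ∷ []) , (λ y∈ → y∈) , (λ y∈ → y∈)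
              ; nonzero           = g⁻¹ , g⁻¹∈J , λ g⁻¹≈0 → 1≉0 (trans (sym gg⁻¹≈1) (trans (*-congˡ g⁻¹≈0) (zeroʳ g)))
              }
            product∈O : ∀ {y z} → y ∈ I → z ∈ J → y * z ∈ O
            product∈O {y} {z} y∈I (o , o∈O , z≈) =
              let y′ , y′∈O , y≈ = generated y∈I in
              O.resp (begin
                  y′ * o zero                         ≈⟨ *-identityʳ _ ⟨
                  y′ * o zero * 1#                    ≈⟨ *-congˡ gg⁻¹≈1 ⟨
                  y′ * o zero * (g * g⁻¹)             ≈⟨ solve 4 (λ y o g i → y :* o :* (g :* i) := g :* y :* (o :* i :+ con 0ℤ)) refl y′ (o zero) g g⁻¹ ⟩
                  g * y′ * (o zero * g⁻¹ + 0#)        ≈⟨ *-cong y≈ z≈ ⟨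
                  y * z                               ∎)
                (O.*-closed y′∈O (o∈O zero))
            IJ⊆O : I · J ⊆ O
            IJ⊆O (k , b , b∈J , i , i∈I , y≈) = O.resp (sym y≈)
              (sum-closed (order⇒submodule O-isSubring 𝔬⊆O) (λ j → i j * b j) (λ j → product∈O (i∈I j) (b∈J j)))
            O⊆IJ : O ⊆ I · J
            O⊆IJ {y} y∈O = 1 , (g⁻¹ ∷ []) , (λ { zero → g⁻¹∈J }) , (y * g ∷ []) , (λ { zero → I.scale y∈O g∈I }) ,
              (begin
                y                     ≈⟨ *-identityʳ y ⟨
                y * 1#                ≈⟨ *-congˡ gg⁻¹≈1 ⟨
                y * (g * g⁻¹)         ≈⟨ solve 3 (λ y g i → y :* (g :* i) := y :* g :* i :+ con 0ℤ) refl y g g⁻¹ ⟩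
                y * g * g⁻¹ + 0#      ∎)

    -- For f < 2a the ideal I = ⟨1, π ^ (f - a) u, π ^ f w⟩ (up to scaling the dual of O) has multiplier
    -- ring O. If IJ = O, some h ∈ J is a unit of O ⊆ 𝔬 + π ^ a 𝒪ᴱ, and π ^ (f - a) u h ∈ O is absurd.
    module Asymmetric (f<2a : f ℕ.< a ℕ.+ a) where
      private
        b = f ℕ.∸ a
        b≤f : b ℕ.≤ f
        b≤f = ℕ.m∸n≤m f a
        a+b≡f : a ℕ.+ b ≡ f
        a+b≡f = ℕ.m+[n∸m]≡n a≤f
        b<a : b ℕ.< a
        b<a = ℕ.+-cancelˡ-< a b a (≡.subst (ℕ._< a ℕ.+ a) (≡.sym a+b≡f) f<2a)
        1≤a : 1 ℕ.≤ a
        1≤a = ℕ.≤-trans (ℕ.s≤s ℕ.z≤n) b<a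
        γ = ϖ ^ b * u

        I : Subset
        I = Λ b f
        module I = IsSubmodule (Λ-isSubmodule b f)

        a≤α* : ∀ {y} → 0 ≤ᵛ y → a ≤ᵛ α * y
        a≤α* 0≤y = ≤ᵛ-*ˡ (≤ᵛ-*ˡ (≤ᵛ-ϖ^ vϖ≡1 a) 0≤u) 0≤y

        f≤β* : ∀ {y} → 0 ≤ᵛ y → f ≤ᵛ β * y
        f≤β* 0≤y = ≤ᵛ-*ˡ (≤ᵛ-*ˡ (≤ᵛ-ϖ^ vϖ≡1 f) 0≤w) 0≤y

        f≤αγ* : ∀ {y} → 0 ≤ᵛ y → f ≤ᵛ α * (γ * y)
        f≤αγ* {y} 0≤y = ≡.subst (_≤ᵛ α * (γ * y)) a+b≡f
          (≤ᵛ-* (≤ᵛ-*ˡ (≤ᵛ-ϖ^ vϖ≡1 a) 0≤u) (≤ᵛ-*ˡ (≤ᵛ-*ˡ (≤ᵛ-ϖ^ vϖ≡1 b) 0≤u) 0≤y))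

        α∈I : α ∈ I
        α∈I = ∈Λ b f 𝔬-0 (Fᴱ-ϖ^ a) Fᴱ-0 (≤ᵛ-weaken (ℕ.<⇒≤ b<a) (≤ᵛ-ϖ^ vϖ≡1 a)) ≤ᵛ-0
          (solve 3 (λ p u w → p :* u := con 0ℤ :+ p :* u :+ con 0ℤ :* w) refl (ϖ ^ a) u w)

        -- The exponent `b = f - a` makes `α * γ` divisible by `ϖ ^ f`, so this product lies in `I`,
        -- as do all products with `β`; and `α` itself is in `I` because `b < a`.
        I-scale : ∀ {y z} → y ∈ O → z ∈ I → y * z ∈ I
        I-scale {y} {z} y∈O z∈I =
          let r , p , q , or , op , oq , y≈ = ∈⟨⟩⁻ (O⊆Λ y∈O)
              r′ , p′ , q′ , or′ , op′ , oq′ , z≈ = ∈⟨⟩⁻ z∈I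
          in I.resp (begin
              r * z + (p * r′ * α + (α * (γ * (p * p′)) + (β * (p * q′ * α) + β * (q * z))))
                ≈⟨ solve 10 (λ r p q z r′ p′ q′ α β γ → r :* z :+ (p :* r′ :* α :+ (α :* (γ :* (p :* p′)) :+ (β :* (p :* q′ :* α) :+ β :* (q :* z))))
                      := (r :+ q :* β) :* z :+ p :* α :* (r′ :* con 1ℤ :+ p′ :* γ :+ q′ :* β)) refl r p q z r′ p′ q′ α β γ ⟩
              (r + q * β) * z + p * α * (r′ * 1# + p′ * γ + q′ * β)
                ≈⟨ +-congˡ (*-congˡ z≈) ⟨
              (r + q * β) * z + p * α * z
                ≈⟨ solve 4 (λ r a b z → (r :+ b) :* z :+ a :* z := (r :* con 1ℤ :+ a :+ b) :* z) refl r (p * α) (q * β) z ⟩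
              (r * 1# + p * α + q * β) * z
                ≈⟨ *-congʳ y≈ ⟨
              y * z ∎)
            (I.+-closed (I.scale or z∈I) (I.+-closed (I.scale (𝔬-* op or′) α∈I)
              (ϖ^𝒪⊆Λ b≤f (≤ᵛ-+ (f≤αγ* (𝔬⇒integral (𝔬-* op op′)))
                (≤ᵛ-+ (f≤β* (≤ᵛ-* (𝔬⇒integral (𝔬-* op oq′)) (Λ⊆𝒪 a f (ϖ^*u∈Λ a f))))
                      (f≤β* (≤ᵛ-* (𝔬⇒integral oq) (Λ⊆𝒪 b f z∈I))))))))

        I-isSubmodule : IsSubmodule O I
        I-isSubmodule = record { resp = I.resp ; 0-mem = I.0-mem ; +-closed = I.+-closed ; scale = I-scale }

        I-generators = 1# ∷ γ ∷ β ∷ []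

        I-ideal : IsFractionalIdeal O I
        I-ideal = record
          { isSubmodule       = I-isSubmodule
          ; finitelyGenerated = 3 , I-generators ,
              (λ { (i , i∈𝔬 , y≈) → i , (λ j → 𝔬⊆O (i∈𝔬 j)) , y≈ }) ,
              span-⊆ I-isSubmodule I-generators (λ { zero → 1∈Λ b f ; (suc zero) → ϖ^*u∈Λ b f ; (suc (suc zero)) → ϖ^*w∈Λ b f })
          ; nonzero           = 1# , 1∈Λ b f , 1≉0
          }

        -- Test `y` on two generators. From `y * 1#` comes the bound on `q`. Up to a multiple of
        -- `ϖ ^ f`, the `w`-coordinate of `y * γ` is `ϖ ^ b * p * ε` with `ε` a unit, so
        -- `f ≤ b + v p`, that is, `a ≤ v p`.
        multiplier⊆O : multiplierRing I ⊆ O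
        multiplier⊆O {y} yI⊆I =
          let r , p , q , Fr , Fp , Fq , y≈ = coords y
              y∈I = I.resp (*-identityʳ y) (yI⊆I (1∈Λ b f))
              0≤r , b≤p , f≤q = ∈Λ⁻ b f y∈I Fr Fp Fq y≈
              C , A , ε , oC , oA , oε , u²≈ = u-square
              Fb = Fᴱ-ϖ^ b
              _ , _ , f≤bpε = ∈Λ⁻ b f
                (sub-closed 𝔬-isSubring (Λ-isSubmodule b f) (yI⊆I (ϖ^*u∈Λ b f)) (ϖ^𝒪⊆Λ b≤f (≤ᵛ-*ˡ f≤q (≤ᵛ-* (≤ᵛ-* (integral-ϖ^ vϖ≡1 b) 0≤u) 0≤w))))
                (Fᴱ-* (Fᴱ-* Fb Fp) (𝔬⇒Fᴱ oC)) (Fᴱ-+ (Fᴱ-* Fb Fr) (Fᴱ-* (Fᴱ-* Fb Fp) (𝔬⇒Fᴱ oA))) (Fᴱ-* (Fᴱ-* Fb Fp) (𝔬⇒Fᴱ oε))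
                (begin
                  y * γ - q * (γ * w)                             ≈⟨ +-congʳ (*-congʳ y≈) ⟩
                  (r + p * u + q * w) * γ - q * (γ * w)           ≈⟨ solve 6 (λ r p u q w b → (r :+ p :* u :+ q :* w) :* (b :* u) :- q :* (b :* u :* w)
                                                                       := b :* r :* u :+ b :* p :* (u :* u)) refl r p u q w (ϖ ^ b) ⟩
                  ϖ ^ b * r * u + ϖ ^ b * p * (u * u)             ≈⟨ +-congˡ (*-congˡ u²≈) ⟩
                  ϖ ^ b * r * u + ϖ ^ b * p * (C + A * u + ε * w)
                    ≈⟨ solve 8 (λ r p b u w C A ε → b :* r :* u :+ b :* p :* (C :+ A :* u :+ ε :* w) := b :* p :* C :+ (b :* r :+ b :* p :* A) :* u :+ b :* p :* ε :* w) refl r p (ϖ ^ b) u w C A ε ⟩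
                  ϖ ^ b * p * C + (ϖ ^ b * r + ϖ ^ b * p * A) * u + ϖ ^ b * p * ε * w ∎)
              f≤bp = *-cancelˡ-≤ᵛ (u-square-coefficient-isUnit oC oA oε u²≈) (≤ᵛ-resp (*-comm (ϖ ^ b * p) ε) f≤bpε)
              a≤p = ϖ^-cancel-≤ᵛ vϖ≡1 b (≡.subst (_≤ᵛ ϖ ^ b * p) (≡.trans (≡.sym a+b≡f) (ℕ.+-comm a b)) f≤bp)
          in Λ⊆O (∈Λ a f (integral⇒𝔬 Fr 0≤r) Fp Fq a≤p f≤q y≈)

        -- Modulo `ϖ ^ a` the element `h` is the scalar `r`, a unit. So modulo `ϖ ^ a` the
        -- `u`-coordinate of `γ * h` is `ϖ ^ b * r`, of valuation `b < a`, whereas membership in `O`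
        -- needs a multiple of `ϖ ^ a`.
        unit-absurd : ∀ {h} → h ∈ O → ¬ 1 ≤ᵛ h → ¬ γ * h ∈ O
        unit-absurd {h} h∈O 1≰h γh∈O =
          let r , p , q , or , op , oq , h≈ = ∈⟨⟩⁻ (O⊆Λ h∈O)
              r′ , p′ , q′ , or′ , op′ , oq′ , γh≈ = ∈⟨⟩⁻ (O⊆Λ γh∈O)
              z = p * α + q * β
              a≤z : a ≤ᵛ z
              a≤z = ≤ᵛ-+ (≤ᵛ-resp (*-comm α p) (a≤α* (𝔬⇒integral op))) (≤ᵛ-weaken a≤f (≤ᵛ-resp (*-comm β q) (f≤β* (𝔬⇒integral oq))))
              unit-r = ¬1≤ᵛ⇒isUnit (𝔬⇒integral or) λ 1≤r → 1≰h (≤ᵛ-resp (trans (solve 3 (λ r a b → r :+ (a :+ b) := r :* con 1ℤ :+ a :+ b) refl r (p * α) (q * β)) (sym h≈))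
                         (≤ᵛ-+ 1≤r (≤ᵛ-weaken 1≤a a≤z)))
              _ , a≤ , _ = coords-≤ᵛ (𝔬⇒Fᴱ or′) (Fᴱ-- (Fᴱ-* (𝔬⇒Fᴱ op′) (Fᴱ-ϖ^ a)) (Fᴱ-* (Fᴱ-ϖ^ b) (𝔬⇒Fᴱ or))) (Fᴱ-* (𝔬⇒Fᴱ oq′) (Fᴱ-ϖ^ f))
                (≤ᵛ-resp (begin
                    γ * z
                      ≈⟨ solve 4 (λ γ r a b → γ :* (a :+ b) := γ :* (r :* con 1ℤ :+ a :+ b) :- γ :* r) refl γ r (p * α) (q * β) ⟩
                    γ * (r * 1# + p * α + q * β) - γ * r
                      ≈⟨ +-congʳ (*-congˡ h≈) ⟨
                    γ * h - γ * r
                      ≈⟨ +-congʳ γh≈ ⟩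
                    (r′ * 1# + p′ * α + q′ * β) - γ * r
                      ≈⟨ solve 9 (λ r′ p′ q′ a f u w b r → (r′ :* con 1ℤ :+ p′ :* (a :* u) :+ q′ :* (f :* w)) :- b :* u :* r
                           := r′ :+ (p′ :* a :- b :* r) :* u :+ q′ :* f :* w) refl r′ p′ q′ (ϖ ^ a) (ϖ ^ f) u w (ϖ ^ b) r ⟩
                    r′ + (p′ * ϖ ^ a - ϖ ^ b * r) * u + q′ * ϖ ^ f * w ∎)
                  (≤ᵛ-*ʳ (≤ᵛ-* (integral-ϖ^ vϖ≡1 b) 0≤u) a≤z))
              a≤b = ϖ^-*-isUnit vϖ≡1 unit-r (≤ᵛ-resp (solve 2 (λ x y → x :- (x :- y) := y) refl (p′ * ϖ ^ a) (ϖ ^ b * r))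
                      (≤ᵛ-- (≤ᵛ-*ʳ (𝔬⇒integral op′) (≤ᵛ-ϖ^ vϖ≡1 a)) a≤))
          in ℕ.<-irrefl ≡.refl (ℕ.<-≤-trans b<a a≤b)

        product∈ : ∀ {J : Subset} → ∀ {y z} → y ∈ I → z ∈ J → y * z ∈ I · J
        product∈ {y = y} {z} y∈I z∈J = 1 , (z ∷ []) , (λ { zero → z∈J }) , (y ∷ []) , (λ { zero → y∈I }) , sym (+-identityʳ (y * z))

        all-1≤ᵛ : ∀ {k} (t : Vector Carrier k) → (∀ i → 1 ≤ᵛ t i) → 1 ≤ᵛ sum t
        all-1≤ᵛ {zero}  t 1≤t = ≤ᵛ-0
        all-1≤ᵛ {suc k} t 1≤t = ≤ᵛ-+ (1≤t zero) (all-1≤ᵛ (λ i → t (suc i)) (λ i → 1≤t (suc i)))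

      -- When 1 is written as a sum of products, some `i m * j m` is not divisible by `ϖ`; as `i m`
      -- is integral, neither is `j m`. Since `1#` and `γ` belong to `I`, both `j m` and `γ * j m`
      -- are in `O`.
      ¬invertible : ¬ Invertible O I
      ¬invertible (J , _ , IJ⊆O , O⊆IJ) =
        let k , j , j∈J , i , i∈I , 1≈ = O⊆IJ O.1-mem in
        case any? (λ m → ¬? (1 ≤ᵛ? (i m * j m))) of λ where
          (no none) → isUnit⇒¬1≤ᵛ isUnit-1 (≤ᵛ-resp (sym 1≈) (all-1≤ᵛ (λ m → i m * j m)
            λ m → decidable-stable (1 ≤ᵛ? (i m * j m)) λ 1≰ → none (m , 1≰)))
          (yes (m , 1≰)) → unit-absurd
            (O.resp (*-identityˡ (j m)) (IJ⊆O (product∈ {J} (1∈Λ b f) (j∈J m))))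
            (λ 1≤b → 1≰ (≤ᵛ-*ʳ (Λ⊆𝒪 b f (i∈I m)) 1≤b))
            (IJ⊆O (product∈ {J} (ϖ^*u∈Λ b f) (j∈J m)))

      ¬gorenstein : ¬ Gorenstein O
      ¬gorenstein O-gorenstein = ¬invertible (O-gorenstein I I-ideal (multiplier⊆O , λ y∈O → I-scale y∈O))

    gorenstein⇒f≡2a : Gorenstein O → f ≡ a ℕ.+ a
    gorenstein⇒f≡2a O-gorenstein = case f ℕ.≟ a ℕ.+ a of λ where
      (yes f≡2a) → f≡2a
      (no f≢2a)  → contradiction O-gorenstein (Asymmetric.¬gorenstein (ℕ.≤∧≢⇒< f≤2a f≢2a))

-- The powers 1, x, x² as an integral basis

module Monogenic {c ℓ} {F E : NonArchimedeanLocalField c ℓ} (E/F : FiniteExtension F E)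
             (degree≡3 : FiniteExtension.degree E/F ≡ 3)
             (unramified : FiniteExtension.Unramified E/F)
             (π : NonArchimedeanLocalField.Carrier F)
             (vπ≡1 : NonArchimedeanLocalField.IsUniformizer F π)
             (x : NonArchimedeanLocalField.Carrier E)
             (0≤x : NonArchimedeanLocalField.Integral E x)
             (𝒪⊆𝔬[x] : ∀ {y} → NonArchimedeanLocalField.Integral E y → Orders.𝔬[_] E/F x y) where
  private
    module F = NonArchimedeanLocalField F
    module VF = Valuation F
    module SF = Series F vπ≡1
  open NonArchimedeanLocalField E hiding (zero)
  open FiniteExtension E/F
  open IsRingHomomorphism isRingHomomorphism using (+-homo; *-homo; 0#-homo; 1#-homo; ⟦⟧-cong)
  open Orders E/F hiding (module Lattices)
  open Extension E/F unramified π vπ≡1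
  open Bases E/F unramified π vπ≡1
  open IntegerCoefficients commutativeRing using (solve; con; _:+_; _:*_; _:-_; :-_; _:=_)
  open import Relation.Binary.Reasoning.Setoid setoid
  open import Algebra.Properties.Semiring.Sum semiring using (sum-cong-≋; ∑-comm; *-distribˡ-sum; *-distribʳ-sum; sum-replicate-zero)
  open LinearDependence F.field′ VF.0≟ using (dependence; sum-zero)

  ι-sum : ∀ {n} (a : Vector F.Carrier n) → ι (F.sum a) ≈ sum (λ i → ι (a i))
  ι-sum {zero}  a = 0#-homo
  ι-sum {suc n} a = trans (+-homo _ _) (+-congˡ (ι-sum (λ i → a (suc i))))

  ι-≤ᵛ : ∀ {k a} → k VF.≤ᵛ a → k ≤ᵛ ι a
  ι-≤ᵛ {k} {a} = ≡.subst ([ ℤ.+ k ] ≤⁺_) (≡.sym (v-ι≡v a))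

  ι-injective : ∀ {a} → ι a ≈ 0# → a F.≈ F.0#
  ι-injective {a} ιa≈0 = F.v-⊤ (≡.trans (≡.sym (v-ι≡v a)) (≡.trans (v-cong ιa≈0) v-0))

  combination≈0 : ∀ {n m} (a : Vector F.Carrier n) (A : Fin n → Vector F.Carrier m) (t : Vector Carrier m) (y : Vector Carrier n) →
                  (∀ i → y i ≈ sum (λ j → ι (A i j) * t j)) →
                  (∀ j → F.sum (λ i → a i F.* A i j) F.≈ F.0#) →
                  sum (λ i → ι (a i) * y i) ≈ 0#
  combination≈0 {n} {m} a A t y y≈ aA≈0 = begin
    sum (λ i → ι (a i) * y i)
      ≈⟨ sum-cong-≋ {n} (λ i → trans (*-congˡ (y≈ i)) (*-distribˡ-sum (ι (a i)) (λ j → ι (A i j) * t j))) ⟩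
    sum (λ i → sum (λ j → ι (a i) * (ι (A i j) * t j)))
      ≈⟨ ∑-comm (λ i j → ι (a i) * (ι (A i j) * t j)) ⟩
    sum (λ j → sum (λ i → ι (a i) * (ι (A i j) * t j)))
      ≈⟨ sum-cong-≋ {m} column ⟩
    sum {m} (λ _ → 0#)
      ≈⟨ sum-replicate-zero m ⟩
    0# ∎
    where
    column : ∀ j → sum (λ i → ι (a i) * (ι (A i j) * t j)) ≈ 0#
    column j = begin
      sum (λ i → ι (a i) * (ι (A i j) * t j))     ≈⟨ sum-cong-≋ {n} (λ i → trans (sym (*-assoc _ _ _)) (*-congʳ (sym (*-homo (a i) (A i j))))) ⟩
      sum (λ i → ι (a i F.* A i j) * t j)         ≈⟨ *-distribʳ-sum (t j) (λ i → ι (a i F.* A i j)) ⟨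
      sum (λ i → ι (a i F.* A i j)) * t j         ≈⟨ *-congʳ (ι-sum (λ i → a i F.* A i j)) ⟨
      ι (F.sum (λ i → a i F.* A i j)) * t j       ≈⟨ *-congʳ (trans (⟦⟧-cong (aA≈0 j)) 0#-homo) ⟩
      0# * t j                                    ≈⟨ zeroˡ (t j) ⟩
      0#                                          ∎

  private
    Basis : ℕ → Set (c ⊔ ℓ)
    Basis d = Σ[ e ∈ Vector Carrier d ] (∀ y → Σ[ a ∈ Vector F.Carrier d ] y ≈ sum (λ i → ι (a i) * e i)) ×
                ((a : Vector F.Carrier d) → sum (λ i → ι (a i) * e i) ≈ 0# → ∀ i → a i F.≈ F.0#)

    basis₃ : Basis 3
    basis₃ = ≡.subst Basis degree≡3 (basis , spanning , independent)

    e = proj₁ basis₃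
    e-spanning = proj₁ (proj₂ basis₃)
    e-independent = proj₂ (proj₂ basis₃)

  -- Four powers of `x` in a three-dimensional space are dependent; dividing by the coefficient of
  -- least valuation keeps the relation integral and nontrivial modulo `ϖ`.
  normalised-relation : Σ[ z ∈ Vector Carrier 4 ] (∀ j → 𝔬ᴱ (z j)) × (∃[ i ] z i ≈ 1#) × sum (λ j → z j * x ^ toℕ j) ≈ 0#
  normalised-relation =
    let a , (k , aₖ≉0) , relation = dependence 3 (λ i → proj₁ (e-spanning (x ^ toℕ i)))
        i , divides = least-generator (λ i → ι (a i))
        aᵢ≉0 : ¬ ι (a i) ≈ 0#
        aᵢ≉0 = λ aᵢ≈0 → aₖ≉0 (ι-injective (let z , _ , eq = divides k in trans eq (trans (*-congʳ aᵢ≈0) (zeroˡ z))))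
        b , aᵢb≈1 = inverse _ aᵢ≉0
        z = λ j → ι (a j) * b
    in z , (λ j → let t , 0≤t , eq = divides j in
              integral⇒𝔬 (Fᴱ-* (a j , refl) (Fᴱ-inverse (a i , refl) aᵢb≈1))
                (≤ᵛ-resp (begin
                  t                   ≈⟨ *-identityʳ t ⟨
                  t * 1#              ≈⟨ *-congˡ aᵢb≈1 ⟨
                  t * (ι (a i) * b)   ≈⟨ solve 3 (λ t a b → t :* (a :* b) := a :* t :* b) refl t (ι (a i)) b ⟩
                  ι (a i) * t * b     ≈⟨ *-congʳ eq ⟨
                  ι (a j) * b         ∎) 0≤t))
         , (i , aᵢb≈1)
         , (begin
              sum (λ j → ι (a j) * b * x ^ toℕ j)
                ≈⟨ sum-cong-≋ {4} (λ j → solve 3 (λ a b x → a :* b :* x := b :* (a :* x)) refl (ι (a j)) b (x ^ toℕ j)) ⟩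
              sum (λ j → b * (ι (a j) * x ^ toℕ j))
                ≈⟨ *-distribˡ-sum b (λ j → ι (a j) * x ^ toℕ j) ⟨
              b * sum (λ j → ι (a j) * x ^ toℕ j)
                ≈⟨ *-congˡ (combination≈0 a (λ i → proj₁ (e-spanning (x ^ toℕ i))) e (λ i → x ^ toℕ i) (λ i → proj₂ (e-spanning (x ^ toℕ i))) relation) ⟩
              b * 0#
                ≈⟨ zeroʳ b ⟩
              0# ∎)

  -- This is `𝔬⟨1, x, x²⟩ + ϖ𝒪ᴱ`: the elements that the powers approximate to one digit.
  M : Subset
  M y = ∃[ r ] ∃[ p ] ∃[ q ] ∃[ h ] 𝔬ᴱ r × 𝔬ᴱ p × 𝔬ᴱ q × 0 ≤ᵛ h × y ≈ r + p * x + q * x ^ 2 + ϖ * h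

  0≤x^ : ∀ k → 0 ≤ᵛ x ^ k
  0≤x^ zero    = integral-1
  0≤x^ (suc k) = ≤ᵛ-* 0≤x (0≤x^ k)

  -- Take the unit coefficient of highest index in the relation. Multiplying by 1, `x` or `x ^ 2`
  -- moves its term to degree three, where it can be solved for; terms of higher degree are
  -- divisible by `ϖ`. The constant term cannot be the only unit, since the others would make it
  -- divisible by `ϖ`.
  x³∈M : x ^ 3 ∈ M
  x³∈M = let z , oz , (i , zᵢ≈1) , relation = normalised-relation in
         from-relation (oz zero) (oz (suc zero)) (oz (suc (suc zero))) (oz (suc (suc (suc zero))))
           (some-unit z i (isUnit-resp (sym zᵢ≈1) isUnit-1))
           (trans (solve 5 (λ a b c d x → a :+ b :* x :+ c :* (x :* x) :+ d :* (x :* x :* x) := a :* con 1ℤ :+ (b :* (x :* con 1ℤ) :+ (c :* (x :* (x :* con 1ℤ)) :+ (d :* (x :* (x :* (x :* con 1ℤ))) :+ con 0ℤ)))) refl _ _ _ _ x) relation)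
    where
    some-unit : ∀ (z : Vector Carrier 4) i → IsUnit (z i) → ¬ (1 ≤ᵛ z zero × 1 ≤ᵛ z (suc zero) × 1 ≤ᵛ z (suc (suc zero)) × 1 ≤ᵛ z (suc (suc (suc zero))))
    some-unit z zero                   unit (p , _)         = isUnit⇒¬1≤ᵛ unit p
    some-unit z (suc zero)             unit (_ , p , _)     = isUnit⇒¬1≤ᵛ unit p
    some-unit z (suc (suc zero))       unit (_ , _ , p , _) = isUnit⇒¬1≤ᵛ unit p
    some-unit z (suc (suc (suc zero))) unit (_ , _ , _ , p) = isUnit⇒¬1≤ᵛ unit p
    infix 4 _≡0modϖ
    _≡0modϖ : Carrier → Set (c ⊔ ℓ)
    t ≡0modϖ = ∃[ h ] 0 ≤ᵛ h × t ≈ ϖ * h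
    reduce : ∀ {t} → 1 ≤ᵛ t → t ≡0modϖ
    reduce {t} 1≤t = t * ϖ⁻ vϖ≡1 1 , ≤ᵛ⇒integral-*ϖ⁻ vϖ≡1 1≤t , trans (ϖ^ϖ⁻-* vϖ≡1 1 t) (*-congʳ (*-identityʳ ϖ))
    unit-or : ∀ {t} → 𝔬ᴱ t → (∃[ i ] 𝔬ᴱ i × t * i ≈ 1#) ⊎ 1 ≤ᵛ t
    unit-or ot = Sum.map₁ (λ unit → let i , oi , _ , eq = 𝔬-unit-inverse ot unit in i , oi , eq) (isUnit-or-1≤ᵛ (𝔬⇒integral ot))
    from-relation : ∀ {z₀ z₁ z₂ z₃} → 𝔬ᴱ z₀ → 𝔬ᴱ z₁ → 𝔬ᴱ z₂ → 𝔬ᴱ z₃ →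
                    ¬ (1 ≤ᵛ z₀ × 1 ≤ᵛ z₁ × 1 ≤ᵛ z₂ × 1 ≤ᵛ z₃) →
                    z₀ + z₁ * x + z₂ * (x * x) + z₃ * (x * x * x) ≈ 0# → x ^ 3 ∈ M
    from-relation {z₀} {z₁} {z₂} {z₃} o₀ o₁ o₂ o₃ ¬all relation = case unit-or o₃ of λ where
        (inj₁ (i , oi , zi≈1)) → - (i * z₀) , - (i * z₁) , - (i * z₂) , 0# , 𝔬-neg (𝔬-* oi o₀) , 𝔬-neg (𝔬-* oi o₁) , 𝔬-neg (𝔬-* oi o₂) , ≤ᵛ-0 , (begin
          x ^ 3
            ≈⟨ solve 7 (λ x a b c d i v → x :* (x :* (x :* con 1ℤ)) := :- (i :* a) :+ :- (i :* b) :* x :+ :- (i :* c) :* (x :* (x :* con 1ℤ)) :+ v :* con 0ℤ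
                          :+ i :* (a :+ b :* x :+ c :* (x :* x) :+ d :* (x :* x :* x)) :+ (x :* x :* x) :* (con 1ℤ :- d :* i)) refl x z₀ z₁ z₂ z₃ i ϖ ⟩
          - (i * z₀) + - (i * z₁) * x + - (i * z₂) * x ^ 2 + ϖ * 0# + i * (z₀ + z₁ * x + z₂ * (x * x) + z₃ * (x * x * x)) + x * x * x * (1# - z₃ * i)
            ≈⟨ vanish relation zi≈1 ⟩
          - (i * z₀) + - (i * z₁) * x + - (i * z₂) * x ^ 2 + ϖ * 0# ∎)
        (inj₂ 1≤z₃) → let h₃ , 0≤h₃ , z₃≈ = reduce 1≤z₃ in case unit-or o₂ of λ where
          (inj₁ (i , oi , zi≈1)) → 0# , - (i * z₀) , - (i * z₁) , - (i * h₃ * (x * x * x * x)) , 𝔬-0 , 𝔬-neg (𝔬-* oi o₀) , 𝔬-neg (𝔬-* oi o₁) ,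
            ≤ᵛ-neg (≤ᵛ-* (≤ᵛ-* (𝔬⇒integral oi) 0≤h₃) (≤ᵛ-* (≤ᵛ-* (≤ᵛ-* 0≤x 0≤x) 0≤x) 0≤x)) , (begin
            x ^ 3
              ≈⟨ solve 7 (λ x a b c h i v → x :* (x :* (x :* con 1ℤ)) := con 0ℤ :+ :- (i :* a) :* x :+ :- (i :* b) :* (x :* (x :* con 1ℤ)) :+ v :* :- (i :* h :* (x :* x :* x :* x))
                            :+ i :* x :* (a :+ b :* x :+ c :* (x :* x) :+ v :* h :* (x :* x :* x)) :+ (x :* x :* x) :* (con 1ℤ :- c :* i)) refl x z₀ z₁ z₂ h₃ i ϖ ⟩
            0# + - (i * z₀) * x + - (i * z₁) * x ^ 2 + ϖ * - (i * h₃ * (x * x * x * x)) + i * x * (z₀ + z₁ * x + z₂ * (x * x) + ϖ * h₃ * (x * x * x)) + x * x * x * (1# - z₂ * i)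
              ≈⟨ vanish (trans (+-congˡ (*-congʳ (sym z₃≈))) relation) zi≈1 ⟩
            0# + - (i * z₀) * x + - (i * z₁) * x ^ 2 + ϖ * - (i * h₃ * (x * x * x * x)) ∎)
          (inj₂ 1≤z₂) → let h₂ , 0≤h₂ , z₂≈ = reduce 1≤z₂ in case unit-or o₁ of λ where
            (inj₁ (i , oi , zi≈1)) → 0# , 0# , - (i * z₀) , - (i * (h₂ + h₃ * x) * (x * x * x * x)) , 𝔬-0 , 𝔬-0 , 𝔬-neg (𝔬-* oi o₀) ,
              ≤ᵛ-neg (≤ᵛ-* (≤ᵛ-* (𝔬⇒integral oi) (≤ᵛ-+ 0≤h₂ (≤ᵛ-* 0≤h₃ 0≤x))) (≤ᵛ-* (≤ᵛ-* (≤ᵛ-* 0≤x 0≤x) 0≤x) 0≤x)) , (begin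
              x ^ 3
                ≈⟨ solve 7 (λ x a b g h i v → x :* (x :* (x :* con 1ℤ)) := con 0ℤ :+ con 0ℤ :* x :+ :- (i :* a) :* (x :* (x :* con 1ℤ)) :+ v :* :- (i :* (g :+ h :* x) :* (x :* x :* x :* x))
                              :+ i :* (x :* x) :* (a :+ b :* x :+ v :* g :* (x :* x) :+ v :* h :* (x :* x :* x)) :+ (x :* x :* x) :* (con 1ℤ :- b :* i)) refl x z₀ z₁ h₂ h₃ i ϖ ⟩
              0# + 0# * x + - (i * z₀) * x ^ 2 + ϖ * - (i * (h₂ + h₃ * x) * (x * x * x * x)) + i * (x * x) * (z₀ + z₁ * x + ϖ * h₂ * (x * x) + ϖ * h₃ * (x * x * x)) + x * x * x * (1# - z₁ * i)
                ≈⟨ vanish (trans (+-cong (+-congˡ (*-congʳ (sym z₂≈))) (*-congʳ (sym z₃≈))) relation) zi≈1 ⟩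
              0# + 0# * x + - (i * z₀) * x ^ 2 + ϖ * - (i * (h₂ + h₃ * x) * (x * x * x * x)) ∎)
            (inj₂ 1≤z₁) → contradiction
              (≤ᵛ-resp (trans (solve 2 (λ a b → :- b :+ (a :+ b) := a) refl z₀ (z₁ * x + z₂ * (x * x) + z₃ * (x * x * x))) refl)
                (≤ᵛ-+ (≤ᵛ-neg (≤ᵛ-+ (≤ᵛ-+ (≤ᵛ-*ˡ 1≤z₁ 0≤x) (≤ᵛ-*ˡ 1≤z₂ (≤ᵛ-* 0≤x 0≤x))) (≤ᵛ-*ˡ 1≤z₃ (≤ᵛ-* (≤ᵛ-* 0≤x 0≤x) 0≤x))))
                      (≤ᵛ-resp (sym (trans (solve 4 (λ a b c d → a :+ (b :+ c :+ d) := a :+ b :+ c :+ d) refl z₀ (z₁ * x) (z₂ * (x * x)) (z₃ * (x * x * x))) relation)) ≤ᵛ-0)))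
              (λ 1≤z₀ → ¬all (1≤z₀ , 1≤z₁ , 1≤z₂ , 1≤z₃))
      where
      vanish : ∀ {m s t k l} → s ≈ 0# → t ≈ 1# → m + k * s + l * (1# - t) ≈ m
      vanish {m} {s} {t} {k} {l} s≈0 t≈1 = begin
        m + k * s + l * (1# - t)     ≈⟨ +-cong (+-congˡ (*-congˡ s≈0)) (*-congˡ (+-congˡ (-‿cong t≈1))) ⟩
        m + k * 0# + l * (1# - 1#)   ≈⟨ solve 3 (λ m k l → m :+ k :* con 0ℤ :+ l :* (con 1ℤ :- con 1ℤ) := m) refl m k l ⟩
        m                            ∎

  M-isSubmodule : IsSubmodule 𝔬ᴱ M
  M-isSubmodule = record
    { resp     = λ { y≈z (r , p , q , h , or , op , oq , 0≤h , y≈) → r , p , q , h , or , op , oq , 0≤h , trans (sym y≈z) y≈ }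
    ; 0-mem    = 0# , 0# , 0# , 0# , 𝔬-0 , 𝔬-0 , 𝔬-0 , ≤ᵛ-0 , solve 3 (λ x w v → con 0ℤ := con 0ℤ :+ con 0ℤ :* x :+ con 0ℤ :* w :+ v :* con 0ℤ) refl x (x ^ 2) ϖ
    ; +-closed = λ { (r , p , q , h , or , op , oq , 0≤h , y≈) (r′ , p′ , q′ , h′ , or′ , op′ , oq′ , 0≤h′ , z≈) →
        r + r′ , p + p′ , q + q′ , h + h′ , 𝔬-+ or or′ , 𝔬-+ op op′ , 𝔬-+ oq oq′ , ≤ᵛ-+ 0≤h 0≤h′ ,
        trans (+-cong y≈ z≈) (solve 11 (λ r p q h r′ p′ q′ h′ x w v → (r :+ p :* x :+ q :* w :+ v :* h) :+ (r′ :+ p′ :* x :+ q′ :* w :+ v :* h′)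
          := r :+ r′ :+ (p :+ p′) :* x :+ (q :+ q′) :* w :+ v :* (h :+ h′)) refl r p q h r′ p′ q′ h′ x (x ^ 2) ϖ) }
    ; scale    = λ { {a} oa (r , p , q , h , or , op , oq , 0≤h , y≈) →
        a * r , a * p , a * q , a * h , 𝔬-* oa or , 𝔬-* oa op , 𝔬-* oa oq , ≤ᵛ-* (𝔬⇒integral oa) 0≤h ,
        trans (*-congˡ y≈) (solve 8 (λ a r p q h x w v → a :* (r :+ p :* x :+ q :* w :+ v :* h) := a :* r :+ a :* p :* x :+ a :* q :* w :+ v :* (a :* h)) refl a r p q h x (x ^ 2) ϖ) }
    }

  x*∈M : ∀ {y} → y ∈ M → x * y ∈ M
  x*∈M {y} (r , p , q , h , or , op , oq , 0≤h , y≈) = M.resp (begin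
      (0# + r * x + p * x ^ 2 + ϖ * (x * h)) + q * x ^ 3
        ≈⟨ solve 6 (λ r p q h x v → (con 0ℤ :+ r :* x :+ p :* (x :* (x :* con 1ℤ)) :+ v :* (x :* h)) :+ q :* (x :* (x :* (x :* con 1ℤ)))
             := x :* (r :+ p :* x :+ q :* (x :* (x :* con 1ℤ)) :+ v :* h)) refl r p q h x ϖ ⟩
      x * (r + p * x + q * x ^ 2 + ϖ * h)
        ≈⟨ *-congˡ y≈ ⟨
      x * y ∎)
    (M.+-closed (0# , r , p , x * h , 𝔬-0 , or , op , ≤ᵛ-* 0≤x 0≤h , refl) (M.scale oq x³∈M))
    where module M = IsSubmodule M-isSubmodule

  x^∈M : ∀ k → x ^ k ∈ M
  x^∈M zero    = 1# , 0# , 0# , 0# , 𝔬-1 , 𝔬-0 , 𝔬-0 , ≤ᵛ-0 ,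
    solve 3 (λ x w v → con 1ℤ := con 1ℤ :+ con 0ℤ :* x :+ con 0ℤ :* w :+ v :* con 0ℤ) refl x (x ^ 2) ϖ
  x^∈M (suc k) = x*∈M (x^∈M k)

  𝒪⊆M : ∀ {y} → 0 ≤ᵛ y → y ∈ M
  𝒪⊆M 0≤y = let k , y∈ = 𝒪⊆𝔬[x] 0≤y in span-⊆ M-isSubmodule {k} (λ i → x ^ toℕ i) (λ i → x^∈M (toℕ i)) y∈

  -- Successive approximation: the digits of y at stage n give y modulo ϖ ^ n, and F is complete.
  module _ (digits : ∀ {y} → 0 ≤ᵛ y → y ∈ M) where

    𝒪⊆⟨1,x,x²⟩ : ∀ {y} → 0 ≤ᵛ y → ∃[ r ] ∃[ p ] ∃[ q ] 𝔬ᴱ r × 𝔬ᴱ p × 𝔬ᴱ q × y ≈ r + p * x + q * x ^ 2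
    𝒪⊆⟨1,x,x²⟩ {y} 0≤y =
      let r̂ , 0≤r̂ , r→r̂ = SF.series-limit r 0≤r
          p̂ , 0≤p̂ , p→p̂ = SF.series-limit p 0≤p
          q̂ , 0≤q̂ , q→q̂ = SF.series-limit q 0≤q
      in ι r̂ , ι p̂ , ι q̂ , 𝔬-ι 0≤r̂ , 𝔬-ι 0≤p̂ , 𝔬-ι 0≤q̂ ,
         x∙y⁻¹≈ε⇒x≈y y _ (≤ᵛ-all⇒≈0 λ n → ≤ᵛ-resp (sym (begin
             y - (ι r̂ + ι p̂ * x + ι q̂ * x ^ 2)
               ≈⟨ +-congʳ (expansion n) ⟩
             (ι (S r n) + ι (S p n) * x + ι (S q n) * x ^ 2 + ϖ ^ n * rest n) - (ι r̂ + ι p̂ * x + ι q̂ * x ^ 2)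
               ≈⟨ solve 9 (λ r p q r′ p′ q′ z x w → (r :+ p :* x :+ q :* w :+ z) :- (r′ :+ p′ :* x :+ q′ :* w) := (r :- r′) :+ (p :- p′) :* x :+ (q :- q′) :* w :+ z)
                    refl (ι (S r n)) (ι (S p n)) (ι (S q n)) (ι r̂) (ι p̂) (ι q̂) (ϖ ^ n * rest n) x (x ^ 2) ⟩
             (ι (S r n) - ι r̂) + (ι (S p n) - ι p̂) * x + (ι (S q n) - ι q̂) * x ^ 2 + ϖ ^ n * rest n ∎))
           (≤ᵛ-+ (≤ᵛ-+ (≤ᵛ-+ (close r→r̂ n) (≤ᵛ-*ˡ (close p→p̂ n) 0≤x)) (≤ᵛ-*ˡ (close q→q̂ n) (0≤x^ 2)))
                 (≤ᵛ-*ˡ (≤ᵛ-ϖ^ vϖ≡1 n) (proj₂ (state n)))))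
      where
      open import Algebra.Properties.Ring ring using (x∙y⁻¹≈ε⇒x≈y)
      S = SF.partialSum
      next : Σ[ z ∈ Carrier ] 0 ≤ᵛ z → Σ[ z ∈ Carrier ] 0 ≤ᵛ z
      next (z , 0≤z) = let _ , _ , _ , h , _ , _ , _ , 0≤h , _ = digits 0≤z in h , 0≤h
      state : ℕ → Σ[ z ∈ Carrier ] 0 ≤ᵛ z
      state zero    = y , 0≤y
      state (suc n) = next (state n)
      rest : ℕ → Carrier
      rest n = proj₁ (state n)
      r p q : ℕ → F.Carrier
      r n = let _ , _ , _ , _ , or , _ = digits (proj₂ (state n)) in proj₁ or
      p n = let _ , _ , _ , _ , _ , op , _ = digits (proj₂ (state n)) in proj₁ op
      q n = let _ , _ , _ , _ , _ , _ , oq , _ = digits (proj₂ (state n)) in proj₁ oq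
      0≤r : ∀ n → r n ∈ F.Integral
      0≤r n = let _ , _ , _ , _ , or , _ = digits (proj₂ (state n)) in proj₁ (proj₂ or)
      0≤p : ∀ n → p n ∈ F.Integral
      0≤p n = let _ , _ , _ , _ , _ , op , _ = digits (proj₂ (state n)) in proj₁ (proj₂ op)
      0≤q : ∀ n → q n ∈ F.Integral
      0≤q n = let _ , _ , _ , _ , _ , _ , oq , _ = digits (proj₂ (state n)) in proj₁ (proj₂ oq)
      rest≈ : ∀ n → rest n ≈ ι (r n) + ι (p n) * x + ι (q n) * x ^ 2 + ϖ * rest (suc n)
      rest≈ n = let _ , _ , _ , _ , (_ , _ , r≈) , (_ , _ , p≈) , (_ , _ , q≈) , _ , eq = digits (proj₂ (state n)) in
        trans eq (+-congʳ (+-cong (+-cong (sym r≈) (*-congʳ (sym p≈))) (*-congʳ (sym q≈))))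
      close : ∀ {a l} → (∀ k → k VF.≤ᵛ S a k F.- l) → ∀ k → k ≤ᵛ ι (S a k) - ι l
      close {a} {l} near k = ≤ᵛ-resp (ι-- (S a k) l) (ι-≤ᵛ (near k))
      ι-S : ∀ a n → ι (S a (suc n)) ≈ ι (S a n) + ϖ ^ n * ι (a n)
      ι-S a n = trans (+-homo _ _) (+-congˡ (trans (*-homo _ _) (*-congʳ (ι-^ π n))))
      expansion : ∀ n → y ≈ ι (S r n) + ι (S p n) * x + ι (S q n) * x ^ 2 + ϖ ^ n * rest n
      expansion zero    = begin
        y                                               ≈⟨ solve 3 (λ y x w → y := con 0ℤ :+ con 0ℤ :* x :+ con 0ℤ :* w :+ con 1ℤ :* y) refl y x (x ^ 2) ⟩
        0# + 0# * x + 0# * x ^ 2 + 1# * y               ≈⟨ +-congʳ (+-cong (+-cong 0#-homo (*-congʳ 0#-homo)) (*-congʳ 0#-homo)) ⟨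
        ι F.0# + ι F.0# * x + ι F.0# * x ^ 2 + 1# * y   ∎
      expansion (suc n) = begin
        y
          ≈⟨ expansion n ⟩
        ι (S r n) + ι (S p n) * x + ι (S q n) * x ^ 2 + ϖ ^ n * rest n
          ≈⟨ +-congˡ (*-congˡ (rest≈ n)) ⟩
        ι (S r n) + ι (S p n) * x + ι (S q n) * x ^ 2 + ϖ ^ n * (ι (r n) + ι (p n) * x + ι (q n) * x ^ 2 + ϖ * rest (suc n))
          ≈⟨ solve 11 (λ R P Q a r p q x w v h → R :+ P :* x :+ Q :* w :+ a :* (r :+ p :* x :+ q :* w :+ v :* h)
                := (R :+ a :* r) :+ (P :+ a :* p) :* x :+ (Q :+ a :* q) :* w :+ v :* a :* h)
               refl (ι (S r n)) (ι (S p n)) (ι (S q n)) (ϖ ^ n) (ι (r n)) (ι (p n)) (ι (q n)) x (x ^ 2) ϖ (rest (suc n)) ⟩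
        (ι (S r n) + ϖ ^ n * ι (r n)) + (ι (S p n) + ϖ ^ n * ι (p n)) * x + (ι (S q n) + ϖ ^ n * ι (q n)) * x ^ 2 + ϖ ^ suc n * rest (suc n)
          ≈⟨ +-congʳ (+-cong (+-cong (ι-S r n) (*-congʳ (ι-S p n))) (*-congʳ (ι-S q n))) ⟨
        ι (S r (suc n)) + ι (S p (suc n)) * x + ι (S q (suc n)) * x ^ 2 + ϖ ^ suc n * rest (suc n) ∎

  module _ (span : ∀ {y} → 0 ≤ᵛ y → ∃[ r ] ∃[ p ] ∃[ q ] 𝔬ᴱ r × 𝔬ᴱ p × 𝔬ᴱ q × y ≈ r + p * x + q * x ^ 2) where
    private
      coordinates : ∀ y → ∃[ r ] ∃[ p ] ∃[ q ] Fᴱ r × Fᴱ p × Fᴱ q × y ≈ r + p * x + q * x ^ 2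
      coordinates y =
        let k , 0≤ϖy = integral-ϖ^-* vϖ≡1 y
            r , p , q , or , op , oq , eq = span 0≤ϖy
            d = ϖ⁻ vϖ≡1 k
            Fd = Fᴱ-ϖ⁻ k
        in d * r , d * p , d * q , Fᴱ-* Fd (𝔬⇒Fᴱ or) , Fᴱ-* Fd (𝔬⇒Fᴱ op) , Fᴱ-* Fd (𝔬⇒Fᴱ oq) , (begin
          y                                  ≈⟨ *-identityʳ y ⟨
          y * 1#                             ≈⟨ *-congˡ (ϖ^*ϖ⁻≈1 vϖ≡1 k) ⟨
          y * (ϖ ^ k * d)                    ≈⟨ solve 3 (λ y a d → y :* (a :* d) := d :* (a :* y)) refl y (ϖ ^ k) d ⟩
          d * (ϖ ^ k * y)                    ≈⟨ *-congˡ eq ⟩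
          d * (r + p * x + q * x ^ 2)        ≈⟨ solve 6 (λ d r p q x w → d :* (r :+ p :* x :+ q :* w) := d :* r :+ d :* p :* x :+ d :* q :* w) refl d r p q x (x ^ 2) ⟩
          d * r + d * p * x + d * q * x ^ 2  ∎)

      powers : Vector Carrier 3
      powers = 1# ∷ x ∷ x ^ 2 ∷ []

      -- The three coordinate vectors of e and a relation between 1, x, x² would be four independent
      -- vectors in F³.
      independence : (a : Vector F.Carrier 3) → sum (λ j → ι (a j) * powers j) ≈ 0# → ∀ j → a j F.≈ F.0#
      independence a a≈0 j =
        let b , (k , bₖ≉0) , relation = dependence 3 A
            -- Row zero represents the vector 0, so the relation among the rows restricts to a
            -- relation among the `e i`; hence only the coefficient of `a` survives, and it is
            -- nonzero.
            rest≈0 = e-independent (λ i → b (suc i)) (begin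
              sum (λ i → ι (b (suc i)) * e i)                  ≈⟨ +-identityˡ _ ⟨
              0# + sum (λ i → ι (b (suc i)) * e i)             ≈⟨ +-congʳ (zeroʳ (ι (b zero))) ⟨
              ι (b zero) * 0# + sum (λ i → ι (b (suc i)) * e i) ≈⟨ combination≈0 b A powers (0# ∷ e) expand relation ⟩
              0#                                               ∎)
        in VF.*≈0⇒≈0 (head≉0 b k bₖ≉0 rest≈0) (F.trans (F.sym (F.trans (F.+-congˡ (sum-zero (λ i → b (suc i) F.* B i j) (λ i → F.trans (F.*-congʳ {B i j} (rest≈0 i)) (F.zeroˡ (B i j))))) (F.+-identityʳ _))) (relation j))
        where
        B : Fin 3 → Vector F.Carrier 3
        B i = let r , p , q , (r′ , _) , (p′ , _) , (q′ , _) , _ = coordinates (e i) in r′ ∷ p′ ∷ q′ ∷ []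
        A : Fin 4 → Vector F.Carrier 3
        A = a ∷ B
        expand : ∀ i → (0# ∷ e) i ≈ sum (λ j → ι (A i j) * powers j)
        expand zero    = sym a≈0
        expand (suc i) = let r , p , q , (_ , r≈) , (_ , p≈) , (_ , q≈) , eq = coordinates (e i) in
          trans eq (trans (+-cong (+-cong (sym r≈) (*-congʳ (sym p≈))) (*-congʳ (sym q≈)))
            (solve 5 (λ r p q x w → r :+ p :* x :+ q :* w := r :* con 1ℤ :+ (p :* x :+ (q :* w :+ con 0ℤ))) refl _ _ _ x (x ^ 2)))
        head≉0 : ∀ (b : Vector F.Carrier 4) k → ¬ b k F.≈ F.0# → (∀ i → b (suc i) F.≈ F.0#) → ¬ b zero F.≈ F.0#
        head≉0 b zero    bₖ≉0 _      = bₖ≉0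
        head≉0 b (suc k) bₖ≉0 rest≈0 = contradiction (rest≈0 k) bₖ≉0

      zero-coordinates : ∀ {r p q} → Fᴱ r → Fᴱ p → Fᴱ q → r + p * x + q * x ^ 2 ≈ 0# → r ≈ 0# × p ≈ 0# × q ≈ 0#
      zero-coordinates {r} {p} {q} (r′ , r≈) (p′ , p≈) (q′ , q≈) eq =
        vanish r≈ (a≈0 zero) , vanish p≈ (a≈0 (suc zero)) , vanish q≈ (a≈0 (suc (suc zero)))
        where
        a≈0 : ∀ j → (r′ ∷ p′ ∷ q′ ∷ []) j F.≈ F.0#
        a≈0 = independence (r′ ∷ p′ ∷ q′ ∷ []) (begin
          ι r′ * 1# + (ι p′ * x + (ι q′ * x ^ 2 + 0#))
            ≈⟨ solve 5 (λ r p q x w → r :* con 1ℤ :+ (p :* x :+ (q :* w :+ con 0ℤ)) := r :+ p :* x :+ q :* w) refl (ι r′) (ι p′) (ι q′) x (x ^ 2) ⟩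
          ι r′ + ι p′ * x + ι q′ * x ^ 2
            ≈⟨ +-cong (+-cong r≈ (*-congʳ p≈)) (*-congʳ q≈) ⟩
          r + p * x + q * x ^ 2
            ≈⟨ eq ⟩
          0# ∎)
        vanish : ∀ {t t′} → ι t′ ≈ t → t′ F.≈ F.0# → t ≈ 0#
        vanish t≈ t′≈0 = trans (sym t≈) (trans (⟦⟧-cong t′≈0) 0#-homo)

    power-basis′ : IntegralBasis x (x ^ 2)
    power-basis′ = record { 0≤u = 0≤x ; 0≤w = 0≤x^ 2 ; coords = coordinates ; bounded = bounded }
      where
      open import Algebra.Properties.Ring ring using (x∙y⁻¹≈ε⇒x≈y)
      bounded : ∀ {r p q} → Fᴱ r → Fᴱ p → Fᴱ q → 0 ≤ᵛ r + p * x + q * x ^ 2 → 0 ≤ᵛ r × 0 ≤ᵛ p × 0 ≤ᵛ q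
      bounded {r} {p} {q} Fr Fp Fq 0≤y =
        let r′ , p′ , q′ , or , op , oq , eq = span 0≤y
            r≈ , p≈ , q≈ = zero-coordinates (Fᴱ-- Fr (𝔬⇒Fᴱ or)) (Fᴱ-- Fp (𝔬⇒Fᴱ op)) (Fᴱ-- Fq (𝔬⇒Fᴱ oq)) (begin
              (r - r′) + (p - p′) * x + (q - q′) * x ^ 2
                ≈⟨ solve 8 (λ r p q r′ p′ q′ x w → (r :- r′) :+ (p :- p′) :* x :+ (q :- q′) :* w := (r :+ p :* x :+ q :* w) :- (r′ :+ p′ :* x :+ q′ :* w)) refl r p q r′ p′ q′ x (x ^ 2) ⟩
              (r + p * x + q * x ^ 2) - (r′ + p′ * x + q′ * x ^ 2)
                ≈⟨ +-congʳ eq ⟩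
              (r′ + p′ * x + q′ * x ^ 2) - (r′ + p′ * x + q′ * x ^ 2)
                ≈⟨ -‿inverseʳ _ ⟩
              0# ∎)
        in integral r≈ or , integral p≈ op , integral q≈ oq
        where
        integral : ∀ {t t′} → t - t′ ≈ 0# → 𝔬ᴱ t′ → 0 ≤ᵛ t
        integral t≈ ot′ = ≤ᵛ-resp (sym (x∙y⁻¹≈ε⇒x≈y _ _ t≈)) (𝔬⇒integral ot′)

  power-basis : IntegralBasis x (x ^ 2)
  power-basis = power-basis′ (𝒪⊆⟨1,x,x²⟩ 𝒪⊆M)

-- Changes of integral basis

module BasisChange {c ℓ} {F E : NonArchimedeanLocalField c ℓ} (E/F : FiniteExtension F E)
             (unramified : FiniteExtension.Unramified E/F)
             (π : NonArchimedeanLocalField.Carrier F)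
             (vπ≡1 : NonArchimedeanLocalField.IsUniformizer F π) where
  open NonArchimedeanLocalField E hiding (zero)
  open Orders E/F
  open Extension E/F unramified π vπ≡1
  open Bases E/F unramified π vπ≡1
  open IntegerCoefficients commutativeRing using (solve; con; _:+_; _:*_; _:-_; :-_; _:=_)
  open import Relation.Binary.Reasoning.Setoid setoid

  swap : ∀ {u w} → IntegralBasis u w → IntegralBasis w u
  swap {u} {w} basis = record
    { 0≤u     = 0≤w
    ; 0≤w     = 0≤u
    ; coords  = λ y → let r , p , q , Fr , Fp , Fq , eq = coords y in r , q , p , Fr , Fq , Fp , trans eq (exchange r (p * u) (q * w))
    ; bounded = λ {r} {p} {q} Fr Fp Fq 0≤y → let 0≤r , 0≤q , 0≤p = bounded Fr Fq Fp (≤ᵛ-resp (exchange r (p * w) (q * u)) 0≤y) in 0≤r , 0≤p , 0≤q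
    }
    where
    open IntegralBasis basis
    exchange : ∀ r a b → r + a + b ≈ r + b + a
    exchange = solve 3 (λ r a b → r :+ a :+ b := r :+ b :+ a) refl

  -- The substitution is unipotent with an integral entry, so it and its inverse preserve
  -- integrality of coordinates.
  shear : ∀ {u w u′ t} → IntegralBasis u w → 𝔬ᴱ t → u′ ≈ u + t * w → IntegralBasis u′ w
  shear {u} {w} {u′} {t} basis ot u′≈ = record
    { 0≤u     = ≤ᵛ-resp (sym u′≈) (≤ᵛ-+ 0≤u (≤ᵛ-* (𝔬⇒integral ot) 0≤w))
    ; 0≤w     = 0≤w
    ; coords  = λ y → let r , p , q , Fr , Fp , Fq , eq = coords y in
        r , p , q - p * t , Fr , Fp , Fᴱ-- Fq (Fᴱ-* Fp (𝔬⇒Fᴱ ot)) ,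
        trans eq (trans (solve 6 (λ r p q t u w → r :+ p :* u :+ q :* w := r :+ p :* (u :+ t :* w) :+ (q :- p :* t) :* w) refl r p q t u w)
                        (+-congʳ (+-congˡ (*-congˡ (sym u′≈)))))
    ; bounded = λ {r} {p} {q} Fr Fp Fq 0≤y →
        let 0≤r , 0≤p , 0≤q+pt = bounded Fr Fp (Fᴱ-+ Fq (Fᴱ-* Fp (𝔬⇒Fᴱ ot)))
              (≤ᵛ-resp (trans (+-congʳ (+-congˡ (*-congˡ u′≈)))
                 (solve 6 (λ r p q t u w → r :+ p :* (u :+ t :* w) :+ q :* w := r :+ p :* u :+ (q :+ p :* t) :* w) refl r p q t u w)) 0≤y)
        in 0≤r , 0≤p , ≤ᵛ-resp (solve 2 (λ q a → q :+ a :- a := q) refl q (p * t)) (≤ᵛ-- 0≤q+pt (≤ᵛ-* 0≤p (𝔬⇒integral ot)))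
    }
    where open IntegralBasis basis

-- Invariants of orders, and translation between F and E

module Invariants {c ℓ} {F E : NonArchimedeanLocalField c ℓ} (E/F : FiniteExtension F E)
             (unramified : FiniteExtension.Unramified E/F)
             (π : NonArchimedeanLocalField.Carrier F)
             (vπ≡1 : NonArchimedeanLocalField.IsUniformizer F π)
             (x : NonArchimedeanLocalField.Carrier E) (n : ℕ) where
  open NonArchimedeanLocalField E hiding (zero)
  open Orders E/F
  open Orders.Lattices E/F π x n hiding (ϖ)
  open FiniteExtension E/F using (ι; isRingHomomorphism)
  open IsRingHomomorphism isRingHomomorphism using (*-homo; ⟦⟧-cong)
  private
    module F = NonArchimedeanLocalField F
    module VF = Valuation F
  open Extension E/F unramified π vπ≡1
  open Bases E/F unramified π vπ≡1

  S-unique : ∀ {O O′ s s′} → O ≐ O′ → S[ O ]≡ s → S[ O′ ]≡ s′ → s ≡ s′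
  S-unique (O⊆O′ , O′⊆O) (C , bound) (C′ , bound′) = ℕ.≤-antisym (bound′ _ (chain-mono O′⊆O C)) (bound _ (chain-mono O⊆O′ C′))

  -- Conductors grow with the lattice, and `ϖ ^ f` is an element of one whose valuation bounds the
  -- exponent of the other.
  f-unique : ∀ {O O′ f f′} → O ≐ O′ → f[ O ]≡ f → f[ O′ ]≡ f′ → f ≡ f′
  f-unique {O} {O′} (O⊆O′ , O′⊆O) p p′ = ℕ.≤-antisym (half {O′} {O} O′⊆O p′ p) (half {O} {O′} O⊆O′ p p′)
    where
    half : ∀ {O O′ f f′} → O ⊆ O′ → f[ O ]≡ f → f[ O′ ]≡ f′ → f′ ℕ.≤ f
    half {f = f} {f′} O⊆O′ (_ , ⊆cond) (cond⊆ , _) =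
      let 0≤y , y𝒪⊆O = ⊆cond {ϖ ^ f * 1#} (1# , integral-1 , refl)
          z , 0≤z , eq = cond⊆ (0≤y , λ 0≤b → O⊆O′ (y𝒪⊆O 0≤b))
      in ϖ^-*-isUnit vϖ≡1 isUnit-1 (≤ᵛ-resp (sym eq) (≤ᵛ-*ˡ (≤ᵛ-ϖ^ vϖ≡1 f′) 0≤z))

  R⊆ : ∀ {O} → IsSubring O → 𝔬ᴱ ⊆ O → ϖ ^ n * x ∈ O → R ⊆ O
  R⊆ {O} O-isSubring 𝔬⊆O ϖ^nx∈O (k , y∈) = span-⊆ (order⇒submodule O-isSubring 𝔬⊆O) (λ i → (ϖ ^ n * x) ^ toℕ i) (λ i → power∈ (toℕ i)) y∈
    where
    module O = IsSubring O-isSubring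
    power∈ : ∀ j → (ϖ ^ n * x) ^ j ∈ O
    power∈ zero    = O.1-mem
    power∈ (suc j) = O.*-closed ϖ^nx∈O (power∈ j)

  ϖ^n*x∈R : ϖ ^ n * x ∈ R
  ϖ^n*x∈R = 2 , IsSubmodule.resp (span-isSubmodule 𝔬-isSubring {2} powers) (*-identityʳ _) (span-generator 𝔬-isSubring powers (suc zero))
    where
    powers : Vector Carrier 2
    powers i = (ϖ ^ n * x) ^ toℕ i

  ∈⟨π^⟩⇒≤ᵛ : ∀ {k a b} → (a F.- b) ∈ ⟨π^ k ⟩ → k ≤ᵛ ι a - ι b
  ∈⟨π^⟩⇒≤ᵛ {k} {a} {b} (d , 0≤d , eq) = ≤ᵛ-resp (ι-- a b) (≤ᵛ-resp (sym (trans (⟦⟧-cong eq) (trans (*-homo (π F.^ k) d) (*-congʳ (ι-^ π k)))))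
    (≤ᵛ-*ˡ (≤ᵛ-ϖ^ vϖ≡1 k) (ι-integral 0≤d)))

  ≤ᵛ⇒∈⟨π^⟩ : ∀ {k a b} → k ≤ᵛ ι a - ι b → (a F.- b) ∈ ⟨π^ k ⟩
  ≤ᵛ⇒∈⟨π^⟩ {k} {a} {b} k≤ = (a F.- b) F.* VF.ϖ⁻ vπ≡1 k ,
    VF.≤ᵛ⇒integral-*ϖ⁻ vπ≡1 (≡.subst ([ ℤ.+ k ] ≤⁺_) (v-ι≡v (a F.- b)) (≤ᵛ-resp (sym (ι-- a b)) k≤)) ,
    VF.ϖ^ϖ⁻-* vπ≡1 k (a F.- b)

-- Inequalities in s and f rewritten in terms of a = s - f

3f≡f+2f : ∀ f → 3 ℕ.* f ≡ f ℕ.+ 2 ℕ.* f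
3f≡f+2f = ℕ-solve

2s≡2a+2f : ∀ {s f} → f ℕ.≤ s → 2 ℕ.* s ≡ (s ℕ.∸ f) ℕ.+ (s ℕ.∸ f) ℕ.+ 2 ℕ.* f
2s≡2a+2f {s} {f} f≤s = ≡.trans (≡.cong (2 ℕ.*_) (≡.sym (ℕ.m∸n+n≡m f≤s))) (expand (s ℕ.∸ f) f)
  where
  expand : ∀ a f → 2 ℕ.* (a ℕ.+ f) ≡ a ℕ.+ a ℕ.+ 2 ℕ.* f
  expand = ℕ-solve

3f≤2s⇔f≤2a : ∀ {s f} → f ℕ.≤ s → 3 ℕ.* f ℕ.≤ 2 ℕ.* s ⇔ f ℕ.≤ (s ℕ.∸ f) ℕ.+ (s ℕ.∸ f)
3f≤2s⇔f≤2a {s} {f} f≤s = mk⇔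
  (λ p → ℕ.+-cancelʳ-≤ (2 ℕ.* f) _ _ (≡.subst₂ ℕ._≤_ (3f≡f+2f f) (2s≡2a+2f f≤s) p))
  (λ p → ≡.subst₂ ℕ._≤_ (≡.sym (3f≡f+2f f)) (≡.sym (2s≡2a+2f f≤s)) (ℕ.+-monoˡ-≤ (2 ℕ.* f) p))

3f≡2s⇔f≡2a : ∀ {s f} → f ℕ.≤ s → 3 ℕ.* f ≡ 2 ℕ.* s ⇔ f ≡ (s ℕ.∸ f) ℕ.+ (s ℕ.∸ f)
3f≡2s⇔f≡2a {s} {f} f≤s = mk⇔
  (λ p → ℕ.+-cancelʳ-≡ (2 ℕ.* f) _ _ (≡.trans (≡.sym (3f≡f+2f f)) (≡.trans p (2s≡2a+2f f≤s))))
  (λ p → ≡.trans (3f≡f+2f f) (≡.trans (≡.cong (ℕ._+ 2 ℕ.* f) p) (≡.sym (2s≡2a+2f f≤s))))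

-- The two families of lattices

module Families {c ℓ} {F E : NonArchimedeanLocalField c ℓ} (E/F : FiniteExtension F E)
             (unramified : FiniteExtension.Unramified E/F)
             (π : NonArchimedeanLocalField.Carrier F)
             (vπ≡1 : NonArchimedeanLocalField.IsUniformizer F π)
             (x : NonArchimedeanLocalField.Carrier E) (n : ℕ)
             (power-basis : Bases.IntegralBasis E/F unramified π vπ≡1 x (NonArchimedeanLocalField._^_ E x 2)) where
  open NonArchimedeanLocalField E hiding (zero)
  open Orders E/F
  open Orders.Lattices E/F π x n hiding (ϖ)
  open FiniteExtension E/F using (ι)
  private
    module F = NonArchimedeanLocalField F
  open Extension E/F unramified π vπ≡1
  open Bases E/F unramified π vπ≡1
  open BasisChange E/F unramified π vπ≡1
  open Invariants E/F unramified π vπ≡1 x n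
  open IntegerCoefficients commutativeRing using (solve; con; _:+_; _:*_; _:-_; :-_; _:=_)
  open import Relation.Binary.Reasoning.Setoid setoid

  module Type¹ {s f : ℕ} {c : F.Carrier} (admissible : Admissible¹ s f c) where
    f≤s = proj₁ admissible
    a = s ℕ.∸ f
    m = n ℕ.⊓ f
    k = f ℕ.∸ m
    a≤m : a ℕ.≤ m
    a≤m = proj₁ (proj₂ admissible)
    m≤f : m ℕ.≤ f
    m≤f = ℕ.m⊓n≤n n f
    a≤f = ℕ.≤-trans a≤m m≤f
    a≤n = ℕ.≤-trans a≤m (ℕ.m⊓n≤m n f)
    a+f≡s : a ℕ.+ f ≡ s
    a+f≡s = ℕ.m∸n+n≡m f≤s
    t = ι c * ϖ ^ k
    ot : 𝔬ᴱ t
    ot = 𝔬-* (𝔬-ι (proj₂ (proj₂ admissible))) (𝔬-ϖ^ k)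
    u = x + t * x ^ 2
    w = x ^ 2
    basis : IntegralBasis u w
    basis = shear power-basis ot refl
    O = O¹ s f c
    open BasisLattices E/F unramified π vπ≡1 basis public
    O≐Λ : O ≐ Λ a f
    O≐Λ = (λ y∈ → y∈) , (λ y∈ → y∈)
    open Order a≤f O≐Λ public

    -- In the basis `u`, `w` the element has coordinates `ϖ ^ n` and `- (ϖ ^ n * t)`. The factor
    -- `ϖ ^ k` of `t` was put there so that the second one reaches `n + k ≥ f`.
    ϖ^nx∈O : ϖ ^ n * x ∈ O
    ϖ^nx∈O = ∈Λ a f 𝔬-0 (Fᴱ-ϖ^ n) (Fᴱ-neg (Fᴱ-* (Fᴱ-ϖ^ n) (𝔬⇒Fᴱ ot))) (≤ᵛ-weaken a≤n (≤ᵛ-ϖ^ vϖ≡1 n))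
      (≤ᵛ-neg (≤ᵛ-weaken f≤n+k (≤ᵛ-* (≤ᵛ-ϖ^ vϖ≡1 n) (≤ᵛ-*ʳ (ι-integral (proj₂ (proj₂ admissible))) (≤ᵛ-ϖ^ vϖ≡1 k)))))
      (solve 4 (λ a x t w → a :* x := con 0ℤ :+ a :* (x :+ t :* w) :+ :- (a :* t) :* w) refl (ϖ ^ n) x t w)
      where
      f≤n+k : f ℕ.≤ n ℕ.+ k
      f≤n+k = ℕ.≤-trans (ℕ.≤-reflexive (≡.sym (ℕ.m+[n∸m]≡n m≤f))) (ℕ.+-monoˡ-≤ k (ℕ.m⊓n≤m n f))

    overorder : f ℕ.≤ a ℕ.+ a → IsOverorder R O
    overorder f≤2a = isOrder f≤2a , R⊆ (isSubring f≤2a) (𝔬⊆Λ a f) ϖ^nx∈O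

    -- The three inequalities are `a ≤ f`, `f ≤ 2a` and `a ≤ n`: admissibility gives the outer two,
    -- and the middle one is the ring condition.
    overorder⇔ : IsOverorder R O ⇔ (s ℕ.≤ 2 ℕ.* f × 3 ℕ.* f ℕ.≤ 2 ℕ.* s × s ℕ.≤ f ℕ.+ n)
    overorder⇔ = mk⇔
      (λ (O-isOrder , _) →
        ≡.subst₂ ℕ._≤_ a+f≡s (≡.cong (f ℕ.+_) (≡.sym (ℕ.+-identityʳ f))) (ℕ.+-monoˡ-≤ f a≤f) ,
        Equivalence.from (3f≤2s⇔f≤2a f≤s) (isOrder⇒f≤2a O-isOrder) ,
        ≡.subst (ℕ._≤ f ℕ.+ n) (≡.trans (ℕ.+-comm f a) a+f≡s) (ℕ.+-monoʳ-≤ f a≤n))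
      (λ (_ , 3f≤2s , _) → overorder (Equivalence.to (3f≤2s⇔f≤2a f≤s) 3f≤2s))

    invariants : (S[ O ]≡ s) × (f[ O ]≡ f)
    invariants = ≡.subst (S[ O ]≡_) a+f≡s (Length.length-≐ E/F unramified π vπ≡1 basis a f O≐Λ) , conductor-≐

    gorenstein⇔ : IsOrder O → Gorenstein O ⇔ (3 ℕ.* f ≡ 2 ℕ.* s)
    gorenstein⇔ O-isOrder = mk⇔
      (λ O-gorenstein → Equivalence.from (3f≡2s⇔f≡2a f≤s) (gorenstein⇒f≡2a a≤f f≤2a O≐Λ O-gorenstein))
      (λ 3f≡2s → Symmetric.gorenstein a≤f f≤2a O≐Λ (Equivalence.to (3f≡2s⇔f≡2a f≤s) 3f≡2s))
      where
      open GorensteinCriterion E/F unramified π vπ≡1 basis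
      f≤2a = isOrder⇒f≤2a O-isOrder

    module Comparison {c′ : F.Carrier} (0≤c′ : c′ ∈ F.Integral) where
      private
        t′ = ι c′ * ϖ ^ k
        α′ = ϖ ^ a * (x + t′ * w)
        δ = ϖ ^ a * (t′ - t)
        Fδ = Fᴱ-* (Fᴱ-ϖ^ a) (Fᴱ-- (𝔬⇒Fᴱ (𝔬-* (𝔬-ι 0≤c′) (𝔬-ϖ^ k))) (𝔬⇒Fᴱ ot))

        α′≈ : α′ ≈ 0# + ϖ ^ a * u + δ * w
        α′≈ = solve 5 (λ a x t′ t w → a :* (x :+ t′ :* w) := con 0ℤ :+ a :* (x :+ t :* w) :+ a :* (t′ :- t) :* w) refl (ϖ ^ a) x t′ t w

        δ≈ : δ ≈ ϖ ^ (a ℕ.+ k) * (ι c′ - ι c)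
        δ≈ = trans (solve 4 (λ a c′ c k → a :* (c′ :* k :- c :* k) := a :* k :* (c′ :- c)) refl (ϖ ^ a) (ι c′) (ι c) (ϖ ^ k)) (*-congʳ (sym (ϖ^-+ a k)))

        exponents : (a ℕ.+ k) ℕ.+ (m ℕ.∸ a) ≡ f
        exponents = ≡.trans (rearrange a k (m ℕ.∸ a)) (≡.trans (≡.cong (ℕ._+ k) (ℕ.m+[n∸m]≡n a≤m)) (ℕ.m+[n∸m]≡n m≤f))
          where
          rearrange : ∀ a k d → (a ℕ.+ k) ℕ.+ d ≡ (a ℕ.+ d) ℕ.+ k
          rearrange = ℕ-solve

      -- The second generators differ by `δ * w`, where `δ` is `ϖ ^ (a + k)` times the difference of
      -- the parameters. So inclusion means `f ≤ a + k + v (c′ - c)`, and `f - (a + k)` equals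
      -- `m - a`.
      close⇒⊆ : m ℕ.∸ a ≤ᵛ ι c′ - ι c → O¹ s f c′ ⊆ O
      close⇒⊆ close = ⟨⟩-⊆ 1# α′ (ϖ ^ f * w) (Λ-isSubmodule a f) (1∈Λ a f)
        (∈Λ a f 𝔬-0 (Fᴱ-ϖ^ a) Fδ (≤ᵛ-ϖ^ vϖ≡1 a)
          (≤ᵛ-resp (sym δ≈) (≡.subst (_≤ᵛ ϖ ^ (a ℕ.+ k) * (ι c′ - ι c)) exponents (≤ᵛ-* (≤ᵛ-ϖ^ vϖ≡1 (a ℕ.+ k)) close))) α′≈)
        (ϖ^*w∈Λ a f)

      ⊆⇒close : O¹ s f c′ ⊆ O → m ℕ.∸ a ≤ᵛ ι c′ - ι c
      ⊆⇒close O′⊆O = ϖ^-cancel-≤ᵛ vϖ≡1 (a ℕ.+ k) (≡.subst (_≤ᵛ ϖ ^ (a ℕ.+ k) * (ι c′ - ι c)) (≡.sym exponents) (≤ᵛ-resp δ≈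
        (proj₂ (proj₂ (∈Λ⁻ a f (O′⊆O (∈⟨⟩₂ 1# α′ (ϖ ^ f * w))) Fᴱ-0 (Fᴱ-ϖ^ a) Fδ α′≈)))))

    -- This separates the two families. Rewritten in `u` and `w`, the element has `w`-coordinate
    -- `ϖ ^ a * (1# - t₂ * t)`; the second factor is a unit because `ϖ` divides `t₂`, and `a < f`.
    mixed∉O : ∀ {t₂} → Fᴱ t₂ → 1 ≤ᵛ t₂ → a ℕ.< f → ¬ ϖ ^ a * (t₂ * x + x ^ 2) ∈ O
    mixed∉O {t₂} Ft₂ 1≤t₂ a<f ∈O = ℕ.<-irrefl ≡.refl (ℕ.<-≤-trans a<f (ϖ^-*-isUnit vϖ≡1 unit
      (proj₂ (proj₂ (∈Λ⁻ a f ∈O Fᴱ-0 (Fᴱ-* (Fᴱ-ϖ^ a) Ft₂) (Fᴱ-* (Fᴱ-ϖ^ a) (Fᴱ-- Fᴱ-1 (Fᴱ-* Ft₂ (𝔬⇒Fᴱ ot))))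
        (solve 5 (λ a x t₂ t w → a :* (t₂ :* x :+ w) := con 0ℤ :+ a :* t₂ :* (x :+ t :* w) :+ a :* (con 1ℤ :- t₂ :* t) :* w) refl (ϖ ^ a) x t₂ t w))))))
      where
      1≤t₂t : 1 ≤ᵛ t₂ * t
      1≤t₂t = ≤ᵛ-*ˡ 1≤t₂ (𝔬⇒integral ot)
      unit : IsUnit (1# - t₂ * t)
      unit = ¬1≤ᵛ⇒isUnit (≤ᵛ-- integral-1 (≤ᵛ-weaken ℕ.z≤n 1≤t₂t)) λ 1≤ →
        isUnit⇒¬1≤ᵛ isUnit-1 (≤ᵛ-resp (solve 1 (λ b → con 1ℤ :- b :+ b := con 1ℤ) refl (t₂ * t)) (≤ᵛ-+ 1≤ 1≤t₂t))

  module Type² {s f : ℕ} {c : F.Carrier} (admissible : Admissible² s f c) where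
    f≤s = proj₁ (proj₁ admissible)
    a = s ℕ.∸ f
    a<f : a ℕ.< f
    a<f = proj₂ admissible
    a≤f = ℕ.<⇒≤ a<f
    a+f≡s : a ℕ.+ f ≡ s
    a+f≡s = ℕ.m∸n+n≡m f≤s
    t = ι c * ϖ
    ot : 𝔬ᴱ t
    ot = 𝔬-* (𝔬-ι (proj₂ (proj₂ (proj₁ admissible)))) 𝔬-ϖ
    u = t * x + x ^ 2
    w = x
    basis : IntegralBasis u w
    basis = shear (swap power-basis) ot (+-comm (t * x) (x ^ 2))
    O = O² s f c
    open BasisLattices E/F unramified π vπ≡1 basis public
    O≐Λ : O ≐ Λ a f
    O≐Λ = ⟨⟩-swap
    open Order a≤f O≐Λ public

    -- Here `x` is the basis vector `w` itself, so the only nonzero coordinate is `ϖ ^ n`.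
    ϖ^nx∈O⇔ : (ϖ ^ n * x ∈ O) ⇔ (f ℕ.≤ n)
    ϖ^nx∈O⇔ = mk⇔
      (λ ∈O → ϖ^-*-isUnit vϖ≡1 isUnit-1 (≤ᵛ-resp (sym (*-identityʳ (ϖ ^ n)))
        (proj₂ (proj₂ (∈Λ⁻ a f (proj₁ O≐Λ ∈O) Fᴱ-0 Fᴱ-0 (Fᴱ-ϖ^ n) coordinates)))))
      (λ f≤n → proj₂ O≐Λ (∈Λ a f 𝔬-0 Fᴱ-0 (Fᴱ-ϖ^ n) ≤ᵛ-0 (≤ᵛ-weaken f≤n (≤ᵛ-ϖ^ vϖ≡1 n)) coordinates))
      where
      coordinates : ϖ ^ n * x ≈ 0# + 0# * u + ϖ ^ n * w
      coordinates = solve 3 (λ a x u → a :* x := con 0ℤ :+ con 0ℤ :* u :+ a :* x) refl (ϖ ^ n) x u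

    overorder : f ℕ.≤ a ℕ.+ a → f ℕ.≤ n → IsOverorder R O
    overorder f≤2a f≤n = isOrder f≤2a ,
      R⊆ (isSubring f≤2a) (λ oy → proj₂ O≐Λ (𝔬⊆Λ a f oy)) (Equivalence.from ϖ^nx∈O⇔ f≤n)

    overorder⇔ : IsOverorder R O ⇔ (s ℕ.< 2 ℕ.* f × 3 ℕ.* f ℕ.≤ 2 ℕ.* s × f ℕ.≤ n)
    overorder⇔ = mk⇔
      (λ (O-isOrder , R⊆O) →
        ≡.subst₂ ℕ._<_ a+f≡s (≡.cong (f ℕ.+_) (≡.sym (ℕ.+-identityʳ f))) (ℕ.+-monoˡ-< f a<f) ,
        Equivalence.from (3f≤2s⇔f≤2a f≤s) (isOrder⇒f≤2a O-isOrder) ,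
        Equivalence.to ϖ^nx∈O⇔ (R⊆O ϖ^n*x∈R))
      (λ (_ , 3f≤2s , f≤n) → overorder (Equivalence.to (3f≤2s⇔f≤2a f≤s) 3f≤2s) f≤n)

    invariants : (S[ O ]≡ s) × (f[ O ]≡ f)
    invariants = ≡.subst (S[ O ]≡_) a+f≡s (Length.length-≐ E/F unramified π vπ≡1 basis a f O≐Λ) , conductor-≐

    gorenstein⇔ : IsOrder O → Gorenstein O ⇔ (3 ℕ.* f ≡ 2 ℕ.* s)
    gorenstein⇔ O-isOrder = mk⇔
      (λ O-gorenstein → Equivalence.from (3f≡2s⇔f≡2a f≤s) (gorenstein⇒f≡2a a≤f f≤2a O≐Λ O-gorenstein))
      (λ 3f≡2s → Symmetric.gorenstein a≤f f≤2a O≐Λ (Equivalence.to (3f≡2s⇔f≡2a f≤s) 3f≡2s))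
      where
      open GorensteinCriterion E/F unramified π vπ≡1 basis
      f≤2a = isOrder⇒f≤2a O-isOrder

    module Comparison {c′ : F.Carrier} (0≤c′ : c′ ∈ F.Integral) where
      private
        t′ = ι c′ * ϖ
        α′ = ϖ ^ a * (t′ * x + x ^ 2)
        δ = ϖ ^ a * (t′ - t)
        Fδ = Fᴱ-* (Fᴱ-ϖ^ a) (Fᴱ-- (𝔬⇒Fᴱ (𝔬-* (𝔬-ι 0≤c′) 𝔬-ϖ)) (𝔬⇒Fᴱ ot))

        α′≈ : α′ ≈ 0# + ϖ ^ a * u + δ * w
        α′≈ = solve 5 (λ a x t′ t w → a :* (t′ :* x :+ w) := con 0ℤ :+ a :* (t :* x :+ w) :+ a :* (t′ :- t) :* x) refl (ϖ ^ a) x t′ t (x ^ 2)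

        δ≈ : δ ≈ ϖ ^ suc a * (ι c′ - ι c)
        δ≈ = solve 4 (λ a c′ c v → a :* (c′ :* v :- c :* v) := v :* a :* (c′ :- c)) refl (ϖ ^ a) (ι c′) (ι c) ϖ

        -- The factor `ϖ` in `t` lowers the required valuation from `f - a = 2f - s` for `t′ - t` to
        -- one less for `c′ - c`.
        exponents : suc a ℕ.+ (2 ℕ.* f ℕ.∸ s ℕ.∸ 1) ≡ f
        exponents = ≡.trans (≡.cong (suc a ℕ.+_) 2f∸s∸1≡) (ℕ.m+[n∸m]≡n a<f)
          where
          2f∸s∸1≡ : 2 ℕ.* f ℕ.∸ s ℕ.∸ 1 ≡ f ℕ.∸ suc a
          2f∸s∸1≡ = ≡.trans (≡.cong (ℕ._∸ 1) (≡.trans (≡.cong₂ ℕ._∸_ (≡.cong (f ℕ.+_) (ℕ.+-identityʳ f)) (≡.sym (≡.trans (ℕ.+-comm f a) a+f≡s)))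
                       (ℕ.[m+n]∸[m+o]≡n∸o f f a))) (≡.trans (ℕ.∸-+-assoc f a 1) (≡.cong (f ℕ.∸_) (ℕ.+-comm a 1)))

      close⇒⊆ : 2 ℕ.* f ℕ.∸ s ℕ.∸ 1 ≤ᵛ ι c′ - ι c → O² s f c′ ⊆ O
      close⇒⊆ close y∈ = proj₂ O≐Λ (⟨⟩-⊆ 1# (ϖ ^ f * w) α′ (Λ-isSubmodule a f) (1∈Λ a f) (ϖ^*w∈Λ a f)
        (∈Λ a f 𝔬-0 (Fᴱ-ϖ^ a) Fδ (≤ᵛ-ϖ^ vϖ≡1 a)
          (≤ᵛ-resp (sym δ≈) (≡.subst (_≤ᵛ ϖ ^ suc a * (ι c′ - ι c)) exponents (≤ᵛ-* (≤ᵛ-ϖ^ vϖ≡1 (suc a)) close))) α′≈) y∈)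

      ⊆⇒close : O² s f c′ ⊆ O → 2 ℕ.* f ℕ.∸ s ℕ.∸ 1 ≤ᵛ ι c′ - ι c
      ⊆⇒close O′⊆O = ϖ^-cancel-≤ᵛ vϖ≡1 (suc a) (≡.subst (_≤ᵛ ϖ ^ suc a * (ι c′ - ι c)) (≡.sym exponents) (≤ᵛ-resp δ≈
        (proj₂ (proj₂ (∈Λ⁻ a f (proj₁ O≐Λ (O′⊆O (∈⟨⟩₃ 1# (ϖ ^ f * w) α′))) Fᴱ-0 (Fᴱ-ϖ^ a) Fδ α′≈)))))

  ≤ᵛ-sym : ∀ {k y z} → k ≤ᵛ y - z → k ≤ᵛ z - y
  ≤ᵛ-sym {k} {y} {z} p = ≤ᵛ-resp (solve 2 (λ y z → :- (y :- z) := z :- y) refl y z) (≤ᵛ-neg p)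

  -- The parameters `s` and `f` are recovered from the lattice as its length and conductor exponent;
  -- only then can the second generators be compared over the same basis.
  O¹-≐⇔ : ∀ {s f c s′ f′ c′} → Admissible¹ s f c → Admissible¹ s′ f′ c′ →
          (O¹ s f c ≐ O¹ s′ f′ c′) ⇔ (s ≡ s′ × f ≡ f′ × (c F.- c′) ∈ ⟨π^ (n ℕ.⊓ f) ℕ.∸ (s ℕ.∸ f) ⟩)
  O¹-≐⇔ {s} {f} {c} {s′} {f′} {c′} adm adm′ = mk⇔
    (λ eq → same eq (S-unique eq (proj₁ T.invariants) (proj₁ T′.invariants)) (f-unique eq (proj₂ T.invariants) (proj₂ T′.invariants)))
    (λ { (≡.refl , ≡.refl , close) → (T′.Comparison.close⇒⊆ 0≤c (∈⟨π^⟩⇒≤ᵛ close)) , T.Comparison.close⇒⊆ 0≤c′ (≤ᵛ-sym (∈⟨π^⟩⇒≤ᵛ close)) })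
    where
    module T = Type¹ adm
    module T′ = Type¹ adm′
    0≤c = proj₂ (proj₂ adm)
    0≤c′ = proj₂ (proj₂ adm′)
    same : O¹ s f c ≐ O¹ s′ f′ c′ → s ≡ s′ → f ≡ f′ → s ≡ s′ × f ≡ f′ × (c F.- c′) ∈ ⟨π^ (n ℕ.⊓ f) ℕ.∸ (s ℕ.∸ f) ⟩
    same (_ , O′⊆O) ≡.refl ≡.refl = ≡.refl , ≡.refl , ≤ᵛ⇒∈⟨π^⟩ (≤ᵛ-sym (T.Comparison.⊆⇒close 0≤c′ O′⊆O))

  O²-≐⇔ : ∀ {s f c s′ f′ c′} → Admissible² s f c → Admissible² s′ f′ c′ →
          (O² s f c ≐ O² s′ f′ c′) ⇔ (s ≡ s′ × f ≡ f′ × (c F.- c′) ∈ ⟨π^ 2 ℕ.* f ℕ.∸ s ℕ.∸ 1 ⟩)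
  O²-≐⇔ {s} {f} {c} {s′} {f′} {c′} adm adm′ = mk⇔
    (λ eq → same eq (S-unique eq (proj₁ T.invariants) (proj₁ T′.invariants)) (f-unique eq (proj₂ T.invariants) (proj₂ T′.invariants)))
    (λ { (≡.refl , ≡.refl , close) → (T′.Comparison.close⇒⊆ 0≤c (∈⟨π^⟩⇒≤ᵛ close)) , T.Comparison.close⇒⊆ 0≤c′ (≤ᵛ-sym (∈⟨π^⟩⇒≤ᵛ close)) })
    where
    module T = Type² adm
    module T′ = Type² adm′
    0≤c = proj₂ (proj₂ (proj₁ adm))
    0≤c′ = proj₂ (proj₂ (proj₁ adm′))
    same : O² s f c ≐ O² s′ f′ c′ → s ≡ s′ → f ≡ f′ → s ≡ s′ × f ≡ f′ × (c F.- c′) ∈ ⟨π^ 2 ℕ.* f ℕ.∸ s ℕ.∸ 1 ⟩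
    same (_ , O′⊆O) ≡.refl ≡.refl = ≡.refl , ≡.refl , ≤ᵛ⇒∈⟨π^⟩ (≤ᵛ-sym (T.Comparison.⊆⇒close 0≤c′ O′⊆O))

  -- Equality would force the same `s` and `f`, hence the same `a`, with `a < f`. The third
  -- generator of the second lattice is then excluded from the first by `mixed∉O`.
  O¹≢O² : ∀ {s f c s′ f′ c′} → Admissible¹ s f c → Admissible² s′ f′ c′ → ¬ (O¹ s f c ≐ O² s′ f′ c′)
  O¹≢O² {s} {f} {c} {s′} {f′} {c′} adm adm′ eq =
    absurd eq (S-unique eq (proj₁ T.invariants) (proj₁ T′.invariants)) (f-unique eq (proj₂ T.invariants) (proj₂ T′.invariants))
    where
    module T = Type¹ adm
    module T′ = Type² adm′
    absurd : O¹ s f c ≐ O² s′ f′ c′ → s ≡ s′ → f ≡ f′ → ⊥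
    absurd (_ , O²⊆O¹) ≡.refl ≡.refl = T.mixed∉O (𝔬⇒Fᴱ T′.ot)
      (≤ᵛ-*ʳ (ι-integral (proj₂ (proj₂ (proj₁ adm′)))) (≤ᵛ-resp (*-identityʳ ϖ) (≤ᵛ-ϖ^ vϖ≡1 1)))
      T′.a<f (O²⊆O¹ (∈⟨⟩₃ 1# (ϖ ^ f * x) (ϖ ^ (s ℕ.∸ f) * (T′.t * x + x ^ 2))))

-- Every overorder belongs to one of the families

module Classification {c ℓ} {F E : NonArchimedeanLocalField c ℓ} (E/F : FiniteExtension F E)
             (unramified : FiniteExtension.Unramified E/F)
             (π : NonArchimedeanLocalField.Carrier F)
             (vπ≡1 : NonArchimedeanLocalField.IsUniformizer F π)
             (x : NonArchimedeanLocalField.Carrier E) (n : ℕ)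
             (power-basis : Bases.IntegralBasis E/F unramified π vπ≡1 x (NonArchimedeanLocalField._^_ E x 2)) where
  open NonArchimedeanLocalField E hiding (zero)
  open Orders E/F
  open Orders.Lattices E/F π x n hiding (ϖ)
  open FiniteExtension E/F using (ι)
  private
    module F = NonArchimedeanLocalField F
  open Extension E/F unramified π vπ≡1
  open Bases E/F unramified π vπ≡1
  open BasisChange E/F unramified π vπ≡1
  open Invariants E/F unramified π vπ≡1 x n
  open Families E/F unramified π vπ≡1 x n power-basis
  open Length E/F unramified π vπ≡1 power-basis
  open IntegerCoefficients commutativeRing using (solve; con; _:+_; _:*_; _:-_; :-_; _:=_)
  open import Relation.Binary.Reasoning.Setoid setoid

  adjoin-generators : ∀ {O} → IsSubmodule 𝔬ᴱ O → O ⊆ 𝒪ᴱ → ∀ {k} (g : Vector Carrier k) → (∀ m → g m ∈ O) →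
                      ∀ i j {s} → 𝔬ᴱ s → H i j s ⊆ O →
                      ∃[ i′ ] ∃[ j′ ] ∃[ s′ ] 𝔬ᴱ s′ × H i j s ⊆ H i′ j′ s′ × H i′ j′ s′ ⊆ O × (∀ m → g m ∈ H i′ j′ s′)
  adjoin-generators O-isSubmodule O⊆𝒪 {zero}  g g∈O i j {s} os H⊆O = i , j , s , os , (λ y∈ → y∈) , H⊆O , λ ()
  adjoin-generators O-isSubmodule O⊆𝒪 {suc k} g g∈O i j {s} os H⊆O =
    let open Adjoined (adjoin i j os (O⊆𝒪 (g∈O zero)))
        i″ , j″ , s″ , os″ , H′⊆H″ , H″⊆O , rest∈H″ =
          adjoin-generators O-isSubmodule O⊆𝒪 (λ m → g (suc m)) (λ m → g∈O (suc m)) i′ j′ os′ (minimal O-isSubmodule H⊆O (g∈O zero))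
    in i″ , j″ , s″ , os″ , (λ y∈ → H′⊆H″ (enlarges y∈)) , H″⊆O , λ { zero → H′⊆H″ y∈ ; (suc m) → rest∈H″ m }

  -- The reduction needs a full lattice inside `O` to start from. With `z = ϖ ^ n * x` in `O`, the
  -- products `ϖ ^ n * z` and `z * z` provide `x` and `x ^ 2` with exponent `2n`; the finitely many
  -- generators of `O` are then adjoined one by one.
  hermite-form : ∀ {O} → IsOverorder R O → ∃[ i ] ∃[ j ] ∃[ s ] 𝔬ᴱ s × O ≐ H i j s
  hermite-form {O} (O-isOrder , R⊆O) =
    let k , g , O⊆span , span⊆O = finitelyGenerated
        i , j , s , os , _ , H⊆O , g∈H = adjoin-generators O-isSubmodule (order⊆𝒪 O-isOrder) g
          (λ m → span⊆O (span-generator 𝔬-isSubring g m)) (n ℕ.+ n) (n ℕ.+ n) 𝔬-0 H⊆O₀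
    in i , j , s , os , (λ y∈O → span-⊆ (H-isSubmodule i j s) g g∈H (O⊆span y∈O)) , H⊆O
    where
    open IsOrder O-isOrder
    open IsSubring isSubring
    O-isSubmodule = order⇒submodule isSubring 𝔬-contained
    z = ϖ ^ n * x
    z∈O : z ∈ O
    z∈O = R⊆O ϖ^n*x∈R
    H⊆O₀ : H (n ℕ.+ n) (n ℕ.+ n) 0# ⊆ O
    H⊆O₀ = H-⊆ (n ℕ.+ n) (n ℕ.+ n) 0# O-isSubmodule 1-mem
      (resp (trans (solve 3 (λ a x w → a :* (a :* x) := a :* a :* x :+ con 0ℤ :* w) refl (ϖ ^ n) x (x ^ 2)) (+-congʳ (*-congʳ (sym (ϖ^-+ n n)))))
        (*-closed (𝔬-contained (𝔬-ϖ^ n)) z∈O))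
      (resp (trans (solve 2 (λ a x → a :* x :* (a :* x) := a :* a :* (x :* (x :* con 1ℤ))) refl (ϖ ^ n) x) (*-congʳ (sym (ϖ^-+ n n))))
        (*-closed z∈O z∈O))

  Normal¹ : ℕ → ℕ → Carrier → Subset
  Normal¹ a f t = 𝔬⟨ 1# , ϖ ^ a * (x + t * x ^ 2) , ϖ ^ f * x ^ 2 ⟩

  Normal² : ℕ → ℕ → Carrier → Subset
  Normal² a f t = 𝔬⟨ 1# , ϖ ^ f * x , ϖ ^ a * (t * ϖ * x + x ^ 2) ⟩

  -- The exponent a is the least valuation of the x- and x²-coordinates of elements of H i j s,
  -- and the type tells in which of the two coordinates it is attained.
  normal-form : ∀ i j {s} → 𝔬ᴱ s →
    (∃[ a ] ∃[ f ] ∃[ t ] 𝔬ᴱ t × a ℕ.≤ f × H i j s ≐ Normal¹ a f t) ⊎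
    (∃[ a ] ∃[ f ] ∃[ t ] 𝔬ᴱ t × a ℕ.< f × H i j s ≐ Normal² a f t)
  -- Ties go to the first type: the second requires the least valuation in the `x`-coordinate to be
  -- strictly larger.
  normal-form i j {s} os = case i ℕ.≤? j of λ where
      (yes i≤j) → case i ≤ᵛ? s of λ where
        (yes i≤s) → inj₁ (x-minimal i≤j i≤s)
        (no i≰s)  → case j ≤ᵛ? s of λ where
          (yes j≤s) → contradiction (≤ᵛ-weaken i≤j j≤s) i≰s
          (no j≰s)  → inj₂ (s-minimal j≰s λ k≤s i≤k → i≰s (≤ᵛ-weaken i≤k k≤s))
      (no i≰j)  → case j ≤ᵛ? s of λ where
        (yes j≤s) → inj₂ (w-minimal (ℕ.≰⇒> i≰j) j≤s)
        (no j≰s)  → inj₂ (s-minimal j≰s λ k≤s i≤k → j≰s (≤ᵛ-weaken (ℕ.≤-trans (ℕ.<⇒≤ (ℕ.≰⇒> i≰j)) i≤k) k≤s))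
    where
    g = ϖ ^ i * x + s * x ^ 2
    h = ϖ ^ j * x ^ 2
    module H = IsSubmodule (H-isSubmodule i j s)

    x-minimal : i ℕ.≤ j → i ≤ᵛ s → ∃[ a ] ∃[ f ] ∃[ t ] 𝔬ᴱ t × a ℕ.≤ f × H i j s ≐ Normal¹ a f t
    x-minimal i≤j i≤s =
      let t , ot , s≈ = ≤ᵛ⇒ϖ^∣ (𝔬⇒Fᴱ os) i≤s
          α = ϖ ^ i * (x + t * x ^ 2)
          g≈α = trans (+-congˡ (*-congʳ s≈)) (solve 4 (λ a x t w → a :* x :+ a :* t :* w := a :* (x :+ t :* w)) refl (ϖ ^ i) x t (x ^ 2))
      in i , j , t , ot , i≤j ,
         H-⊆ i j s (⟨⟩-isSubmodule 1# α h) (∈⟨⟩₁ 1# α h) (IsSubmodule.resp (⟨⟩-isSubmodule 1# α h) (sym g≈α) (∈⟨⟩₂ 1# α h)) (∈⟨⟩₃ 1# α h) ,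
         ⟨⟩-⊆ 1# α h (H-isSubmodule i j s) (H₁ i j s) (H.resp g≈α (H₂ i j s)) (H₃ i j s)

    w-minimal : j ℕ.< i → j ≤ᵛ s → ∃[ a ] ∃[ f ] ∃[ t ] 𝔬ᴱ t × a ℕ.< f × H i j s ≐ Normal² a f t
    w-minimal j<i j≤s = j , i , 0# , 𝔬-0 , j<i ,
        H-⊆ i j s N (∈⟨⟩₁ 1# β α)
          (IsSubmodule.+-closed N (∈⟨⟩₂ 1# β α) (ϖ^*w-multiple j N (𝔬⇒Fᴱ os) j≤s (IsSubmodule.resp N α≈h (∈⟨⟩₃ 1# β α))))
          (IsSubmodule.resp N α≈h (∈⟨⟩₃ 1# β α)) ,
        ⟨⟩-⊆ 1# β α (H-isSubmodule i j s) (H₁ i j s)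
          (H.resp (solve 2 (λ a b → a :+ b :- b := a) refl β (s * x ^ 2))
            (sub-closed 𝔬-isSubring (H-isSubmodule i j s) (H₂ i j s) (ϖ^*w-multiple j (H-isSubmodule i j s) (𝔬⇒Fᴱ os) j≤s (H₃ i j s))))
          (H.resp (sym α≈h) (H₃ i j s))
      where
      α = ϖ ^ j * (0# * ϖ * x + x ^ 2)
      β = ϖ ^ i * x
      N = ⟨⟩-isSubmodule 1# β α
      α≈h : α ≈ h
      α≈h = solve 4 (λ a v x w → a :* (con 0ℤ :* v :* x :+ w) := a :* w) refl (ϖ ^ j) ϖ x (x ^ 2)

    -- The pivot is `s`, of valuation `k` below both `i` and `j`. Scaling `g` by `e⁻¹` makes its
    -- `x ^ 2`-coefficient `ϖ ^ k`, and eliminating `x ^ 2` between `g` and `h` leaves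
    -- `ϖ ^ (d + i) * x`.
    s-minimal : ¬ j ≤ᵛ s → (∀ {k} → k ≤ᵛ s → ¬ i ℕ.≤ k) → ∃[ a ] ∃[ f ] ∃[ t ] 𝔬ᴱ t × a ℕ.< f × H i j s ≐ Normal² a f t
    s-minimal j≰s i≰ =
      let k , e , oe , unit , s≈ = ≉0⇒ϖ^-*-unit os (λ s≈0 → j≰s (≤ᵛ-resp (sym s≈0) ≤ᵛ-0))
          e⁻¹ , oe⁻¹ , _ , ee⁻¹≈1 = 𝔬-unit-inverse oe unit
          k≤s = ≤ᵛ-resp (sym s≈) (≤ᵛ-*ˡ (≤ᵛ-ϖ^ vϖ≡1 k) (𝔬⇒integral oe))
      in form k e e⁻¹ oe oe⁻¹ ee⁻¹≈1 s≈ (ℕ.≰⇒> λ j≤k → j≰s (≤ᵛ-weaken j≤k k≤s)) (ℕ.≰⇒> (i≰ k≤s))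
      where
      form : ∀ k e e⁻¹ → 𝔬ᴱ e → 𝔬ᴱ e⁻¹ → e * e⁻¹ ≈ 1# → s ≈ ϖ ^ k * e → k ℕ.< j → k ℕ.< i →
             ∃[ a ] ∃[ f ] ∃[ t ] 𝔬ᴱ t × a ℕ.< f × H i j s ≐ Normal² a f t
      form k e e⁻¹ oe oe⁻¹ ee⁻¹≈1 s≈ k<j k<i = k , d ℕ.+ i , t , 𝔬-* (𝔬-ϖ^ l) oe⁻¹ , ℕ.<-≤-trans k<i (ℕ.m≤n+m i d) ,
          H-⊆ i j s N (∈⟨⟩₁ 1# β α) (N.resp (sym g≈) (N.scale oe (∈⟨⟩₃ 1# β α)))
            (N.resp (sym h≈) (sub-closed 𝔬-isSubring N (N.scale (𝔬-ϖ^ d) (∈⟨⟩₃ 1# β α)) (N.scale oe⁻¹ (∈⟨⟩₂ 1# β α)))) ,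
          ⟨⟩-⊆ 1# β α (H-isSubmodule i j s) (H₁ i j s)
            (H.resp (sym β≈) (sub-closed 𝔬-isSubring (H-isSubmodule i j s) (H.scale (𝔬-ϖ^ d) (H₂ i j s)) (H.scale oe (H₃ i j s))))
            (H.resp (sym α≈) (H.scale oe⁻¹ (H₂ i j s)))
        where
        d = j ℕ.∸ k
        -- One less than `i - k`, because the `x`-coefficient of the normal form carries a factor
        -- `ϖ` besides `t`; it is exact since `k < i`.
        l = i ℕ.∸ suc k
        t = ϖ ^ l * e⁻¹
        α = ϖ ^ k * (t * ϖ * x + x ^ 2)
        β = ϖ ^ (d ℕ.+ i) * x
        N = ⟨⟩-isSubmodule 1# β α
        module N = IsSubmodule N
        ϖ^i≈ : ϖ ^ i ≈ ϖ * ϖ ^ k * ϖ ^ l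
        ϖ^i≈ = ϖ^-∸ k<i
        ϖ^j≈ : ϖ ^ j ≈ ϖ ^ k * ϖ ^ d
        ϖ^j≈ = ϖ^-∸ (ℕ.<⇒≤ k<j)
        cancel : ∀ y → e * (e⁻¹ * y) ≈ y
        cancel y = trans (sym (*-assoc e e⁻¹ y)) (trans (*-congʳ ee⁻¹≈1) (*-identityˡ y))
        α≈ : α ≈ e⁻¹ * g
        α≈ = begin
          ϖ ^ k * (ϖ ^ l * e⁻¹ * ϖ * x + x ^ 2)
            ≈⟨ solve 6 (λ K L i v x w → K :* (L :* i :* v :* x :+ w) := i :* (v :* K :* L :* x) :+ K :* w) refl (ϖ ^ k) (ϖ ^ l) e⁻¹ ϖ x (x ^ 2) ⟩
          e⁻¹ * (ϖ * ϖ ^ k * ϖ ^ l * x) + ϖ ^ k * x ^ 2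
            ≈⟨ +-cong (*-congˡ (*-congʳ (sym ϖ^i≈))) (sym (cancel _)) ⟩
          e⁻¹ * (ϖ ^ i * x) + e * (e⁻¹ * (ϖ ^ k * x ^ 2))
            ≈⟨ solve 5 (λ e i y K w → i :* y :+ e :* (i :* (K :* w)) := i :* (y :+ K :* e :* w)) refl e e⁻¹ (ϖ ^ i * x) (ϖ ^ k) (x ^ 2) ⟩
          e⁻¹ * (ϖ ^ i * x + ϖ ^ k * e * x ^ 2)
            ≈⟨ *-congˡ (+-congˡ (*-congʳ (sym s≈))) ⟩
          e⁻¹ * g ∎
        g≈ : g ≈ e * α
        g≈ = trans (sym (cancel g)) (*-congˡ (sym α≈))
        β≈ : β ≈ ϖ ^ d * g - e * h
        β≈ = begin
          ϖ ^ (d ℕ.+ i) * x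
            ≈⟨ *-congʳ (ϖ^-+ d i) ⟩
          ϖ ^ d * ϖ ^ i * x
            ≈⟨ solve 6 (λ D I x K e w → D :* I :* x := D :* (I :* x :+ K :* e :* w) :- e :* (K :* D :* w)) refl (ϖ ^ d) (ϖ ^ i) x (ϖ ^ k) e (x ^ 2) ⟩
          ϖ ^ d * (ϖ ^ i * x + ϖ ^ k * e * x ^ 2) - e * (ϖ ^ k * ϖ ^ d * x ^ 2)
            ≈⟨ +-cong (*-congˡ (+-congˡ (*-congʳ (sym s≈)))) (-‿cong (*-congˡ (*-congʳ (sym ϖ^j≈)))) ⟩
          ϖ ^ d * g - e * h ∎
        h≈ : h ≈ ϖ ^ d * α - e⁻¹ * β
        h≈ = begin
          h
            ≈⟨ trans (sym (*-identityˡ h)) (*-congʳ (sym ee⁻¹≈1)) ⟩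
          e * e⁻¹ * h
            ≈⟨ solve 5 (λ e i h D g → e :* i :* h := D :* (i :* g) :- i :* (D :* g :- e :* h)) refl e e⁻¹ h (ϖ ^ d) g ⟩
          ϖ ^ d * (e⁻¹ * g) - e⁻¹ * (ϖ ^ d * g - e * h)
            ≈⟨ +-cong (*-congˡ (sym α≈)) (-‿cong (*-congˡ (sym β≈))) ⟩
          ϖ ^ d * α - e⁻¹ * β ∎

  -- The coordinates of `ϖ ^ n * x`, which lies in `O`, give `a ≤ n` and `f ≤ n + v t`. The second
  -- bound makes `t` divisible by `ϖ ^ k`, and the quotient is `c`; for `n > f` the exponent `k` is
  -- zero.
  normal¹⇒type¹ : ∀ {O a f t} → IsOverorder R O → 𝔬ᴱ t → a ℕ.≤ f → O ≐ Normal¹ a f t →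
                  ∃[ s ] ∃[ f ] ∃[ c ] Overorder¹ s f c × O ≐ O¹ s f c
  normal¹⇒type¹ {O} {a} {f} {t} (O-isOrder , R⊆O) ot a≤f O≐N =
    let t′ , (c , 0≤c , ιc≈) , t≈ = ≤ᵛ⇒ϖ^∣ (𝔬⇒Fᴱ ot) k≤t
    in a ℕ.+ f , f , c , overorder c 0≤c (trans t≈ (trans (*-comm _ _) (*-congʳ (sym ιc≈))))
    where
    basis = shear power-basis ot refl
    open BasisLattices E/F unramified π vπ≡1 basis
    m = n ℕ.⊓ f
    k = f ℕ.∸ m
    f≤2a : f ℕ.≤ a ℕ.+ a
    f≤2a = Order.isOrder⇒f≤2a a≤f O≐N O-isOrder
    membership = ∈Λ⁻ a f (proj₁ O≐N (R⊆O ϖ^n*x∈R)) Fᴱ-0 (Fᴱ-ϖ^ n) (Fᴱ-neg (Fᴱ-* (Fᴱ-ϖ^ n) (𝔬⇒Fᴱ ot)))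
      (solve 4 (λ a x t w → a :* x := con 0ℤ :+ a :* (x :+ t :* w) :+ :- (a :* t) :* w) refl (ϖ ^ n) x t (x ^ 2))
    a≤n : a ℕ.≤ n
    a≤n = ϖ^-*-isUnit vϖ≡1 isUnit-1 (≤ᵛ-resp (sym (*-identityʳ (ϖ ^ n))) (proj₁ (proj₂ membership)))
    f≤ϖ^nt : f ≤ᵛ ϖ ^ n * t
    f≤ϖ^nt = ≤ᵛ-resp (solve 1 (λ y → :- (:- y) := y) refl (ϖ ^ n * t)) (≤ᵛ-neg (≤ᵛ-resp (solve 2 (λ a t → :- (a :* t) := :- (a :* t)) refl (ϖ ^ n) t) (proj₂ (proj₂ membership))))
    k≤t : k ≤ᵛ t
    k≤t = case n ℕ.≤? f of λ where
      (yes n≤f) → ≡.subst (λ m → f ℕ.∸ m ≤ᵛ t) (≡.sym (ℕ.m≤n⇒m⊓n≡m n≤f))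
        (ϖ^-cancel-≤ᵛ vϖ≡1 n (≡.subst (_≤ᵛ ϖ ^ n * t) (≡.sym (ℕ.m+[n∸m]≡n n≤f)) f≤ϖ^nt))
      (no n≰f)  → ≡.subst (_≤ᵛ t) (≡.sym (≡.trans (≡.cong (f ℕ.∸_) (ℕ.m≥n⇒m⊓n≡n (ℕ.<⇒≤ (ℕ.≰⇒> n≰f)))) (ℕ.n∸n≡0 f))) (𝔬⇒integral ot)
    overorder : ∀ c → c ∈ F.Integral → t ≈ ι c * ϖ ^ k → Overorder¹ (a ℕ.+ f) f c × O ≐ O¹ (a ℕ.+ f) f c
    overorder c 0≤c t≈ = (admissible , Type¹.overorder admissible (≡.subst (λ a → f ℕ.≤ a ℕ.+ a) (≡.sym a≡) f≤2a)) ,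
      ≐-trans {O} {Normal¹ a f t} {O¹ (a ℕ.+ f) f c} O≐N (⟨⟩-cong (*-cong (reflexive (≡.cong (ϖ ^_) (≡.sym a≡))) (+-congˡ (*-congʳ t≈))) refl)
      where
      a≡ : a ℕ.+ f ℕ.∸ f ≡ a
      a≡ = ℕ.m+n∸n≡m a f
      admissible : Admissible¹ (a ℕ.+ f) f c
      admissible = ℕ.m≤n+m f a , ≡.subst (ℕ._≤ m) (≡.sym a≡) (ℕ.⊓-glb a≤n a≤f) , 0≤c

  -- The parameter `t` already serves as `c`; membership of `ϖ ^ n * x` supplies `f ≤ n`.
  normal²⇒type² : ∀ {O a f t} → IsOverorder R O → 𝔬ᴱ t → a ℕ.< f → O ≐ Normal² a f t →
                  ∃[ s ] ∃[ f ] ∃[ c ] Overorder² s f c × O ≐ O² s f c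
  normal²⇒type² {O} {a} {f} {t} (O-isOrder , R⊆O) (c , 0≤c , ιc≈t) a<f O≐N =
    a ℕ.+ f , f , c , (admissible , Type².overorder admissible f≤2a f≤n) , O≐O²
    where
    a≡ : a ℕ.+ f ℕ.∸ f ≡ a
    a≡ = ℕ.m+n∸n≡m a f
    a<f′ : a ℕ.+ f ℕ.∸ f ℕ.< f
    a<f′ = ≡.subst (ℕ._< f) (≡.sym a≡) a<f
    O≐O² : O ≐ O² (a ℕ.+ f) f c
    O≐O² = ≐-trans {O} {Normal² a f t} {O² (a ℕ.+ f) f c} O≐N
      (⟨⟩-cong refl (*-cong (reflexive (≡.cong (ϖ ^_) (≡.sym a≡))) (+-congʳ (*-congʳ (*-congʳ (sym ιc≈t))))))
    basis = shear (swap power-basis) (𝔬-* (c , 0≤c , ιc≈t) 𝔬-ϖ) (+-comm (t * ϖ * x) (x ^ 2))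
    open BasisLattices E/F unramified π vπ≡1 basis
    O≐Λ : O ≐ Λ a f
    O≐Λ = ≐-trans {O} {Normal² a f t} {Λ a f} O≐N ⟨⟩-swap
    f≤2a : f ℕ.≤ (a ℕ.+ f ℕ.∸ f) ℕ.+ (a ℕ.+ f ℕ.∸ f)
    f≤2a = ≡.subst (λ a → f ℕ.≤ a ℕ.+ a) (≡.sym a≡) (Order.isOrder⇒f≤2a (ℕ.<⇒≤ a<f) O≐Λ O-isOrder)
    f≤n : f ℕ.≤ n
    f≤n = ϖ^-*-isUnit vϖ≡1 isUnit-1 (≤ᵛ-resp (sym (*-identityʳ (ϖ ^ n))) (proj₂ (proj₂
      (∈Λ⁻ a f (proj₁ O≐Λ (R⊆O ϖ^n*x∈R)) Fᴱ-0 Fᴱ-0 (Fᴱ-ϖ^ n)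
        (solve 3 (λ a x u → a :* x := con 0ℤ :+ con 0ℤ :* u :+ a :* x) refl (ϖ ^ n) x (t * ϖ * x + x ^ 2))))))
    admissible : Admissible² (a ℕ.+ f) f c
    admissible = (ℕ.m≤n+m f a , ℕ.⊓-glb (ℕ.≤-trans (ℕ.<⇒≤ a<f′) f≤n) (ℕ.<⇒≤ a<f′) , 0≤c) , a<f′

  classification : ∀ O → IsOverorder R O →
    (∃[ s ] ∃[ f ] ∃[ c ] Overorder¹ s f c × O ≐ O¹ s f c) ⊎
    (∃[ s ] ∃[ f ] ∃[ c ] Overorder² s f c × O ≐ O² s f c)
  classification O O-overorder =
    let i , j , s , os , O≐H = hermite-form O-overorder in
    Sum.map
      (λ (a , f , t , ot , a≤f , H≐N) → normal¹⇒type¹ O-overorder ot a≤f (≐-trans {O} {H i j s} {Normal¹ a f t} O≐H H≐N))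
      (λ (a , f , t , ot , a<f , H≐N) → normal²⇒type² O-overorder ot a<f (≐-trans {O} {H i j s} {Normal² a f t} O≐H H≐N))
      (normal-form i j os)

open import Data.Nat.Base using (_+_; _*_; _∸_; _⊓_; _≤_; _<_)

corollary4p3 :
    {a ℓ : Level} {F E : NonArchimedeanLocalField a ℓ} (E/F : FiniteExtension F E) →
    let module F = NonArchimedeanLocalField F
        module E = NonArchimedeanLocalField E
        open FiniteExtension E/F
        open Orders E/F
    in
    degree ≡ 3 → Unramified →
    (π : F.Carrier) → F.IsUniformizer π →
    (x : E.Carrier) → x ∈ 𝒪ᴱˣ → 𝒪ᴱ ≐ 𝔬[ x ] →
    (n : ℕ) →
    let open Lattices π x n in
    (∀ s f c → Admissible¹ s f c →
      IsOverorder R (O¹ s f c) ⇔ (s ≤ 2 * f × 3 * f ≤ 2 * s × s ≤ f + n)) ×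
    (∀ s f c → Admissible² s f c →
      IsOverorder R (O² s f c) ⇔ (s < 2 * f × 3 * f ≤ 2 * s × f ≤ n)) ×
    (∀ s f c → Overorder¹ s f c → (S[ O¹ s f c ]≡ s) × (f[ O¹ s f c ]≡ f)) ×
    (∀ s f c → Overorder² s f c → (S[ O² s f c ]≡ s) × (f[ O² s f c ]≡ f)) ×
    (∀ s f c s′ f′ c′ → Overorder¹ s f c → Overorder¹ s′ f′ c′ →
      (O¹ s f c ≐ O¹ s′ f′ c′) ⇔
      (s ≡ s′ × f ≡ f′ × (c F.- c′) ∈ ⟨π^ (n ⊓ f) ∸ (s ∸ f) ⟩)) ×
    (∀ s f c s′ f′ c′ → Overorder² s f c → Overorder² s′ f′ c′ →
      (O² s f c ≐ O² s′ f′ c′) ⇔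
      (s ≡ s′ × f ≡ f′ × (c F.- c′) ∈ ⟨π^ 2 * f ∸ s ∸ 1 ⟩)) ×
    (∀ s f c s′ f′ c′ → Overorder¹ s f c → Overorder² s′ f′ c′ → s′ < 2 * f′ →
      ¬ (O¹ s f c ≐ O² s′ f′ c′)) ×
    (∀ s f c → Overorder¹ s f c → Gorenstein (O¹ s f c) ⇔ (3 * f ≡ 2 * s)) ×
    (∀ s f c → Overorder² s f c → Gorenstein (O² s f c) ⇔ (3 * f ≡ 2 * s)) ×
    (∀ O → IsOverorder R O →
      (∃[ s ] ∃[ f ] ∃[ c ] Overorder¹ s f c × O ≐ O¹ s f c) ⊎
      (∃[ s ] ∃[ f ] ∃[ c ] Overorder² s f c × O ≐ O² s f c))
corollary4p3 E/F degree≡3 unramified π vπ≡1 x (0≤x , _) (𝒪⊆𝔬[x] , _) n =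
  (λ s f c adm → Type¹.overorder⇔ adm) ,
  (λ s f c adm → Type².overorder⇔ adm) ,
  (λ s f c (adm , _) → Type¹.invariants adm) ,
  (λ s f c (adm , _) → Type².invariants adm) ,
  (λ s f c s′ f′ c′ (adm , _) (adm′ , _) → O¹-≐⇔ adm adm′) ,
  (λ s f c s′ f′ c′ (adm , _) (adm′ , _) → O²-≐⇔ adm adm′) ,
  (λ s f c s′ f′ c′ (adm , _) (adm′ , _) _ → O¹≢O² adm adm′) ,
  (λ s f c (adm , O-isOrder , _) → Type¹.gorenstein⇔ adm O-isOrder) ,
  (λ s f c (adm , O-isOrder , _) → Type².gorenstein⇔ adm O-isOrder) ,
  classification
  where
  power-basis = Monogenic.power-basis E/F degree≡3 unramified π vπ≡1 x 0≤x 𝒪⊆𝔬[x]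
  open Families E/F unramified π vπ≡1 x n power-basis
  open Classification E/F unramified π vπ≡1 x n power-basis
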